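{- Let $(a_n)_{n\ge0}$ be the sequence, listed in increasing order, of the non-negative integers $m$ such that $840m+529$ is a perfect square. Define $t(n)=0$ if $n\equiv 0,2,3,6,9,12,13,15 \pmod{16}$ and $t(n)=1$ otherwise. Then $$\sum_{n=0}^\infty(-1)^{t(n)}q^{a_n}=\frac{(q,q^6,q^7;q^7)_\infty}{(q^2,q^3;q^5)_\infty}.$$
   Context: Here $q$ is a complex number with $|q|<1$ (equivalently, the identity may be read as an identity of formal power series in $q$). For a complex number $a$, $(a;q)_\infty:=\prod_{i=0}^\infty(1-aq^i)$, and $(a_1,a_2,\dots,a_m;q)_\infty:=\prod_{j=1}^m(a_j;q)_\infty$. -}

module Defs where

open import Data.Nat as ℕ using (ℕ; zero; suc; _∸_; _≤_; z≤n; s≤s; _%_)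
open import Data.Nat.Divisibility using (_∣_; _∣?_)
open import Data.Nat.Properties using (m≤m*n; _≟_)
open import Data.Integer as ℤ using (ℤ; +_; -_; _-_; _*_; _+_; _^_)
open import Data.Fin using (Fin; toℕ; fromℕ<)
open import Data.Fin.Properties using (any?; toℕ-fromℕ<)
open import Data.Product using (∃; ∃-syntax; _,_)
open import Data.List using (List; []; _∷_)
open import Data.List.Membership.DecPropositional _≟_ using (_∈?_)
open import Relation.Nullary using (Dec; yes; no; ¬_)
open import Relation.Binary.PropositionalEquality using (_≡_; refl; subst; sym; trans; cong)

IsSquare : ℕ → Set
IsSquare k = ∃[ j ] j ℕ.* j ≡ k

private
  sq-bound : ∀ j k → j ℕ.* j ≡ k → j ≤ k
  sq-bound zero k p = z≤n
  sq-bound j@(suc _) k p = subst (j ≤_) p (m≤m*n j j)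

isSquare? : (k : ℕ) → Dec (IsSquare k)
isSquare? k with any? {n = suc k} (λ (j : Fin (suc k)) → toℕ j ℕ.* toℕ j ≟ k)
... | yes (j , p) = yes (toℕ j , p)
... | no ¬p = no λ { (j , p) →
        ¬p (fromℕ< (s≤s (sq-bound j k p)) ,
            subst (λ x → x ℕ.* x ≡ k) (sym (toℕ-fromℕ< (s≤s (sq-bound j k p)))) p) }

-- The set S = { m ≥ 0 : 840 m + 529 is a perfect square }, and the
-- number of elements of S strictly below m.  If a_0 < a_1 < ... lists S
-- in increasing order, then m = a_n  iff  m ∈ S and countBelow m = n.

InS : ℕ → Set
InS m = IsSquare (840 ℕ.* m ℕ.+ 529)

inS? : (m : ℕ) → Dec (InS m)
inS? m = isSquare? (840 ℕ.* m ℕ.+ 529)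

countBelow : ℕ → ℕ
countBelow zero = zero
countBelow (suc m) with inS? m
... | yes _ = suc (countBelow m)
... | no  _ = countBelow m

t : ℕ → ℕ
t n with (n % 16) ∈? (0 ∷ 2 ∷ 3 ∷ 6 ∷ 9 ∷ 12 ∷ 13 ∷ 15 ∷ [])
... | yes _ = 0
... | no  _ = 1

-- Formal power series in q with integer coefficients: coefficient maps.

PS : Set
PS = ℕ → ℤ

sumTo : ℕ → (ℕ → ℤ) → ℤ
sumTo zero    f = f zero
sumTo (suc n) f = sumTo n f + f (suc n)

_⊛_ : PS → PS → PS
(f ⊛ g) n = sumTo n (λ i → f i * g (n ∸ i))

infixl 7 _⊛_

oneP : PS
oneP zero    = + 1
oneP (suc _) = + 0

mono : ℕ → PS
mono e n with n ≟ e
... | yes _ = + 1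
... | no  _ = + 0

oneMinus : ℕ → PS
oneMinus e n = oneP n - mono e n

-- 1/(1 - q^e) = Σ_j q^{e j}   (used only for e ≥ 1)
geomInv : ℕ → PS
geomInv e n with e ∣? n
... | yes _ = + 1
... | no  _ = + 0

prodTo : ℕ → (ℕ → PS) → PS
prodTo zero    F = oneP
prodTo (suc k) F = prodTo k F ⊛ F k

-- (q^a; q^d)_∞ = ∏_{i≥0} (1 - q^{a + d i}), for a ≥ 1.
-- Since a + d i ≥ i + 1, the factors with i > N do not affect the
-- coefficient of q^N, so that coefficient is read off a finite product.
poch∞ : ℕ → ℕ → PS
poch∞ a d N = prodTo (suc N) (λ i → oneMinus (a ℕ.+ d ℕ.* i)) N

-- 1/(q^a; q^d)_∞ = ∏_{i≥0} 1/(1 - q^{a + d i}), for a ≥ 1 (same truncation).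
invPoch∞ : ℕ → ℕ → PS
invPoch∞ a d N = prodTo (suc N) (λ i → geomInv (a ℕ.+ d ℕ.* i)) N

lhsSeries : PS
lhsSeries m with inS? m
... | yes _ = (- (+ 1)) ^ t (countBelow m)
... | no  _ = + 0

rhsSeries : PS
rhsSeries = (poch∞ 1 7 ⊛ poch∞ 6 7 ⊛ poch∞ 7 7) ⊛ (invPoch∞ 2 5 ⊛ invPoch∞ 3 5)

{-# OPTIONS --safe #-}
-- Multiply both sides by (q;q)_∞ = (q,q²,q³;q³)_∞. On the right this gives
-- (q,q⁴,q⁵;q⁵)_∞ (q,q⁶,q⁷;q⁷)_∞, so by the Jacobi triple product (applied three times)
-- the claim becomes an identity between two signed sums over ℤ², whose exponents are
-- governed by 35 (6c+1)² + j² on the left (840 m + 529 = j²) and by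
-- 3 (7 x² + 5 y²), x = 10 a + 3, y = ± (14 b + 5), on the right. The substitution
-- x = 2 u + y, j = 7 u + 6 y identifies the two forms. In the coordinates (u , y) the right
-- side is the sum over u, y odd, and the left side is the sum over u coprime to 6 with the
-- sign - (-1)^y. The difference is removed by two isometries: (u , y) ↦ (u + y , - y) reverses
-- the sign and preserves {u odd, y even}, so that part sums to 0; and
-- (3 v , y) ↦ (- 3 v , y + 7 v) exchanges y odd and y even among the terms with u odd, 3 ∣ u.

module Submission where

open import Defs
open import Algebra.Bundles using (CommutativeRing; CommutativeSemiring)
import Algebra.Properties.Ring as RingProperties
import Algebra.Solver.Ring.NaturalCoefficients.Default as SemiringSolver
open import Data.Integer as ℤ using (ℤ; +_; -[1+_]; -_; _+_; _*_; _-_)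
open import Data.Integer.DivMod using (_%ℕ_; _/ℕ_; n%ℕd<d; a≡a%ℕn+[a/ℕn]*n)
import Data.Integer.Properties as ℤ
open import Data.Integer.Tactic.RingSolver using (solve-∀)
open import Data.List using (List; []; _∷_)
open import Data.Nat as ℕ using (ℕ; zero; suc; _∸_; _≤_; _<_; z≤n; s≤s)
open import Data.List.Membership.DecPropositional ℕ._≟_ using (_∈_; _∈?_)
open import Data.Nat.Divisibility using (_∣_; _∣?_; ∣m∣n⇒∣m+n; ∣m+n∣m⇒∣n; ∣⇒≤; _∣0; ∣-refl)
open import Data.Nat.DivMod using (m≡m%n+[m/n]*n; m%n<n; [m+kn]%n≡m%n; m*n/n≡m)
import Data.Nat.Properties as ℕ
import Data.Nat.Tactic.RingSolver as ℕ-Solver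
open import Data.Product using (_×_; _,_; proj₁; proj₂; ∃-syntax)
open import Data.Product.Properties using (≡-dec)
open import Data.Sum using (_⊎_; inj₁; inj₂; [_,_]′)
open import Function using (_∘_)
open import Level using (0ℓ)
open import Relation.Binary.Definitions using (tri<; tri≈; tri>)
open import Relation.Binary.PropositionalEquality using (_≡_; _≢_; refl; sym; trans; cong; cong₂; subst; subst₂; module ≡-Reasoning)
import Relation.Binary.Reasoning.Setoid as SetoidReasoning
open import Relation.Nullary using (Dec; yes; no; ¬_; contradiction)
open import Relation.Nullary.Decidable using (from-yes; _⊎-dec_; _×-dec_; _→-dec_)

-- The factor (q;q)_∞ is introduced because a single square j² has no useful symmetry, whereas
-- adding 35 (6c+1)² produces a binary form with two diagonal shapes, j² + 35 u² and 21 x² + 15 y².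
-- Each of the two isometries changes one sign in one shape. Changing the sign of y with x fixed is
-- integral everywhere; changing the sign of u with j fixed moves y by 7 u / 3, which is integral
-- only for 3 ∣ u. This is why the terms with u coprime to 6 and those with 3 ∣ u are treated apart.
-- The signs and congruence conditions are periodic functions, so that identities between them
-- reduce to checks over one period. Convergence is avoided: everything is proved modulo q^(N+1),
-- with sums over one box large enough to hold all points that contribute. A linear substitution
-- does not map a box to itself, so sums are compared by matching the points of nonzero weight
-- rather than by permuting the box.

module SemiringIdentities {c ℓ} (R : CommutativeSemiring c ℓ) where
  open CommutativeSemiring R using (_≈_)
    renaming (_+_ to infixl 6 _⊞_; _*_ to infixl 7 _⊡_)
  open SemiringSolver R
  private
    ≈-refl = CommutativeSemiring.refl R

  *-interchange : ∀ a b c d → (a ⊡ b) ⊡ (c ⊡ d) ≈ (a ⊡ c) ⊡ (b ⊡ d)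
  *-interchange = solve 4 (λ a b c d → (a :* b) :* (c :* d) := (a :* c) :* (b :* d)) ≈-refl

  *-rotate : ∀ a b c → a ⊡ (b ⊡ c) ≈ c ⊡ (a ⊡ b)
  *-rotate = solve 3 (λ a b c → a :* (b :* c) := c :* (a :* b)) ≈-refl

  *-pull : ∀ a b c → (a ⊡ b) ⊡ c ≈ b ⊡ (a ⊡ c)
  *-pull = solve 3 (λ a b c → (a :* b) :* c := b :* (a :* c)) ≈-refl

  *-inner-interchange : ∀ a b c d → (a ⊡ (b ⊡ c)) ⊡ d ≈ (a ⊡ b) ⊡ (d ⊡ c)
  *-inner-interchange = solve 4 (λ a b c d → (a :* (b :* c)) :* d := (a :* b) :* (d :* c)) ≈-refl

  *-distribˡ-+-comm : ∀ a b c → a ⊡ (b ⊞ c) ≈ a ⊡ c ⊞ a ⊡ b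
  *-distribˡ-+-comm = solve 3 (λ a b c → a :* (b :+ c) := a :* c :+ a :* b) ≈-refl

  gauss-expand : ∀ A p g p′ g′ u v y → (A ⊡ (v ⊞ y ⊡ u)) ⊡ ((p ⊡ g) ⊡ (p′ ⊡ g′)) ≈
    (A ⊡ ((p ⊡ g) ⊡ p′)) ⊡ (v ⊡ g′) ⊞ (y ⊡ (A ⊡ (p ⊡ (p′ ⊡ g′)))) ⊡ (u ⊡ g)
  gauss-expand = solve 8 (λ A p g p′ g′ u v y →
    (A :* (v :+ y :* u)) :* ((p :* g) :* (p′ :* g′)) :=
    (A :* ((p :* g) :* p′)) :* (v :* g′) :+ (y :* (A :* (p :* (p′ :* g′)))) :* (u :* g)) ≈-refl

  regroup₃ : ∀ a b c x y z → a ⊡ b ⊡ c ⊡ x ⊡ y ⊡ z ≈ (a ⊡ x) ⊡ (b ⊡ y) ⊡ (c ⊡ z)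
  regroup₃ = solve 6 (λ a b c x y z →
    a :* b :* c :* x :* y :* z := (a :* x) :* (b :* y) :* (c :* z)) ≈-refl

  regroup₅ : ∀ a b c d e v w x y z → a ⊡ b ⊡ c ⊡ d ⊡ e ⊡ v ⊡ w ⊡ x ⊡ y ⊡ z ≈
    (a ⊡ v) ⊡ (b ⊡ w) ⊡ (c ⊡ x) ⊡ (d ⊡ y) ⊡ (e ⊡ z)
  regroup₅ = solve 10 (λ a b c d e v w x y z → a :* b :* c :* d :* e :* v :* w :* x :* y :* z :=
    (a :* v) :* (b :* w) :* (c :* x) :* (d :* y) :* (e :* z)) ≈-refl

  regroup-products : ∀ a b c d e p q r i j →
    (a ⊡ b ⊡ c ⊡ d ⊡ e) ⊡ ((p ⊡ q ⊡ r) ⊡ (i ⊡ j)) ≈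
    ((d ⊡ a ⊡ e) ⊡ (q ⊡ p ⊡ r)) ⊡ ((b ⊡ i) ⊡ (c ⊡ j))
  regroup-products = solve 10 (λ a b c d e p q r i j →
    (a :* b :* c :* d :* e) :* ((p :* q :* r) :* (i :* j)) :=
    ((d :* a :* e) :* (q :* p :* r)) :* ((b :* i) :* (c :* j))) ≈-refl

  swap₁₂ : ∀ a b c → a ⊡ b ⊡ c ≈ b ⊡ a ⊡ c
  swap₁₂ = solve 3 (λ a b c → a :* b :* c := b :* a :* c) ≈-refl

-- Finite sums

sumTo-cong-≤ : ∀ n {f g : ℕ → ℤ} → (∀ i → i ≤ n → f i ≡ g i) → sumTo n f ≡ sumTo n g
sumTo-cong-≤ zero    f≗g = f≗g 0 z≤n
sumTo-cong-≤ (suc n) f≗g =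
  cong₂ _+_ (sumTo-cong-≤ n λ i i≤n → f≗g i (ℕ.m≤n⇒m≤1+n i≤n)) (f≗g (suc n) ℕ.≤-refl)

sumTo-cong : ∀ n {f g : ℕ → ℤ} → (∀ i → f i ≡ g i) → sumTo n f ≡ sumTo n g
sumTo-cong n f≗g = sumTo-cong-≤ n λ i _ → f≗g i

sumTo-+ : ∀ n (f g : ℕ → ℤ) → sumTo n (λ i → f i + g i) ≡ sumTo n f + sumTo n g
sumTo-+ zero    f g = refl
sumTo-+ (suc n) f g = trans (cong (_+ (f (suc n) + g (suc n))) (sumTo-+ n f g))
  (interchange (sumTo n f) (sumTo n g) (f (suc n)) (g (suc n)))
  where
  interchange : ∀ a b c d → (a + b) + (c + d) ≡ (a + c) + (b + d)
  interchange = solve-∀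

sumTo-*ˡ : ∀ n c (f : ℕ → ℤ) → sumTo n (λ i → c * f i) ≡ c * sumTo n f
sumTo-*ˡ zero    c f = refl
sumTo-*ˡ (suc n) c f = trans (cong (_+ c * f (suc n)) (sumTo-*ˡ n c f))
  (sym (ℤ.*-distribˡ-+ c (sumTo n f) (f (suc n))))

sumTo-*ʳ : ∀ n c (f : ℕ → ℤ) → sumTo n (λ i → f i * c) ≡ sumTo n f * c
sumTo-*ʳ n c f = trans (sumTo-cong n λ i → ℤ.*-comm (f i) c)
  (trans (sumTo-*ˡ n c f) (ℤ.*-comm c (sumTo n f)))

sumTo-neg : ∀ n (f : ℕ → ℤ) → sumTo n (λ i → - f i) ≡ - sumTo n f
sumTo-neg zero    f = refl
sumTo-neg (suc n) f = trans (cong (_+ - f (suc n)) (sumTo-neg n f))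
  (sym (ℤ.neg-distrib-+ (sumTo n f) (f (suc n))))

sumTo-0 : ∀ n → sumTo n (λ _ → + 0) ≡ + 0
sumTo-0 zero    = refl
sumTo-0 (suc n) = cong (_+ + 0) (sumTo-0 n)

sumTo-≡0 : ∀ n {f : ℕ → ℤ} → (∀ i → i ≤ n → f i ≡ + 0) → sumTo n f ≡ + 0
sumTo-≡0 n f≗0 = trans (sumTo-cong-≤ n f≗0) (sumTo-0 n)

sumTo-swap : ∀ m n (F : ℕ → ℕ → ℤ) →
  sumTo m (λ i → sumTo n (F i)) ≡ sumTo n (λ j → sumTo m (λ i → F i j))
sumTo-swap zero    n F = refl
sumTo-swap (suc m) n F = trans (cong (_+ sumTo n (F (suc m))) (sumTo-swap m n F))
  (sym (sumTo-+ n _ (F (suc m))))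

sumTo-suc : ∀ n (f : ℕ → ℤ) → sumTo (suc n) f ≡ f 0 + sumTo n (f ∘ suc)
sumTo-suc zero    f = refl
sumTo-suc (suc n) f = trans (cong (_+ f (suc (suc n))) (sumTo-suc n f))
  (ℤ.+-assoc (f 0) (sumTo n (f ∘ suc)) (f (suc (suc n))))

sumTo-reverse : ∀ n (f : ℕ → ℤ) → sumTo n f ≡ sumTo n (λ i → f (n ∸ i))
sumTo-reverse zero    f = refl
sumTo-reverse (suc n) f = trans (cong (_+ f (suc n)) (sumTo-reverse n f))
  (trans (ℤ.+-comm _ (f (suc n))) (sym (sumTo-suc n λ i → f (suc n ∸ i))))

-- The pairs (j , k) with j + k ≤ n are summed along antidiagonals and along rows. Passing from n to
-- n + 1 lengthens each old row by one entry, the `D j`, and adds one new row of a single entry;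
-- together these form the new antidiagonal.
sumTo-triangle : ∀ n (F : ℕ → ℕ → ℤ) →
  sumTo n (λ i → sumTo i (λ j → F j (i ∸ j))) ≡ sumTo n (λ j → sumTo (n ∸ j) (F j))
sumTo-triangle zero    F = refl
sumTo-triangle (suc n) F = begin
  sumTo n (λ i → sumTo i (λ j → F j (i ∸ j))) + (sumTo n D + F (suc n) (n ∸ n))
    ≡⟨ cong (_+ (sumTo n D + F (suc n) (n ∸ n))) (sumTo-triangle n F) ⟩
  sumTo n (λ j → sumTo (n ∸ j) (F j)) + (sumTo n D + F (suc n) (n ∸ n))
    ≡⟨ ℤ.+-assoc (sumTo n (λ j → sumTo (n ∸ j) (F j))) (sumTo n D) _ ⟨
  sumTo n (λ j → sumTo (n ∸ j) (F j)) + sumTo n D + F (suc n) (n ∸ n)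
    ≡⟨ cong₂ _+_ (sym (sumTo-+ n (λ j → sumTo (n ∸ j) (F j)) D)) last ⟩
  sumTo n (λ j → sumTo (n ∸ j) (F j) + D j) + sumTo (n ∸ n) (F (suc n))
    ≡⟨ cong (_+ sumTo (n ∸ n) (F (suc n))) (sumTo-cong-≤ n step) ⟩
  sumTo n (λ j → sumTo (suc n ∸ j) (F j)) + sumTo (n ∸ n) (F (suc n)) ∎
  where
  open ≡-Reasoning
  D = λ j → F j (suc n ∸ j)
  last : F (suc n) (n ∸ n) ≡ sumTo (n ∸ n) (F (suc n))
  last rewrite ℕ.n∸n≡0 n = refl
  step : ∀ j → j ≤ n → sumTo (n ∸ j) (F j) + D j ≡ sumTo (suc n ∸ j) (F j)
  step j j≤n rewrite ℕ.+-∸-assoc 1 j≤n = refl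

-- The ring of formal power series

infix 4 _≈_
_≈_ : PS → PS → Set
f ≈ g = ∀ n → f n ≡ g n

infixl 6 _⊕_
infix 8 ⊖_
_⊕_ : PS → PS → PS
(f ⊕ g) n = f n + g n

⊖_ : PS → PS
(⊖ f) n = - f n

zeroP : PS
zeroP _ = + 0

⊛-comm : ∀ f g → f ⊛ g ≈ g ⊛ f
⊛-comm f g n = trans (sumTo-reverse n λ i → f i * g (n ∸ i))
  (sumTo-cong-≤ n λ i i≤n → trans (cong (λ k → f (n ∸ i) * g k) (ℕ.m∸[m∸n]≡n i≤n))
    (ℤ.*-comm (f (n ∸ i)) (g i)))

⊛-assoc : ∀ f g h → (f ⊛ g) ⊛ h ≈ f ⊛ (g ⊛ h)
⊛-assoc f g h n = begin
  sumTo n (λ i → sumTo i (λ j → f j * g (i ∸ j)) * h (n ∸ i))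
    ≡⟨ sumTo-cong n (λ i → sym (sumTo-*ʳ i (h (n ∸ i)) _)) ⟩
  sumTo n (λ i → sumTo i (λ j → f j * g (i ∸ j) * h (n ∸ i)))
    ≡⟨ sumTo-cong n (λ i → sumTo-cong-≤ i λ j j≤i →
         cong (λ k → f j * g (i ∸ j) * h (n ∸ k)) (sym (ℕ.m+[n∸m]≡n j≤i))) ⟩
  sumTo n (λ i → sumTo i (λ j → F j (i ∸ j)))
    ≡⟨ sumTo-triangle n F ⟩
  sumTo n (λ j → sumTo (n ∸ j) (F j))
    ≡⟨ sumTo-cong n (λ j → trans
         (sumTo-cong (n ∸ j) λ k → trans (ℤ.*-assoc (f j) (g k) _)
           (cong (λ l → f j * (g k * h l)) (sym (ℕ.∸-+-assoc n j k))))
         (sumTo-*ˡ (n ∸ j) (f j) _)) ⟩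
  sumTo n (λ j → f j * sumTo (n ∸ j) (λ k → g k * h (n ∸ j ∸ k))) ∎
  where
  open ≡-Reasoning
  F : ℕ → ℕ → ℤ
  F j k = f j * g k * h (n ∸ (j ℕ.+ k))

⊛-identityˡ : ∀ f → oneP ⊛ f ≈ f
⊛-identityˡ f zero    = ℤ.*-identityˡ (f 0)
⊛-identityˡ f (suc n) = begin
  sumTo (suc n) (λ i → oneP i * f (suc n ∸ i))
    ≡⟨ sumTo-suc n _ ⟩
  + 1 * f (suc n) + sumTo n (λ i → + 0 * f (n ∸ i))
    ≡⟨ cong₂ _+_ (ℤ.*-identityˡ (f (suc n))) (sumTo-0 n) ⟩
  f (suc n) + + 0
    ≡⟨ ℤ.+-identityʳ _ ⟩
  f (suc n) ∎
  where open ≡-Reasoning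

⊛-distribˡ-⊕ : ∀ f g h → f ⊛ (g ⊕ h) ≈ (f ⊛ g) ⊕ (f ⊛ h)
⊛-distribˡ-⊕ f g h n = trans
  (sumTo-cong n λ i → ℤ.*-distribˡ-+ (f i) (g (n ∸ i)) (h (n ∸ i)))
  (sumTo-+ n (λ i → f i * g (n ∸ i)) (λ i → f i * h (n ∸ i)))

module Truncated (N : ℕ) where

  infix 4 _≋_
  -- Equality in ℤ[[q]] / (q^(N+1)). In this quotient a factor 1 - q^e with e > N is 1, so infinite
  -- products become finite ones of any sufficient length.
  record _≋_ (f g : PS) : Set where
    constructor trunc
    field coeff : ∀ n → n ≤ N → f n ≡ g n
  open _≋_ public

  ≈⇒≋ : ∀ {f g} → f ≈ g → f ≋ g
  ≈⇒≋ f≈g = trunc λ n _ → f≈g n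

  ⊛-cong : ∀ {f f′ g g′} → f ≋ f′ → g ≋ g′ → f ⊛ g ≋ f′ ⊛ g′
  ⊛-cong f≋f′ g≋g′ = trunc λ n n≤N → sumTo-cong-≤ n λ i i≤n →
    cong₂ _*_ (coeff f≋f′ i (ℕ.≤-trans i≤n n≤N)) (coeff g≋g′ (n ∸ i) (ℕ.≤-trans (ℕ.m∸n≤m n i) n≤N))

  ring : CommutativeRing 0ℓ 0ℓ
  ring = record
    { Carrier = PS ; _≈_ = _≋_ ; _+_ = _⊕_ ; _*_ = _⊛_ ; -_ = ⊖_ ; 0# = zeroP ; 1# = oneP
    ; isCommutativeRing = record
      { isRing = record
        { +-isAbelianGroup = record
          { isGroup = record
            { isMonoid = record
              { isSemigroup = record
                { isMagma = record
                  { isEquivalence = record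
                    { refl = ≈⇒≋ λ _ → refl
                    ; sym = λ e → trunc λ n n≤N → sym (coeff e n n≤N)
                    ; trans = λ e e′ → trunc λ n n≤N → trans (coeff e n n≤N) (coeff e′ n n≤N) }
                  ; ∙-cong = λ e e′ → trunc λ n n≤N → cong₂ _+_ (coeff e n n≤N) (coeff e′ n n≤N) }
                ; assoc = λ f g h → ≈⇒≋ λ n → ℤ.+-assoc (f n) (g n) (h n) }
              ; identity = (λ f → ≈⇒≋ λ n → ℤ.+-identityˡ (f n))
                         , λ f → ≈⇒≋ λ n → ℤ.+-identityʳ (f n) }
            ; inverse = (λ f → ≈⇒≋ λ n → ℤ.+-inverseˡ (f n))
                      , λ f → ≈⇒≋ λ n → ℤ.+-inverseʳ (f n)
            ; ⁻¹-cong = λ e → trunc λ n n≤N → cong -_ (coeff e n n≤N) }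
          ; comm = λ f g → ≈⇒≋ λ n → ℤ.+-comm (f n) (g n) }
        ; *-cong = ⊛-cong
        ; *-assoc = λ f g h → ≈⇒≋ (⊛-assoc f g h)
        ; *-identity = (λ f → ≈⇒≋ (⊛-identityˡ f))
                     , λ f → ≈⇒≋ λ n → trans (⊛-comm f oneP n) (⊛-identityˡ f n)
        ; distrib = (λ f g h → ≈⇒≋ (⊛-distribˡ-⊕ f g h))
                  , λ f g h → ≈⇒≋ λ n → trans (⊛-comm (g ⊕ h) f n)
                      (trans (⊛-distribˡ-⊕ f g h n) (cong₂ _+_ (⊛-comm f g n) (⊛-comm f h n))) }
      ; *-comm = λ f g → ≈⇒≋ (⊛-comm f g) } }

-- Monomials

mono-≡ : ∀ e → mono e e ≡ + 1
mono-≡ e with e ℕ.≟ e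
... | yes _  = refl
... | no e≢e = contradiction refl e≢e

mono-≢ : ∀ {e n} → n ≢ e → mono e n ≡ + 0
mono-≢ {e} {n} n≢e with n ℕ.≟ e
... | yes n≡e = contradiction n≡e n≢e
... | no _    = refl

mono-cancelˡ : ∀ a b n → mono (a ℕ.+ b) (a ℕ.+ n) ≡ mono b n
mono-cancelˡ a b n with n ℕ.≟ b
... | yes refl = mono-≡ (a ℕ.+ b)
... | no n≢b   = mono-≢ (n≢b ∘ ℕ.+-cancelˡ-≡ a n b)

sumTo-mono-> : ∀ n e (f : ℕ → ℤ) → n < e → sumTo n (λ i → mono e i * f i) ≡ + 0
sumTo-mono-> n e f n<e = sumTo-≡0 n λ i i≤n →
  cong (_* f i) (mono-≢ (ℕ.<⇒≢ (ℕ.≤-<-trans i≤n n<e)))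

sumTo-mono-≤ : ∀ n e (f : ℕ → ℤ) → e ≤ n → sumTo n (λ i → mono e i * f i) ≡ f e
sumTo-mono-≤ zero    .0 f z≤n = ℤ.*-identityˡ (f 0)
sumTo-mono-≤ (suc n) e  f e≤1+n with ℕ.m≤n⇒m<n∨m≡n e≤1+n
... | inj₁ (s≤s e≤n) = trans (cong₂ _+_ (sumTo-mono-≤ n e f e≤n)
  (cong (_* f (suc n)) (mono-≢ (ℕ.>⇒≢ (s≤s e≤n))))) (ℤ.+-identityʳ (f e))
... | inj₂ refl = trans (cong₂ _+_ (sumTo-mono-> n e f ℕ.≤-refl) (cong (_* f e) (mono-≡ e)))
  (trans (ℤ.+-identityˡ _) (ℤ.*-identityˡ (f e)))

mono-⊛-< : ∀ {e n} f → n < e → (mono e ⊛ f) n ≡ + 0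
mono-⊛-< {e} {n} f = sumTo-mono-> n e (λ i → f (n ∸ i))

mono-⊛-+ : ∀ e f n → (mono e ⊛ f) (e ℕ.+ n) ≡ f n
mono-⊛-+ e f n = trans (sumTo-mono-≤ (e ℕ.+ n) e (λ i → f (e ℕ.+ n ∸ i)) (ℕ.m≤m+n e n))
  (cong f (ℕ.m+n∸m≡n e n))

data Position (e n : ℕ) : Set where
  below : n < e → Position e n
  above : ∀ k → n ≡ e ℕ.+ k → Position e n

position : ∀ e n → Position e n
position e n with e ℕ.≤? n
... | yes e≤n = above (n ∸ e) (sym (ℕ.m+[n∸m]≡n e≤n))
... | no e≰n  = below (ℕ.≰⇒> e≰n)

mono-⊛-mono : ∀ a b → mono a ⊛ mono b ≈ mono (a ℕ.+ b)
mono-⊛-mono a b n with position a n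
... | below n<a    = trans (mono-⊛-< (mono b) n<a)
  (sym (mono-≢ (ℕ.<⇒≢ (ℕ.<-≤-trans n<a (ℕ.m≤m+n a b)))))
... | above k refl = trans (mono-⊛-+ a (mono b) k) (sym (mono-cancelˡ a b k))

mono-0 : mono 0 ≈ oneP
mono-0 zero    = refl
mono-0 (suc n) = refl

geomInv-∣ : ∀ {e n} → e ∣ n → geomInv e n ≡ + 1
geomInv-∣ {e} {n} e∣n with e ∣? n
... | yes _  = refl
... | no e∤n = contradiction e∣n e∤n

geomInv-∤ : ∀ {e n} → ¬ e ∣ n → geomInv e n ≡ + 0
geomInv-∤ {e} {n} e∤n with e ∣? n
... | yes e∣n = contradiction e∣n e∤n
... | no _    = refl

geomInv-< : ∀ {e n} → n < e → geomInv e n ≡ oneP n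
geomInv-< {e} {zero}  _   = geomInv-∣ (e ∣0)
geomInv-< {e} {suc n} n<e = geomInv-∤ λ e∣n → ℕ.<⇒≱ n<e (∣⇒≤ e∣n)

geomInv-+ : ∀ e n → geomInv e (e ℕ.+ n) ≡ geomInv e n
geomInv-+ e n with e ∣? n
... | yes e∣n = geomInv-∣ (∣m∣n⇒∣m+n ∣-refl e∣n)
... | no e∤n  = geomInv-∤ λ e∣e+n → e∤n (∣m+n∣m⇒∣n e∣e+n ∣-refl)

oneMinus-⊛ : ∀ e f n → (oneMinus e ⊛ f) n ≡ f n - (mono e ⊛ f) n
oneMinus-⊛ e f n = begin
  sumTo n (λ i → (oneP i - mono e i) * f (n ∸ i))
    ≡⟨ sumTo-cong n (λ i → expand (oneP i) (mono e i) (f (n ∸ i))) ⟩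
  sumTo n (λ i → oneP i * f (n ∸ i) + - (mono e i * f (n ∸ i)))
    ≡⟨ sumTo-+ n _ _ ⟩
  (oneP ⊛ f) n + sumTo n (λ i → - (mono e i * f (n ∸ i)))
    ≡⟨ cong₂ _+_ (⊛-identityˡ f n) (sumTo-neg n _) ⟩
  f n - (mono e ⊛ f) n ∎
  where
  open ≡-Reasoning
  expand : ∀ a b c → (a - b) * c ≡ a * c + - (b * c)
  expand = solve-∀

-- Below degree e the shifted copy is absent and the geometric series has only its constant term.
-- From degree e on, the coefficients of the series have period e, so the two copies cancel.
oneMinus-⊛-geomInv : ∀ e .{{_ : ℕ.NonZero e}} → oneMinus e ⊛ geomInv e ≈ oneP
oneMinus-⊛-geomInv e n with position e n
... | below n<e = trans (oneMinus-⊛ e (geomInv e) n)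
  (trans (cong₂ _-_ (geomInv-< n<e) (mono-⊛-< (geomInv e) n<e)) (ℤ.+-identityʳ (oneP n)))
oneMinus-⊛-geomInv (suc e) .(suc e ℕ.+ k) | above k refl =
  trans (oneMinus-⊛ (suc e) (geomInv (suc e)) (suc e ℕ.+ k))
  (trans (cong₂ _-_ (geomInv-+ (suc e) k) (mono-⊛-+ (suc e) (geomInv (suc e)) k))
    (ℤ.+-inverseʳ (geomInv (suc e) k)))

scale : ℤ → PS → PS
scale c f n = c * f n

scale-⊛ : ∀ c f g → scale c f ⊛ g ≈ scale c (f ⊛ g)
scale-⊛ c f g n = trans (sumTo-cong n λ i → ℤ.*-assoc c (f i) (g (n ∸ i))) (sumTo-*ˡ n c _)

⊛-scale : ∀ c f g → f ⊛ scale c g ≈ scale c (f ⊛ g)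
⊛-scale c f g n = trans (⊛-comm f (scale c g) n)
  (trans (scale-⊛ c g f n) (cong (c *_) (⊛-comm g f n)))

sumP : ℕ → (ℕ → PS) → PS
sumP n F i = sumTo n (λ m → F m i)

⊛-sumP : ∀ n f F → f ⊛ sumP n F ≈ sumP n (λ m → f ⊛ F m)
⊛-sumP n f F k = trans (sumTo-cong k λ i → sym (sumTo-*ˡ n (f i) (λ m → F m (k ∸ i))))
  (sumTo-swap k n λ i m → f i * F m (k ∸ i))

-- Finite products modulo q^(N+1)

module TruncatedProducts (N : ℕ) where
  open Truncated N public
  open CommutativeRing ring public
    using (setoid; commutativeSemiring)
    renaming ( refl to ≋-refl; sym to ≋-sym; trans to ≋-trans; +-cong to ⊕-cong
             ; -‿cong to ⊖-cong; *-identityʳ to ⊛-identityʳ≋; *-identityˡ to ⊛-identityˡ≋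
             ; *-comm to ⊛-comm≋; *-assoc to ⊛-assoc≋ )
  open SemiringIdentities commutativeSemiring public
  open RingProperties (CommutativeRing.ring ring) public
    using () renaming (-‿distribˡ-* to ⊖-distribˡ-⊛; -‿involutive to ⊖-involutive)

  ⊛-congˡ : ∀ f {g g′} → g ≋ g′ → f ⊛ g ≋ f ⊛ g′
  ⊛-congˡ f = ⊛-cong (≋-refl {f})

  ⊛-congʳ : ∀ g {f f′} → f ≋ f′ → f ⊛ g ≋ f′ ⊛ g
  ⊛-congʳ g f≋f′ = ⊛-cong f≋f′ (≋-refl {g})

  mono-high : ∀ {e} → N < e → mono e ≋ zeroP
  mono-high N<e = trunc λ n n≤N → mono-≢ (ℕ.<⇒≢ (ℕ.≤-<-trans n≤N N<e))

  oneMinus-high : ∀ {e} → N < e → oneMinus e ≋ oneP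
  oneMinus-high N<e = trunc λ n n≤N →
    trans (cong (λ z → oneP n - z) (coeff (mono-high N<e) n n≤N)) (ℤ.+-identityʳ (oneP n))

  geomInv-high : ∀ {e} → N < e → geomInv e ≋ oneP
  geomInv-high N<e = trunc λ n n≤N → geomInv-< (ℕ.≤-<-trans n≤N N<e)

  sumP-cong : ∀ n {F G : ℕ → PS} → (∀ m → m ≤ n → F m ≋ G m) → sumP n F ≋ sumP n G
  sumP-cong n F≋G = trunc λ i i≤N → sumTo-cong-≤ n λ m m≤n → coeff (F≋G m m≤n) i i≤N

  prodTo-⊛-inverse : ∀ n {F G : ℕ → PS} → (∀ i → F i ⊛ G i ≋ oneP) →
    prodTo n F ⊛ prodTo n G ≋ oneP
  prodTo-⊛-inverse zero    FG≋1 = ⊛-identityʳ≋ oneP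
  prodTo-⊛-inverse (suc n) {F} {G} FG≋1 = begin
    (prodTo n F ⊛ F n) ⊛ (prodTo n G ⊛ G n)
      ≈⟨ *-interchange (prodTo n F) (F n) (prodTo n G) (G n) ⟩
    (prodTo n F ⊛ prodTo n G) ⊛ (F n ⊛ G n)
      ≈⟨ ⊛-cong (prodTo-⊛-inverse n FG≋1) (FG≋1 n) ⟩
    oneP ⊛ oneP
      ≈⟨ ⊛-identityʳ≋ oneP ⟩
    oneP ∎
    where
    open SetoidReasoning setoid

  prodTo-stable-+ : ∀ k j {F : ℕ → PS} → (∀ i → k ≤ i → F i ≋ oneP) →
    prodTo (j ℕ.+ k) F ≋ prodTo k F
  prodTo-stable-+ k zero    F≋1 = ≋-refl
  prodTo-stable-+ k (suc j) F≋1 =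
    ≋-trans (⊛-cong (prodTo-stable-+ k j F≋1) (F≋1 (j ℕ.+ k) (ℕ.m≤n+m k j))) (⊛-identityʳ≋ _)

  prodTo-stable : ∀ {k l} {F : ℕ → PS} → (∀ i → N ≤ i → F i ≋ oneP) →
    N ≤ k → N ≤ l → prodTo k F ≋ prodTo l F
  prodTo-stable {k} {l} {F} F≋1 N≤k N≤l = ≋-trans (stable k N≤k) (≋-sym (stable l N≤l))
    where
    stable : ∀ m → N ≤ m → prodTo m F ≋ prodTo N F
    stable m N≤m = subst (λ j → prodTo j F ≋ prodTo N F) (ℕ.m∸n+n≡m N≤m)
      (prodTo-stable-+ N (m ∸ N) F≋1)

-- The sign (-1)^z

sgnℕ : ℕ → ℤ
sgnℕ zero    = + 1
sgnℕ (suc n) = - sgnℕ n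

sgn : ℤ → ℤ
sgn z = sgnℕ ℤ.∣ z ∣

sgn-suc : ∀ z → sgn (+ 1 + z) ≡ - sgn z
sgn-suc (+ n)        = refl
sgn-suc -[1+ zero ]  = refl
sgn-suc -[1+ suc n ] = sym (ℤ.neg-involutive (sgnℕ (suc n)))

suc-⊖ : ∀ m s → suc m ℤ.⊖ s ≡ + 1 + (m ℤ.⊖ s)
suc-⊖ m s = sym (ℤ.distribʳ-⊖-+-pos 1 m s)

sgn-suc-⊖ : ∀ m s → sgn (suc m ℤ.⊖ s) ≡ - sgn (m ℤ.⊖ s)
sgn-suc-⊖ m s = trans (cong sgn (suc-⊖ m s)) (sgn-suc (m ℤ.⊖ s))

-- The Jacobi triple product

-- The triangular number n (n - 1) / 2, free of division.
tri : ℕ → ℕ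
tri zero    = 0
tri (suc n) = n ℕ.+ tri n

poch : ℕ → ℕ → ℕ → PS
poch a d n = prodTo n (λ i → oneMinus (a ℕ.+ d ℕ.* i))

invPoch : ℕ → ℕ → ℕ → PS
invPoch a d n = prodTo n (λ i → geomInv (a ℕ.+ d ℕ.* i))

-- The passage between consecutive rows of a Pascal triangle: `a` contributes at its own index, `b`
-- one place further up. In the induction on partial sums, `b k` is the contribution that the terms
-- up to k have not yet absorbed.
sumTo-pascal : ∀ n {t a b : ℕ → ℤ} → t 0 ≡ a 0 → (∀ m → m < n → t (suc m) ≡ a (suc m) + b m) →
  t (suc n) ≡ b n → sumTo (suc n) t ≡ sumTo n a + sumTo n b
sumTo-pascal n {t} {a} {b} t₀ tₘ tₙ = trans (cong (_+_ (sumTo n t)) tₙ) (partial n ℕ.≤-refl)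
  where
  shuffle : ∀ T A B x y z → T + y ≡ A + B → T + (x + y) + z ≡ A + x + (B + z)
  shuffle T A B x y z eq = trans (lhs T x y z) (trans (cong (_+ (x + z)) eq) (rhs A B x z))
    where
    lhs : ∀ T x y z → T + (x + y) + z ≡ T + y + (x + z)
    lhs = solve-∀
    rhs : ∀ A B x z → A + B + (x + z) ≡ A + x + (B + z)
    rhs = solve-∀
  partial : ∀ k → k ≤ n → sumTo k t + b k ≡ sumTo k a + sumTo k b
  partial zero    _   = cong (_+ b 0) t₀
  partial (suc k) k<n = trans (cong (λ x → sumTo k t + x + b (suc k)) (tₘ k k<n))
    (shuffle (sumTo k t) (sumTo k a) (sumTo k b) (a (suc k)) (b k) (b (suc k))
      (partial k (ℕ.<⇒≤ k<n)))

module TripleProduct (α β : ℕ) .{{_ : ℕ.NonZero α}} .{{_ : ℕ.NonZero β}} where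

  d : ℕ
  d = α ℕ.+ β

  -- The theta exponent d k (k - 1) / 2 + α k. At k = - m it equals d m (m - 1) / 2 + β m, so both
  -- branches stay within ℕ.
  expo : ℤ → ℕ
  expo (+ k)    = d ℕ.* tri k ℕ.+ α ℕ.* k
  expo -[1+ k ] = d ℕ.* tri (suc k) ℕ.+ β ℕ.* suc k

  expo-neg : ∀ k → expo (- (+ k)) ≡ d ℕ.* tri k ℕ.+ β ℕ.* k
  expo-neg zero    = cong (d ℕ.* 0 ℕ.+_) (trans (ℕ.*-zeroʳ α) (sym (ℕ.*-zeroʳ β)))
  expo-neg (suc k) = refl

  ∣k∣≤expo : ∀ k → ℤ.∣ k ∣ ≤ expo k
  ∣k∣≤expo (+ k)    = ℕ.≤-trans (ℕ.m≤n*m k α) (ℕ.m≤n+m _ _)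
  ∣k∣≤expo -[1+ k ] = ℕ.≤-trans (ℕ.m≤n*m (suc k) β) (ℕ.m≤n+m _ _)

  -- The first difference of `expo` at k is α + d k. Here k = m - s, and the negative part d s is
  -- moved to the other side.
  expo-suc : ∀ m s → α ℕ.+ d ℕ.* m ℕ.+ expo (m ℤ.⊖ s) ≡ expo (suc m ℤ.⊖ s) ℕ.+ d ℕ.* s
  expo-suc m s with position s m
  ... | above k refl
    rewrite trans (ℤ.⊖-≥ (ℕ.m≤m+n s k)) (cong +_ (ℕ.m+n∸m≡n s k))
          | trans (ℤ.⊖-≥ (ℕ.m≤n⇒m≤1+n (ℕ.m≤m+n s k)))
              (cong +_ (trans (cong (_∸ s) (sym (ℕ.+-suc s k))) (ℕ.m+n∸m≡n s (suc k))))
    = identity α β s k (tri k)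
    where
    identity : ∀ α β s k t → α ℕ.+ (α ℕ.+ β) ℕ.* (s ℕ.+ k) ℕ.+ ((α ℕ.+ β) ℕ.* t ℕ.+ α ℕ.* k)
      ≡ (α ℕ.+ β) ℕ.* (k ℕ.+ t) ℕ.+ α ℕ.* suc k ℕ.+ (α ℕ.+ β) ℕ.* s
    identity = ℕ-Solver.solve-∀
  ... | below m<s with position (suc m) s
  ...   | below s≤m = contradiction s≤m (ℕ.≤⇒≯ m<s)
  ...   | above k refl
    rewrite trans (ℤ.⊖-< m<s)
              (cong (-_ ∘ +_) (trans (cong (_∸ m) (sym (ℕ.+-suc m k))) (ℕ.m+n∸m≡n m (suc k))))
          | trans (ℤ.⊖-≤ (ℕ.m≤m+n (suc m) k)) (cong (-_ ∘ +_) (ℕ.m+n∸m≡n (suc m) k))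
          | expo-neg k
    = identity α β m k (tri k)
    where
    identity : ∀ α β m k t →
      α ℕ.+ (α ℕ.+ β) ℕ.* m ℕ.+ ((α ℕ.+ β) ℕ.* (k ℕ.+ t) ℕ.+ β ℕ.* suc k)
      ≡ (α ℕ.+ β) ℕ.* t ℕ.+ β ℕ.* k ℕ.+ (α ℕ.+ β) ℕ.* suc (m ℕ.+ k)
    identity = ℕ-Solver.solve-∀

  expo-up : ∀ {m l r s} → m ℕ.+ l ≡ r ℕ.+ s →
    α ℕ.+ d ℕ.* r ℕ.+ expo (m ℤ.⊖ s) ≡ expo (suc m ℤ.⊖ s) ℕ.+ d ℕ.* l
  expo-up {m} {l} {r} {s} m+l≡r+s = ℕ.+-cancelʳ-≡ (d ℕ.* m) _ _ (begin
    α ℕ.+ d ℕ.* r ℕ.+ E ℕ.+ d ℕ.* m    ≡⟨ lhs α (d ℕ.* r) E (d ℕ.* m) ⟩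
    α ℕ.+ d ℕ.* m ℕ.+ E ℕ.+ d ℕ.* r    ≡⟨ cong (ℕ._+ d ℕ.* r) (expo-suc m s) ⟩
    E′ ℕ.+ d ℕ.* s ℕ.+ d ℕ.* r         ≡⟨ regroup E′ d s r ⟩
    E′ ℕ.+ d ℕ.* (r ℕ.+ s)             ≡⟨ cong (λ n → E′ ℕ.+ d ℕ.* n) (sym m+l≡r+s) ⟩
    E′ ℕ.+ d ℕ.* (m ℕ.+ l)             ≡⟨ sym (regroup E′ d l m) ⟩
    E′ ℕ.+ d ℕ.* l ℕ.+ d ℕ.* m         ∎)
    where
    open ≡-Reasoning
    E  = expo (m ℤ.⊖ s)
    E′ = expo (suc m ℤ.⊖ s)
    lhs : ∀ a b c e → a ℕ.+ b ℕ.+ c ℕ.+ e ≡ a ℕ.+ e ℕ.+ c ℕ.+ b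
    lhs = ℕ-Solver.solve-∀
    regroup : ∀ e d s r → e ℕ.+ d ℕ.* s ℕ.+ d ℕ.* r ≡ e ℕ.+ d ℕ.* (r ℕ.+ s)
    regroup = ℕ-Solver.solve-∀

  expo-down : ∀ m s → β ℕ.+ d ℕ.* s ℕ.+ expo (suc m ℤ.⊖ s) ≡ expo (m ℤ.⊖ s) ℕ.+ (d ℕ.+ d ℕ.* m)
  expo-down m s = begin
    β ℕ.+ d ℕ.* s ℕ.+ E′               ≡⟨ lhs β (d ℕ.* s) E′ ⟩
    β ℕ.+ (E′ ℕ.+ d ℕ.* s)             ≡⟨ cong (β ℕ.+_) (sym (expo-suc m s)) ⟩
    β ℕ.+ (α ℕ.+ d ℕ.* m ℕ.+ E)        ≡⟨ rhs α β (d ℕ.* m) E ⟩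
    E ℕ.+ (d ℕ.+ d ℕ.* m)              ∎
    where
    open ≡-Reasoning
    E  = expo (m ℤ.⊖ s)
    E′ = expo (suc m ℤ.⊖ s)
    lhs : ∀ a b c → a ℕ.+ b ℕ.+ c ≡ a ℕ.+ (c ℕ.+ b)
    lhs = ℕ-Solver.solve-∀
    rhs : ∀ α β x e → β ℕ.+ (α ℕ.+ x ℕ.+ e) ≡ e ℕ.+ (α ℕ.+ β ℕ.+ x)
    rhs = ℕ-Solver.solve-∀

  smono : ℤ → PS
  smono k = scale (sgn k) (mono (expo k))

  mono-⊛-smono : ∀ {a k k′ b} → sgn k′ ≡ - sgn k → a ℕ.+ expo k ≡ expo k′ ℕ.+ b →
    mono a ⊛ smono k ≈ ⊖ (smono k′ ⊛ mono b)
  mono-⊛-smono {a} {k} {k′} {b} sgn-eq expo-eq n = begin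
    (mono a ⊛ smono k) n
      ≡⟨ ⊛-scale (sgn k) (mono a) (mono (expo k)) n ⟩
    sgn k * (mono a ⊛ mono (expo k)) n
      ≡⟨ cong₂ _*_ (trans (sym (ℤ.neg-involutive (sgn k))) (cong -_ (sym sgn-eq)))
           (trans (mono-⊛-mono a (expo k) n)
             (trans (cong (λ e → mono e n) expo-eq) (sym (mono-⊛-mono (expo k′) b n)))) ⟩
    - sgn k′ * (mono (expo k′) ⊛ mono b) n
      ≡⟨ sym (ℤ.neg-distribˡ-* (sgn k′) _) ⟩
    - (sgn k′ * (mono (expo k′) ⊛ mono b) n)
      ≡⟨ cong -_ (sym (scale-⊛ (sgn k′) (mono (expo k′)) (mono b) n)) ⟩
    - (smono k′ ⊛ mono b) n ∎
    where open ≡-Reasoning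

-- The finite form of the triple product

module FiniteTripleProduct (α β : ℕ) .{{α≢0 : ℕ.NonZero α}} .{{_ : ℕ.NonZero β}} (N : ℕ) where

  open TripleProduct α β public
  open TruncatedProducts N public

  instance
    d≢0 : ℕ.NonZero d
    d≢0 = ℕ.>-nonZero (ℕ.<-≤-trans (ℕ.>-nonZero⁻¹ α) (ℕ.m≤m+n α β))

    d+-nonZero : ∀ {n} → ℕ.NonZero (d ℕ.+ n)
    d+-nonZero {n} = ℕ.>-nonZero (ℕ.<-≤-trans (ℕ.>-nonZero⁻¹ d) (ℕ.m≤m+n d n))

  oneMinus-+ : ∀ a b → oneMinus (a ℕ.+ b) ≈ oneMinus a ⊕ mono a ⊛ oneMinus b
  oneMinus-+ a b n = begin
    oneP n - mono (a ℕ.+ b) n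
      ≡⟨ cong (λ x → oneP n - x) (sym (mono-⊛-mono a b n)) ⟩
    oneP n - (mono a ⊛ mono b) n
      ≡⟨ telescope (oneP n) (mono a n) ((mono a ⊛ mono b) n) ⟩
    oneMinus a n + (mono a n - (mono a ⊛ mono b) n)
      ≡⟨ cong (_+_ (oneMinus a n)) (sym (trans (⊛-comm (mono a) (oneMinus b) n)
           (trans (oneMinus-⊛ b (mono a) n) (cong (λ x → mono a n - x) (⊛-comm (mono b) (mono a) n))))) ⟩
    oneMinus a n + (mono a ⊛ oneMinus b) n ∎
    where
    open ≡-Reasoning
    telescope : ∀ x y z → x - z ≡ x - y + (y - z)
    telescope = solve-∀

  poch-⊛-invPoch : ∀ n → poch d d n ⊛ invPoch d d n ≋ oneP
  poch-⊛-invPoch n = prodTo-⊛-inverse n λ i → ≈⇒≋ (oneMinus-⊛-geomInv (d ℕ.+ d ℕ.* i))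

  -- the Gaussian binomial coefficient [m + l choose m] in q^d
  gauss : ℕ → ℕ → PS
  gauss m l = poch d d (m ℕ.+ l) ⊛ (invPoch d d m ⊛ invPoch d d l)

  gauss-comm : ∀ m l → gauss m l ≋ gauss l m
  gauss-comm m l rewrite ℕ.+-comm m l = ⊛-congˡ (poch d d (l ℕ.+ m)) (⊛-comm≋ (invPoch d d m) (invPoch d d l))

  gauss-0ʳ : ∀ m → gauss m 0 ≋ oneP
  gauss-0ʳ m rewrite ℕ.+-identityʳ m =
    ≋-trans (⊛-congˡ (poch d d m) (⊛-identityʳ≋ (invPoch d d m))) (poch-⊛-invPoch m)

  gauss-0ˡ : ∀ l → gauss 0 l ≋ oneP
  gauss-0ˡ l = ≋-trans (gauss-comm 0 l) (gauss-0ʳ l)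

  -- Split the last factor of the numerator as 1 - Q^(l+1) Q^(m+1) = (1 - Q^(l+1)) + Q^(l+1) (1 -
  -- Q^(m+1)) with Q = q^d. Each summand cancels the last factor of one of the two denominators.
  gauss-pascal : ∀ m l →
    gauss (suc m) (suc l) ≋ gauss (suc m) l ⊕ mono (d ℕ.+ d ℕ.* l) ⊛ gauss m (suc l)
  gauss-pascal m l = begin
    (A ⊛ oneMinus (d ℕ.+ d ℕ.* (m ℕ.+ suc l))) ⊛ ((p ⊛ g) ⊛ (p′ ⊛ g′))
      ≡⟨ cong (λ e → (A ⊛ oneMinus e) ⊛ ((p ⊛ g) ⊛ (p′ ⊛ g′))) (exponents d m l) ⟩
    (A ⊛ oneMinus ((d ℕ.+ d ℕ.* l) ℕ.+ (d ℕ.+ d ℕ.* m))) ⊛ ((p ⊛ g) ⊛ (p′ ⊛ g′))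
      ≈⟨ ⊛-congʳ ((p ⊛ g) ⊛ (p′ ⊛ g′)) (⊛-congˡ A (≈⇒≋ (oneMinus-+ (d ℕ.+ d ℕ.* l) (d ℕ.+ d ℕ.* m)))) ⟩
    (A ⊛ (v ⊕ y ⊛ u)) ⊛ ((p ⊛ g) ⊛ (p′ ⊛ g′))
      ≈⟨ gauss-expand A p g p′ g′ u v y ⟩
    (A ⊛ ((p ⊛ g) ⊛ p′)) ⊛ (v ⊛ g′) ⊕ (y ⊛ (A ⊛ (p ⊛ (p′ ⊛ g′)))) ⊛ (u ⊛ g)
      ≈⟨ ⊕-cong (cancel (A ⊛ ((p ⊛ g) ⊛ p′)) (oneMinus-⊛-geomInv (d ℕ.+ d ℕ.* l)))
           (cancel (y ⊛ (A ⊛ (p ⊛ (p′ ⊛ g′)))) (oneMinus-⊛-geomInv (d ℕ.+ d ℕ.* m))) ⟩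
    A ⊛ ((p ⊛ g) ⊛ p′) ⊕ y ⊛ (A ⊛ (p ⊛ (p′ ⊛ g′)))
      ≡⟨ cong (λ n → poch d d n ⊛ ((p ⊛ g) ⊛ p′) ⊕ y ⊛ (A ⊛ (p ⊛ (p′ ⊛ g′)))) (ℕ.+-suc m l) ⟩
    gauss (suc m) l ⊕ y ⊛ gauss m (suc l) ∎
    where
    open SetoidReasoning setoid
    A = poch d d (m ℕ.+ suc l)
    p = invPoch d d m
    g = geomInv (d ℕ.+ d ℕ.* m)
    p′ = invPoch d d l
    g′ = geomInv (d ℕ.+ d ℕ.* l)
    u = oneMinus (d ℕ.+ d ℕ.* m)
    v = oneMinus (d ℕ.+ d ℕ.* l)
    y = mono (d ℕ.+ d ℕ.* l)
    cancel : ∀ f {u} → u ≈ oneP → f ⊛ u ≋ f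
    cancel f u≈1 = ≋-trans (⊛-congˡ f (≈⇒≋ u≈1)) (⊛-identityʳ≋ f)
    exponents : ∀ d m l → d ℕ.+ d ℕ.* (m ℕ.+ suc l) ≡ d ℕ.+ d ℕ.* l ℕ.+ (d ℕ.+ d ℕ.* m)
    exponents = ℕ-Solver.solve-∀

  gauss-pascal′ : ∀ m l →
    gauss (suc m) (suc l) ≋ gauss m (suc l) ⊕ mono (d ℕ.+ d ℕ.* m) ⊛ gauss (suc m) l
  gauss-pascal′ m l = ≋-trans (gauss-comm (suc m) (suc l)) (≋-trans (gauss-pascal l m)
    (⊕-cong (gauss-comm (suc l) m) (⊛-congˡ (mono (d ℕ.+ d ℕ.* m)) (gauss-comm l (suc m)))))

  sumP-pascal : ∀ n {t a b : ℕ → PS} → t 0 ≋ a 0 → (∀ m → m < n → t (suc m) ≋ a (suc m) ⊕ b m) →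
    t (suc n) ≋ b n → sumP (suc n) t ≋ sumP n a ⊕ sumP n b
  sumP-pascal n t₀ tₘ tₙ = trunc λ i i≤N →
    sumTo-pascal n (coeff t₀ i i≤N) (λ m m<n → coeff (tₘ m m<n) i i≤N) (coeff tₙ i i≤N)

  term : ℕ → ℕ → ℕ → PS
  term s n m = smono (m ℤ.⊖ s) ⊛ gauss m (n ∸ m)

  oneMinus-⊛-sumP : ∀ e n F → oneMinus e ⊛ sumP n F ≋ sumP n F ⊕ sumP n (λ m → ⊖ (mono e ⊛ F m))
  oneMinus-⊛-sumP e n F = trunc λ i _ → trans (oneMinus-⊛ e (sumP n F) i)
    (cong (_+_ (sumP n F i)) (trans (cong -_ (⊛-sumP n (mono e) F i)) (sym (sumTo-neg n _))))

  mono-⊛-term : ∀ a b k k′ G → sgn k′ ≡ - sgn k → a ℕ.+ expo k ≡ expo k′ ℕ.+ b →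
    ⊖ (mono a ⊛ (smono k ⊛ G)) ≋ smono k′ ⊛ (mono b ⊛ G)
  mono-⊛-term a b k k′ G sgn-eq expo-eq = begin
    ⊖ (mono a ⊛ (smono k ⊛ G))
      ≈⟨ ⊖-cong (≋-sym (⊛-assoc≋ (mono a) (smono k) G)) ⟩
    ⊖ ((mono a ⊛ smono k) ⊛ G)
      ≈⟨ ⊖-cong (⊛-congʳ G (≈⇒≋ (mono-⊛-smono {a} {k} {k′} {b} sgn-eq expo-eq))) ⟩
    ⊖ (⊖ (smono k′ ⊛ mono b) ⊛ G)
      ≈⟨ ⊖-cong (≋-sym (⊖-distribˡ-⊛ (smono k′ ⊛ mono b) G)) ⟩
    ⊖ ⊖ ((smono k′ ⊛ mono b) ⊛ G)
      ≈⟨ ⊖-involutive ((smono k′ ⊛ mono b) ⊛ G) ⟩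
    (smono k′ ⊛ mono b) ⊛ G
      ≈⟨ ⊛-assoc≋ (smono k′) (mono b) G ⟩
    smono k′ ⊛ (mono b ⊛ G) ∎
    where open SetoidReasoning setoid

  ⊛-cong-gauss : ∀ f m {l l′} → l ≡ l′ → f ⊛ gauss m l ≋ f ⊛ gauss m l′
  ⊛-cong-gauss f m {l} refl = ≋-refl {f ⊛ gauss m l}

  ∸-suc : ∀ {m n} → m < n → n ∸ m ≡ suc (n ∸ suc m)
  ∸-suc {m} {suc n} (s≤s m≤n) = ℕ.+-∸-assoc 1 m≤n

  mono-d*0 : mono (d ℕ.* 0) ≋ oneP
  mono-d*0 rewrite ℕ.*-zeroʳ d = ≈⇒≋ mono-0

  -- Multiplying by 1 - q^(α + d r) adds a second copy of the sum. By `moved`, its term of index m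
  -- acquires the sign and exponent of index m + 1 and a leftover monomial q^(d l) with l = n - m,
  -- which is the weight in Pascal's rule.
  step-up : ∀ r s → oneMinus (α ℕ.+ d ℕ.* r) ⊛ sumP (r ℕ.+ s) (term s (r ℕ.+ s))
    ≋ sumP (suc (r ℕ.+ s)) (term s (suc (r ℕ.+ s)))
  step-up r s = ≋-trans (oneMinus-⊛-sumP e n (term s n)) (≋-sym (sumP-pascal n first middle last))
    where
    open SetoidReasoning setoid
    n = r ℕ.+ s
    e = α ℕ.+ d ℕ.* r
    moved : ∀ m l → m ℕ.+ l ≡ n → ⊖ (mono e ⊛ (smono (m ℤ.⊖ s) ⊛ gauss m l))
      ≋ smono (suc m ℤ.⊖ s) ⊛ (mono (d ℕ.* l) ⊛ gauss m l)
    moved m l m+l≡n = mono-⊛-term e (d ℕ.* l) (m ℤ.⊖ s) (suc m ℤ.⊖ s) (gauss m l)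
      (sgn-suc-⊖ m s) (expo-up {m} {l} {r} {s} m+l≡n)
    first : term s (suc n) 0 ≋ term s n 0
    first = ⊛-congˡ (smono (0 ℤ.⊖ s)) (≋-trans (gauss-0ˡ (suc n)) (≋-sym (gauss-0ˡ n)))
    middle : ∀ m → m < n → term s (suc n) (suc m) ≋ term s n (suc m) ⊕ ⊖ (mono e ⊛ term s n m)
    middle m m<n = begin
      S ⊛ gauss (suc m) (n ∸ m)
        ≈⟨ ⊛-cong-gauss S (suc m) (∸-suc m<n) ⟩
      S ⊛ gauss (suc m) (suc l)
        ≈⟨ ⊛-congˡ S (gauss-pascal m l) ⟩
      S ⊛ (gauss (suc m) l ⊕ mono (d ℕ.+ d ℕ.* l) ⊛ gauss m (suc l))
        ≈⟨ ≈⇒≋ (⊛-distribˡ-⊕ S (gauss (suc m) l) (mono (d ℕ.+ d ℕ.* l) ⊛ gauss m (suc l))) ⟩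
      S ⊛ gauss (suc m) l ⊕ S ⊛ (mono (d ℕ.+ d ℕ.* l) ⊛ gauss m (suc l))
        ≡⟨ cong (λ k → S ⊛ gauss (suc m) l ⊕ S ⊛ (mono k ⊛ gauss m (suc l))) (sym (ℕ.*-suc d l)) ⟩
      S ⊛ gauss (suc m) l ⊕ S ⊛ (mono (d ℕ.* suc l) ⊛ gauss m (suc l))
        ≈⟨ ⊕-cong (≋-refl {S ⊛ gauss (suc m) l}) (≋-sym (moved m (suc l) m+1+l≡n)) ⟩
      S ⊛ gauss (suc m) l ⊕ ⊖ (mono e ⊛ (smono (m ℤ.⊖ s) ⊛ gauss m (suc l)))
        ≡⟨ cong (λ k → S ⊛ gauss (suc m) l ⊕ ⊖ (mono e ⊛ (smono (m ℤ.⊖ s) ⊛ gauss m k))) (sym (∸-suc m<n)) ⟩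
      term s n (suc m) ⊕ ⊖ (mono e ⊛ term s n m) ∎
      where
      S = smono (suc m ℤ.⊖ s)
      l = n ∸ suc m
      m+1+l≡n : m ℕ.+ suc l ≡ n
      m+1+l≡n = trans (ℕ.+-suc m l) (ℕ.m+[n∸m]≡n m<n)
    last : term s (suc n) (suc n) ≋ ⊖ (mono e ⊛ term s n n)
    last rewrite ℕ.n∸n≡0 n = ≋-sym (≋-trans (moved n 0 (ℕ.+-identityʳ n))
      (⊛-congˡ (smono (suc n ℤ.⊖ s)) (≋-trans (⊛-cong mono-d*0 (gauss-0ʳ n))
        (≋-trans (⊛-identityˡ≋ oneP) (≋-sym (gauss-0ʳ (suc n)))))))

  suc-⊖-suc : ∀ m s → suc m ℤ.⊖ suc s ≡ m ℤ.⊖ s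
  suc-⊖-suc m s = ℤ.[1+m]⊖[1+n]≡m⊖n m s

  sgn-⊖-suc : ∀ m s → sgn (m ℤ.⊖ suc s) ≡ - sgn (m ℤ.⊖ s)
  sgn-⊖-suc m s = trans (sym (ℤ.neg-involutive _))
    (cong -_ (trans (sym (sgn-suc-⊖ m (suc s))) (cong sgn (suc-⊖-suc m s))))

  -- The centre moves from s to s + 1, so the roles are exchanged: the copy multiplied by the
  -- monomial keeps its index m, while the untouched copy moves up by one. The symmetric rule
  -- `gauss-pascal′` is therefore the one that applies.
  step-down : ∀ s → oneMinus (β ℕ.+ d ℕ.* s) ⊛ sumP s (term s s) ≋ sumP (suc s) (term (suc s) (suc s))
  step-down s = ≋-trans (oneMinus-⊛-sumP e s (term s s))
    (≋-trans (trunc λ n _ → ℤ.+-comm (sumP s (term s s) n) (sumP s (λ m → ⊖ (mono e ⊛ term s s m)) n))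
      (≋-sym (sumP-pascal s first middle last)))
    where
    open SetoidReasoning setoid
    e = β ℕ.+ d ℕ.* s
    moved : ∀ m G → ⊖ (mono e ⊛ (smono (m ℤ.⊖ s) ⊛ G))
      ≋ smono (m ℤ.⊖ suc s) ⊛ (mono (d ℕ.* m) ⊛ G)
    moved m G = mono-⊛-term e (d ℕ.* m) (m ℤ.⊖ s) (m ℤ.⊖ suc s) G (sgn-⊖-suc m s) (expo-eq)
      where
      expo-eq : e ℕ.+ expo (m ℤ.⊖ s) ≡ expo (m ℤ.⊖ suc s) ℕ.+ d ℕ.* m
      expo-eq = ℕ.+-cancelʳ-≡ d _ _ (trans
        (lhs β (d ℕ.* s) (expo (m ℤ.⊖ s)) d)
        (trans (cong₂ (λ u k → β ℕ.+ u ℕ.+ expo k) (sym (ℕ.*-suc d s)) (sym (suc-⊖-suc m s)))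
        (trans (expo-down m (suc s)) (rhs (expo (m ℤ.⊖ suc s)) d (d ℕ.* m)))))
        where
        lhs : ∀ b x y d → b ℕ.+ x ℕ.+ y ℕ.+ d ≡ b ℕ.+ (d ℕ.+ x) ℕ.+ y
        lhs = ℕ-Solver.solve-∀
        rhs : ∀ y d x → y ℕ.+ (d ℕ.+ x) ≡ y ℕ.+ x ℕ.+ d
        rhs = ℕ-Solver.solve-∀
    first : term (suc s) (suc s) 0 ≋ ⊖ (mono e ⊛ term s s 0)
    first = ≋-sym (≋-trans (moved 0 (gauss 0 s)) (⊛-congˡ (smono (0 ℤ.⊖ suc s))
      (≋-trans (⊛-cong mono-d*0 (gauss-0ˡ s)) (≋-trans (⊛-identityˡ≋ oneP) (≋-sym (gauss-0ˡ (suc s)))))))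
    middle : ∀ m → m < s →
      term (suc s) (suc s) (suc m) ≋ ⊖ (mono e ⊛ term s s (suc m)) ⊕ term s s m
    middle m m<s = begin
      S ⊛ gauss (suc m) (s ∸ m)
        ≈⟨ ⊛-cong-gauss S (suc m) (∸-suc m<s) ⟩
      S ⊛ gauss (suc m) (suc l)
        ≈⟨ ⊛-congˡ S (gauss-pascal′ m l) ⟩
      S ⊛ (gauss m (suc l) ⊕ mono (d ℕ.+ d ℕ.* m) ⊛ gauss (suc m) l)
        ≈⟨ *-distribˡ-+-comm S (gauss m (suc l)) (mono (d ℕ.+ d ℕ.* m) ⊛ gauss (suc m) l) ⟩
      S ⊛ (mono (d ℕ.+ d ℕ.* m) ⊛ gauss (suc m) l) ⊕ S ⊛ gauss m (suc l)
        ≡⟨ cong₂ (λ k j → S ⊛ (mono k ⊛ gauss (suc m) l) ⊕ smono j ⊛ gauss m (suc l))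
             (sym (ℕ.*-suc d m)) (suc-⊖-suc m s) ⟩
      S ⊛ (mono (d ℕ.* suc m) ⊛ gauss (suc m) l) ⊕ smono (m ℤ.⊖ s) ⊛ gauss m (suc l)
        ≈⟨ ⊕-cong (≋-sym (moved (suc m) (gauss (suc m) l))) (⊛-cong-gauss (smono (m ℤ.⊖ s)) m (sym (∸-suc m<s))) ⟩
      ⊖ (mono e ⊛ term s s (suc m)) ⊕ term s s m ∎
      where
      S = smono (suc m ℤ.⊖ suc s)
      l = s ∸ suc m
    last : term (suc s) (suc s) (suc s) ≋ term s s s
    last rewrite ℕ.n∸n≡0 s | suc-⊖-suc s s =
      ⊛-congˡ (smono (s ℤ.⊖ s)) (≋-trans (gauss-0ʳ (suc s)) (≋-sym (gauss-0ʳ s)))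

  -- A form of the q-binomial theorem. The factors with base β are inserted while r = 0, the case
  -- that `step-down` covers; those with base α follow, for any s.
  finite-triple-product : ∀ r s →
    poch α d r ⊛ poch β d s ≋ sumP (r ℕ.+ s) (term s (r ℕ.+ s))
  finite-triple-product zero zero = ≋-trans (⊛-identityˡ≋ oneP)
    (≋-sym (≋-trans (⊛-cong smono-0 (gauss-0ʳ 0)) (⊛-identityˡ≋ oneP)))
    where
    smono-0 : smono (+ 0) ≋ oneP
    smono-0 = ≈⇒≋ λ n → trans (ℤ.*-identityˡ _) (trans
      (cong (λ e → mono e n) (cong₂ ℕ._+_ (ℕ.*-zeroʳ d) (ℕ.*-zeroʳ α))) (mono-0 n))
  finite-triple-product zero (suc s) = begin
    oneP ⊛ (poch β d s ⊛ oneMinus (β ℕ.+ d ℕ.* s))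
      ≈⟨ *-rotate oneP (poch β d s) (oneMinus (β ℕ.+ d ℕ.* s)) ⟩
    oneMinus (β ℕ.+ d ℕ.* s) ⊛ (oneP ⊛ poch β d s)
      ≈⟨ ⊛-congˡ (oneMinus (β ℕ.+ d ℕ.* s)) (finite-triple-product zero s) ⟩
    oneMinus (β ℕ.+ d ℕ.* s) ⊛ sumP s (term s s)
      ≈⟨ step-down s ⟩
    sumP (suc s) (term (suc s) (suc s)) ∎
    where
    open SetoidReasoning setoid
  finite-triple-product (suc r) s = begin
    (poch α d r ⊛ oneMinus (α ℕ.+ d ℕ.* r)) ⊛ poch β d s
      ≈⟨ *-pull (poch α d r) (oneMinus (α ℕ.+ d ℕ.* r)) (poch β d s) ⟩
    oneMinus (α ℕ.+ d ℕ.* r) ⊛ (poch α d r ⊛ poch β d s)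
      ≈⟨ ⊛-congˡ (oneMinus (α ℕ.+ d ℕ.* r)) (finite-triple-product r s) ⟩
    oneMinus (α ℕ.+ d ℕ.* r) ⊛ sumP (r ℕ.+ s) (term s (r ℕ.+ s))
      ≈⟨ step-up r s ⟩
    sumP (suc (r ℕ.+ s)) (term s (suc (r ℕ.+ s))) ∎
    where
    open SetoidReasoning setoid

-- the sum over - R ≤ k ≤ R
bsum : ℕ → (ℤ → ℤ) → ℤ
bsum R f = sumTo (R ℕ.+ R) (λ m → f (m ℤ.⊖ R))

-- Stabilised products and the limit of the finite identity

poch-exponent-high : ∀ a d i N .{{_ : ℕ.NonZero a}} .{{_ : ℕ.NonZero d}} → N ≤ i → N < a ℕ.+ d ℕ.* i
poch-exponent-high a d i N N≤i = ℕ.+-mono-≤ (ℕ.>-nonZero⁻¹ a) (ℕ.≤-trans N≤i (ℕ.m≤n*m i d))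

poch-coeff : ∀ a d N {k l} .{{_ : ℕ.NonZero a}} .{{_ : ℕ.NonZero d}} →
  N ≤ k → N ≤ l → poch a d k N ≡ poch a d l N
poch-coeff a d N N≤k N≤l = coeff (prodTo-stable
  (λ i N≤i → oneMinus-high (poch-exponent-high a d i N N≤i)) N≤k N≤l) N ℕ.≤-refl
  where open TruncatedProducts N

invPoch-coeff : ∀ a d N {k l} .{{_ : ℕ.NonZero a}} .{{_ : ℕ.NonZero d}} →
  N ≤ k → N ≤ l → invPoch a d k N ≡ invPoch a d l N
invPoch-coeff a d N N≤k N≤l = coeff (prodTo-stable
  (λ i N≤i → geomInv-high (poch-exponent-high a d i N N≤i)) N≤k N≤l) N ℕ.≤-refl
  where open TruncatedProducts N

module TruncatedPochhammers (N : ℕ) where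
  open TruncatedProducts N

  -- Each coefficient of `poch∞` is read off a product whose length depends on the degree, so the
  -- comparison with one fixed length is made degree by degree.
  poch∞≋poch : ∀ a d {K} .{{_ : ℕ.NonZero a}} .{{_ : ℕ.NonZero d}} → N ≤ K → poch∞ a d ≋ poch a d K
  poch∞≋poch a d N≤K = trunc λ n n≤N → poch-coeff a d n (ℕ.n≤1+n n) (ℕ.≤-trans n≤N N≤K)

  invPoch∞≋invPoch : ∀ a d {K} .{{_ : ℕ.NonZero a}} .{{_ : ℕ.NonZero d}} →
    N ≤ K → invPoch∞ a d ≋ invPoch a d K
  invPoch∞≋invPoch a d N≤K = trunc λ n n≤N → invPoch-coeff a d n (ℕ.n≤1+n n) (ℕ.≤-trans n≤N N≤K)

-- Modulo q^(N+1) only the terms with ∣ k ∣ ≤ N survive, and for these the Gaussian binomial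
-- coefficient times (q^d; q^d)_K is 1.
module JacobiTripleProduct (α β : ℕ) .{{_ : ℕ.NonZero α}} .{{_ : ℕ.NonZero β}}
                           (N : ℕ) {K : ℕ} (N+N≤K : N ℕ.+ N ≤ K) where
  open FiniteTripleProduct α β N

  N≤K : N ≤ K
  N≤K = ℕ.≤-trans (ℕ.m≤m+n N N) N+N≤K

  -- Since 2 N ≤ K, an index within N of the centre K leaves at least K - N ≥ N on either side. Both
  -- lower entries of the Gaussian binomial coefficient are then in the range where the products
  -- have stabilised.
  central : ∀ m → m ≤ K ℕ.+ K → ℤ.∣ m ℤ.⊖ K ∣ ≤ N → N ≤ m × N ≤ K ℕ.+ K ∸ m
  central m m≤2K small with ℕ.≤-total m K
  ... | inj₁ m≤K = ℕ.+-cancelˡ-≤ N N m (ℕ.≤-trans N+N≤K K≤N+m)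
                 , ℕ.≤-trans N≤K (ℕ.≤-trans (ℕ.m≤m+n K (K ∸ m)) (ℕ.≤-reflexive (sym (ℕ.+-∸-assoc K m≤K))))
    where
    K≤N+m : K ≤ N ℕ.+ m
    K≤N+m = subst (K ≤_) (ℕ.+-comm m N) (ℕ.≤-trans (ℕ.m≤n+m∸n K m)
      (ℕ.+-monoʳ-≤ m (subst (_≤ N) (ℤ.∣⊖∣-≤ m≤K) small)))
  ... | inj₂ K≤m = ℕ.≤-trans N≤K K≤m
                 , ℕ.≤-trans N≤K∸N (ℕ.≤-trans
                     (ℕ.≤-reflexive (sym (ℕ.[m+n]∸[m+o]≡n∸o K K N))) (ℕ.∸-monoʳ-≤ (K ℕ.+ K) m≤K+N))
    where
    m≤K+N : m ≤ K ℕ.+ N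
    m≤K+N = ℕ.≤-trans (ℕ.m≤n+m∸n m K)
      (ℕ.+-monoʳ-≤ K (subst (_≤ N) (cong ℤ.∣_∣ (ℤ.⊖-≥ K≤m)) small))
    N≤K∸N : N ≤ K ∸ N
    N≤K∸N = ℕ.m+n≤o⇒m≤o∸n N N+N≤K

  poch-stable : ∀ {k l} → N ≤ k → N ≤ l → poch d d k ≋ poch d d l
  poch-stable = prodTo-stable λ i N≤i → oneMinus-high (poch-exponent-high d d i N N≤i)

  gauss-⊛-poch : ∀ {m l} → N ≤ m → N ≤ l → gauss m l ⊛ poch d d K ≋ oneP
  gauss-⊛-poch {m} {l} N≤m N≤l = begin
    (poch d d (m ℕ.+ l) ⊛ (invPoch d d m ⊛ invPoch d d l)) ⊛ poch d d K
      -- All lengths from N on give the same product, so m + l is traded for m and K for l; each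
      -- product then meets its own inverse.
      ≈⟨ ⊛-cong (⊛-congʳ (invPoch d d m ⊛ invPoch d d l)
           (poch-stable (ℕ.≤-trans N≤m (ℕ.m≤m+n m l)) N≤m)) (poch-stable N≤K N≤l) ⟩
    (poch d d m ⊛ (invPoch d d m ⊛ invPoch d d l)) ⊛ poch d d l
      ≈⟨ *-inner-interchange (poch d d m) (invPoch d d m) (invPoch d d l) (poch d d l) ⟩
    (poch d d m ⊛ invPoch d d m) ⊛ (poch d d l ⊛ invPoch d d l)
      ≈⟨ ⊛-cong (poch-⊛-invPoch m) (poch-⊛-invPoch l) ⟩
    oneP ⊛ oneP
      ≈⟨ ⊛-identityˡ≋ oneP ⟩
    oneP ∎
    where open SetoidReasoning setoid

  term-limit : ∀ m → m ≤ K ℕ.+ K → term K (K ℕ.+ K) m ⊛ poch d d K ≋ smono (m ℤ.⊖ K)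
  term-limit m m≤2K with expo (m ℤ.⊖ K) ℕ.≤? N
  ... | yes e≤N = ≋-trans (⊛-assoc≋ (smono (m ℤ.⊖ K)) (gauss m (K ℕ.+ K ∸ m)) (poch d d K))
    (≋-trans (⊛-congˡ (smono (m ℤ.⊖ K)) (gauss-⊛-poch (proj₁ mid) (proj₂ mid)))
      (⊛-identityʳ≋ (smono (m ℤ.⊖ K))))
    where mid = central m m≤2K (ℕ.≤-trans (∣k∣≤expo (m ℤ.⊖ K)) e≤N)
  ... | no e≰N = ≋-trans (⊛-congʳ (poch d d K) (⊛-congʳ (gauss m (K ℕ.+ K ∸ m)) smono≋0))
    (≋-trans (⊛-congʳ (poch d d K) (zeroˡ≋ (gauss m (K ℕ.+ K ∸ m))))
      (≋-trans (zeroˡ≋ (poch d d K)) (≋-sym smono≋0)))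
    where
    open CommutativeRing ring using () renaming (zeroˡ to zeroˡ≋)
    smono≋0 : smono (m ℤ.⊖ K) ≋ zeroP
    smono≋0 = trunc λ n n≤N → trans
      (cong (sgn (m ℤ.⊖ K) *_) (coeff (mono-high (ℕ.≰⇒> e≰N)) n n≤N)) (ℤ.*-zeroʳ (sgn (m ℤ.⊖ K)))

  triple-product : poch α d K ⊛ poch β d K ⊛ poch d d K ≋ λ n → bsum K (λ k → sgn k * mono (expo k) n)
  triple-product = begin
    poch α d K ⊛ poch β d K ⊛ poch d d K
      ≈⟨ ⊛-congʳ (poch d d K) (finite-triple-product K K) ⟩
    sumP (K ℕ.+ K) (term K (K ℕ.+ K)) ⊛ poch d d K
      ≈⟨ ⊛-comm≋ (sumP (K ℕ.+ K) (term K (K ℕ.+ K))) (poch d d K) ⟩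
    poch d d K ⊛ sumP (K ℕ.+ K) (term K (K ℕ.+ K))
      ≈⟨ ≈⇒≋ (⊛-sumP (K ℕ.+ K) (poch d d K) (term K (K ℕ.+ K))) ⟩
    sumP (K ℕ.+ K) (λ m → poch d d K ⊛ term K (K ℕ.+ K) m)
      ≈⟨ sumP-cong (K ℕ.+ K) (λ m m≤2K → ≋-trans (⊛-comm≋ (poch d d K) (term K (K ℕ.+ K) m)) (term-limit m m≤2K)) ⟩
    sumP (K ℕ.+ K) (λ m → smono (m ℤ.⊖ K)) ∎
    where open SetoidReasoning setoid

-- Sums over boxes in ℤ and ℤ²

bsum-cong : ∀ R {f g : ℤ → ℤ} → (∀ k → f k ≡ g k) → bsum R f ≡ bsum R g
bsum-cong R f≗g = sumTo-cong (R ℕ.+ R) λ m → f≗g (m ℤ.⊖ R)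

bsum-0 : ∀ R → bsum R (λ _ → + 0) ≡ + 0
bsum-0 R = sumTo-0 (R ℕ.+ R)

bsum-+ : ∀ R (f g : ℤ → ℤ) → bsum R (λ k → f k + g k) ≡ bsum R f + bsum R g
bsum-+ R f g = sumTo-+ (R ℕ.+ R) (λ m → f (m ℤ.⊖ R)) (λ m → g (m ℤ.⊖ R))

bsum-neg : ∀ R (f : ℤ → ℤ) → bsum R (λ k → - f k) ≡ - bsum R f
bsum-neg R f = sumTo-neg (R ℕ.+ R) (λ m → f (m ℤ.⊖ R))

bsum-*ˡ : ∀ R c (f : ℤ → ℤ) → bsum R (λ k → c * f k) ≡ c * bsum R f
bsum-*ˡ R c f = sumTo-*ˡ (R ℕ.+ R) c (λ m → f (m ℤ.⊖ R))

bsum-swap : ∀ R (F : ℤ → ℤ → ℤ) → bsum R (λ k → bsum R (F k)) ≡ bsum R (λ l → bsum R (λ k → F k l))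
bsum-swap R F = sumTo-swap (R ℕ.+ R) (R ℕ.+ R) (λ m n → F (m ℤ.⊖ R) (n ℤ.⊖ R))

⊖-injectiveˡ : ∀ {m n} R → m ℤ.⊖ R ≡ n ℤ.⊖ R → m ≡ n
⊖-injectiveˡ {m} {n} R eq = ℤ.+-injective (RingProperties.+-cancelʳ ℤ.+-*-ring (- + R) (+ m) (+ n)
  (trans (ℤ.m-n≡m⊖n m R) (trans eq (sym (ℤ.m-n≡m⊖n n R)))))

box-index : ∀ R a → ℤ.∣ a ∣ ≤ R → ∃[ m ] (m ≤ R ℕ.+ R × m ℤ.⊖ R ≡ a)
box-index R (+ k)    k≤R = R ℕ.+ k , ℕ.+-monoʳ-≤ R k≤R
  , trans (ℤ.⊖-≥ (ℕ.m≤m+n R k)) (cong +_ (ℕ.m+n∸m≡n R k))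
box-index R -[1+ k ] k<R = R ∸ suc k , ℕ.≤-trans (ℕ.m∸n≤m R (suc k)) (ℕ.m≤m+n R R)
  , trans (ℤ.⊖-≤ (ℕ.m∸n≤m R (suc k))) (cong (-_ ∘ +_) (ℕ.m∸[m∸n]≡n k<R))

δ : ℤ → ℤ → ℤ
δ a k with k ℤ.≟ a
... | yes _ = + 1
... | no _  = + 0

δ-≡ : ∀ a → δ a a ≡ + 1
δ-≡ a with a ℤ.≟ a
... | yes _  = refl
... | no a≢a = contradiction refl a≢a

δ-≢ : ∀ {a k} → k ≢ a → δ a k ≡ + 0
δ-≢ {a} {k} k≢a with k ℤ.≟ a
... | yes k≡a = contradiction k≡a k≢a
... | no _    = refl

bsum-δ : ∀ R a (h : ℤ → ℤ) → ℤ.∣ a ∣ ≤ R → bsum R (λ k → δ a k * h k) ≡ h a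
bsum-δ R a h a≤R with box-index R a a≤R
... | m₀ , m₀≤2R , refl = trans
  (sumTo-cong (R ℕ.+ R) λ m → cong (_* h (m ℤ.⊖ R)) (δ-mono m))
  (sumTo-mono-≤ (R ℕ.+ R) m₀ (λ m → h (m ℤ.⊖ R)) m₀≤2R)
  where
  δ-mono : ∀ m → δ (m₀ ℤ.⊖ R) (m ℤ.⊖ R) ≡ mono m₀ m
  δ-mono m with m ℕ.≟ m₀
  ... | yes refl = δ-≡ (m₀ ℤ.⊖ R)
  ... | no m≢m₀  = δ-≢ (m≢m₀ ∘ ⊖-injectiveˡ R)

theta : ℕ → (ℤ → ℤ) → (ℤ → ℕ) → PS
theta R w e n = bsum R (λ k → w k * mono (e k) n)

theta-⊛-theta : ∀ R w e w′ e′ n → (theta R w e ⊛ theta R w′ e′) n ≡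
  bsum R (λ k → bsum R (λ l → w k * w′ l * mono (e k ℕ.+ e′ l) n))
theta-⊛-theta R w e w′ e′ n = begin
  (theta R w e ⊛ theta R w′ e′) n
    ≡⟨ ⊛-sumP (R ℕ.+ R) (theta R w e) (λ j → G (j ℤ.⊖ R)) n ⟩
  bsum R (λ l → (theta R w e ⊛ G l) n)
    ≡⟨ bsum-cong R (λ l → trans (⊛-comm (theta R w e) (G l) n) (⊛-sumP (R ℕ.+ R) (G l) (λ i → F (i ℤ.⊖ R)) n)) ⟩
  bsum R (λ l → bsum R (λ k → (G l ⊛ F k) n))
    ≡⟨ bsum-cong R (λ l → bsum-cong R λ k → product l k) ⟩
  bsum R (λ l → bsum R (λ k → w k * w′ l * mono (e k ℕ.+ e′ l) n))
    ≡⟨ bsum-swap R (λ l k → w k * w′ l * mono (e k ℕ.+ e′ l) n) ⟩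
  bsum R (λ k → bsum R (λ l → w k * w′ l * mono (e k ℕ.+ e′ l) n)) ∎
  where
  open ≡-Reasoning
  F G : ℤ → PS
  F k = scale (w k) (mono (e k))
  G l = scale (w′ l) (mono (e′ l))
  product : ∀ l k → (G l ⊛ F k) n ≡ w k * w′ l * mono (e k ℕ.+ e′ l) n
  product l k = begin
    (G l ⊛ F k) n
      ≡⟨ ⊛-scale (w k) (G l) (mono (e k)) n ⟩
    w k * (G l ⊛ mono (e k)) n
      ≡⟨ cong (w k *_) (scale-⊛ (w′ l) (mono (e′ l)) (mono (e k)) n) ⟩
    w k * (w′ l * (mono (e′ l) ⊛ mono (e k)) n)
      ≡⟨ sym (ℤ.*-assoc (w k) (w′ l) _) ⟩
    w k * w′ l * (mono (e′ l) ⊛ mono (e k)) n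
      ≡⟨ cong (w k * w′ l *_) (trans (⊛-comm (mono (e′ l)) (mono (e k)) n) (mono-⊛-mono (e k) (e′ l) n)) ⟩
    w k * w′ l * mono (e k ℕ.+ e′ l) n ∎

-- Box sums over ℤ² and matchings of their supports

Plane : Set
Plane = ℤ × ℤ

Weight : Set
Weight = Plane → ℤ

bsum₂ : ℕ → Weight → ℤ
bsum₂ R F = bsum R (λ k → bsum R (λ l → F (k , l)))

bsum₂-cong : ∀ R {F G : Weight} → (∀ p → F p ≡ G p) → bsum₂ R F ≡ bsum₂ R G
bsum₂-cong R F≗G = bsum-cong R λ k → bsum-cong R λ l → F≗G (k , l)

bsum₂-+ : ∀ R (F G : Weight) → bsum₂ R (λ p → F p + G p) ≡ bsum₂ R F + bsum₂ R G
bsum₂-+ R F G = trans (bsum-cong R λ k → bsum-+ R (λ l → F (k , l)) (λ l → G (k , l)))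
  (bsum-+ R (λ k → bsum R λ l → F (k , l)) (λ k → bsum R λ l → G (k , l)))

bsum₂-neg : ∀ R (F : Weight) → bsum₂ R (λ p → - F p) ≡ - bsum₂ R F
bsum₂-neg R F = trans (bsum-cong R λ k → bsum-neg R (λ l → F (k , l)))
  (bsum-neg R (λ k → bsum R λ l → F (k , l)))

bsum₂-0 : ∀ R → bsum₂ R (λ _ → + 0) ≡ + 0
bsum₂-0 R = trans (bsum-cong R λ _ → bsum-0 R) (bsum-0 R)

bsum₂-swap : ∀ R (F : Plane → Plane → ℤ) →
  bsum₂ R (λ p → bsum₂ R (F p)) ≡ bsum₂ R (λ r → bsum₂ R (λ p → F p r))
bsum₂-swap R F = begin
  bsum R (λ a → bsum R (λ b → bsum R (λ c → bsum R (λ d → F (a , b) (c , d)))))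
    ≡⟨ bsum-cong R (λ a → bsum-swap R (λ b c → bsum R (λ d → F (a , b) (c , d)))) ⟩
  bsum R (λ a → bsum R (λ c → bsum R (λ b → bsum R (λ d → F (a , b) (c , d)))))
    ≡⟨ bsum-swap R (λ a c → bsum R (λ b → bsum R (λ d → F (a , b) (c , d)))) ⟩
  bsum R (λ c → bsum R (λ a → bsum R (λ b → bsum R (λ d → F (a , b) (c , d)))))
    ≡⟨ bsum-cong R (λ c → bsum-cong R (λ a → bsum-swap R (λ b d → F (a , b) (c , d)))) ⟩
  bsum R (λ c → bsum R (λ a → bsum R (λ d → bsum R (λ b → F (a , b) (c , d)))))
    ≡⟨ bsum-cong R (λ c → bsum-swap R (λ a d → bsum R (λ b → F (a , b) (c , d)))) ⟩
  bsum R (λ c → bsum R (λ d → bsum R (λ a → bsum R (λ b → F (a , b) (c , d))))) ∎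
  where open ≡-Reasoning

InBox : ℕ → Plane → Set
InBox R (k , l) = ℤ.∣ k ∣ ≤ R × ℤ.∣ l ∣ ≤ R

δ₂ : Plane → Plane → ℤ
δ₂ (a , b) (k , l) = δ a k * δ b l

δ₂-≡ : ∀ p → δ₂ p p ≡ + 1
δ₂-≡ (a , b) = cong₂ _*_ (δ-≡ a) (δ-≡ b)

δ₂-≢ : ∀ {p r} → r ≢ p → δ₂ p r ≡ + 0
δ₂-≢ {a , b} {k , l} r≢p with k ℤ.≟ a
... | no _ = refl
... | yes refl with l ℤ.≟ b
...   | no _     = refl
...   | yes refl = contradiction refl r≢p

bsum₂-δ : ∀ R p c → InBox R p → bsum₂ R (λ r → δ₂ p r * c) ≡ c
bsum₂-δ R (a , b) c (a≤R , b≤R) = begin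
  bsum R (λ k → bsum R (λ l → δ a k * δ b l * c))
    ≡⟨ bsum-cong R (λ k → trans (bsum-cong R λ l → ℤ.*-assoc (δ a k) (δ b l) c)
         (bsum-*ˡ R (δ a k) (λ l → δ b l * c))) ⟩
  bsum R (λ k → δ a k * bsum R (λ l → δ b l * c))
    ≡⟨ bsum-δ R a (λ _ → bsum R (λ l → δ b l * c)) a≤R ⟩
  bsum R (λ l → δ b l * c)
    ≡⟨ bsum-δ R b (λ _ → c) b≤R ⟩
  c ∎
  where open ≡-Reasoning

-- A weight-preserving bijection between supports. A relation is used because partners are needed
-- only where the weight is nonzero, and there they may come from a case distinction or a division;
-- the box conditions ensure that no partner is lost at the boundary.
record Matching (R : ℕ) (F G : Weight) : Set₁ where
  field
    Rel  : Plane → Plane → Set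
    to   : ∀ p → F p ≢ + 0 → ∃[ r ] (G r ≡ F p × Rel p r)
    from : ∀ r → G r ≢ + 0 → ∃[ p ] (F p ≡ G r × Rel p r)
    functional : ∀ {p r r′} → Rel p r → Rel p r′ → r ≡ r′
    injective  : ∀ {p p′ r} → Rel p r → Rel p′ r → p ≡ p′
    boxˡ : ∀ p → F p ≢ + 0 → InBox R p
    boxʳ : ∀ r → G r ≢ + 0 → InBox R r

module _ {R F G} (M : Matching R F G) where
  open Matching M

  private
    image : Plane → Plane
    image p with F p ℤ.≟ + 0
    ... | yes _  = p
    ... | no F≢0 = proj₁ (to p F≢0)

    preimage : Plane → Plane
    preimage r with G r ℤ.≟ + 0
    ... | yes _  = r
    ... | no G≢0 = proj₁ (from r G≢0)

    δ₂-kill : ∀ p r c → r ≢ p → δ₂ p r * c ≡ + 0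
    δ₂-kill p r c r≢p = cong (_* c) (δ₂-≢ {p} {r} r≢p)

    matched : ∀ p r p′ r′ → G r′ ≡ F p → Rel p r′ → Rel p′ r → δ₂ r′ r * F p ≡ δ₂ p′ p * G r
    matched p r p′ r′ G≡F p~r′ p′~r with ≡-dec ℤ._≟_ ℤ._≟_ r r′
    ... | no r≢r′ = trans (δ₂-kill r′ r (F p) r≢r′)
      (sym (δ₂-kill p′ p (G r) λ { refl → r≢r′ (functional p′~r p~r′) }))
    ... | yes refl with injective p~r′ p′~r
    ...   | refl = cong₂ _*_ (trans (δ₂-≡ r) (sym (δ₂-≡ p))) (sym G≡F)

    -- Both sides are the weighted indicator of p and r being partners, seen from p and from r. If
    -- only one of the weights vanishes, the points cannot be partners, because partners have equal
    -- weight.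
    transfer : ∀ p r → δ₂ (image p) r * F p ≡ δ₂ (preimage r) p * G r
    transfer p r with F p ℤ.≟ + 0 | G r ℤ.≟ + 0
    ... | yes F≡0 | yes G≡0 = trans (trans (cong (δ₂ p r *_) F≡0) (ℤ.*-zeroʳ (δ₂ p r)))
      (sym (trans (cong (δ₂ r p *_) G≡0) (ℤ.*-zeroʳ (δ₂ r p))))
    ... | yes F≡0 | no G≢0  with from r G≢0
    ...   | p′ , F≡G , _ = trans (trans (cong (δ₂ p r *_) F≡0) (ℤ.*-zeroʳ (δ₂ p r)))
      (sym (δ₂-kill p′ p (G r) λ { refl → G≢0 (trans (sym F≡G) F≡0) }))
    transfer p r | no F≢0 | yes G≡0 with to p F≢0
    ...   | r′ , G≡F , _ = trans (δ₂-kill r′ r (F p) λ { refl → F≢0 (trans (sym G≡F) G≡0) })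
      (sym (trans (cong (δ₂ r p *_) G≡0) (ℤ.*-zeroʳ (δ₂ r p))))
    transfer p r | no F≢0 | no G≢0 with to p F≢0 | from r G≢0
    ...   | r′ , G≡F , p~r′ | p′ , _ , p′~r = matched p r p′ r′ G≡F p~r′ p′~r

    image-box : ∀ p → F p ≢ + 0 → InBox R (image p)
    image-box p F≢0 with F p ℤ.≟ + 0
    ... | yes F≡0 = contradiction F≡0 F≢0
    ... | no F≢0′ = boxʳ (proj₁ (to p F≢0′)) λ G≡0 → F≢0 (trans (sym (proj₁ (proj₂ (to p F≢0′)))) G≡0)

    preimage-box : ∀ r → G r ≢ + 0 → InBox R (preimage r)
    preimage-box r G≢0 with G r ℤ.≟ + 0
    ... | yes G≡0 = contradiction G≡0 G≢0
    ... | no G≢0′ = boxˡ (proj₁ (from r G≢0′)) λ F≡0 → G≢0 (trans (sym (proj₁ (proj₂ (from r G≢0′)))) F≡0)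

    spread : ∀ q c → (c ≢ + 0 → InBox R q) → c ≡ bsum₂ R (λ r → δ₂ q r * c)
    spread q c box with c ℤ.≟ + 0
    ... | yes refl = sym (trans (bsum₂-cong R λ r → ℤ.*-zeroʳ (δ₂ q r)) (bsum₂-0 R))
    ... | no c≢0   = sym (bsum₂-δ R q c (box c≢0))

  -- Double counting over pairs (p , r): every nonzero weight is placed on its matched pair, and the
  -- order of summation is exchanged.
  bsum₂-matching : bsum₂ R F ≡ bsum₂ R G
  bsum₂-matching = begin
    bsum₂ R F
      ≡⟨ bsum₂-cong R (λ p → spread (image p) (F p) (image-box p)) ⟩
    bsum₂ R (λ p → bsum₂ R (λ r → δ₂ (image p) r * F p))
      ≡⟨ bsum₂-cong R (λ p → bsum₂-cong R (λ r → transfer p r)) ⟩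
    bsum₂ R (λ p → bsum₂ R (λ r → δ₂ (preimage r) p * G r))
      ≡⟨ bsum₂-swap R (λ p r → δ₂ (preimage r) p * G r) ⟩
    bsum₂ R (λ r → bsum₂ R (λ p → δ₂ (preimage r) p * G r))
      ≡⟨ sym (bsum₂-cong R (λ r → spread (preimage r) (G r) (preimage-box r))) ⟩
    bsum₂ R G ∎
    where open ≡-Reasoning

bsum₂-antisymmetric : ∀ {R F} → Matching R F (λ p → - F p) → bsum₂ R F ≡ + 0
bsum₂-antisymmetric {R} {F} M = i≡-i⇒i≡0 (trans (bsum₂-matching M) (bsum₂-neg R F))
  where
  i≡-i⇒i≡0 : ∀ {i} → i ≡ - i → i ≡ + 0
  i≡-i⇒i≡0 {+ zero} _ = refl
  i≡-i⇒i≡0 {+ suc n} ()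
  i≡-i⇒i≡0 { -[1+ n ]} ()

-- Periodic functions on ℤ

-- A nonzero multiple of n has absolute value at least n, while two numbers below n differ by less.
≡-by-difference : ∀ {r r′ n} k → r < n → r′ < n → + r - + r′ ≡ k * + n → r ≡ r′
≡-by-difference {r} {r′} {n} k r<n r′<n eq with k ℤ.≟ + 0
... | yes refl = ℤ.+-injective (ℤ.i-j≡0⇒i≡j (+ r) (+ r′) eq)
... | no k≢0  = contradiction (ℕ.≤-<-trans n≤∣r⊖r′∣ ∣r⊖r′∣<n) (ℕ.<-irrefl refl)
  where
  ∣r⊖r′∣<n : ℤ.∣ r ℤ.⊖ r′ ∣ < n
  ∣r⊖r′∣<n = ℕ.≤-<-trans (ℤ.∣m⊝n∣≤m⊔n r r′) (ℕ.⊔-lub r<n r′<n)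
  n≤∣r⊖r′∣ : n ≤ ℤ.∣ r ℤ.⊖ r′ ∣
  n≤∣r⊖r′∣ = subst (n ≤_) (sym (trans (cong ℤ.∣_∣ (trans (sym (ℤ.m-n≡m⊖n r r′)) eq))
    (ℤ.abs-* k (+ n)))) (ℕ.m≤n*m n ℤ.∣ k ∣ {{ℕ.≢-nonZero (k≢0 ∘ ℤ.∣i∣≡0⇒i≡0)}})

Periodic : ℕ → (ℤ → ℤ) → Set
Periodic n f = ∀ z k → f (z + k * + n) ≡ f z

%ℕ-periodic : ∀ n .{{_ : ℕ.NonZero n}} z k → (z + k * + n) %ℕ n ≡ z %ℕ n
%ℕ-periodic n z k = ≡-by-difference (z /ℕ n + k - (z + k * + n) /ℕ n)
  (n%ℕd<d (z + k * + n) n) (n%ℕd<d z n) (begin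
  + ((z + k * + n) %ℕ n) - + (z %ℕ n)
    ≡⟨ cancel (+ ((z + k * + n) %ℕ n)) ((z + k * + n) /ℕ n * + n) (+ (z %ℕ n)) (z /ℕ n * + n) ⟩
  + ((z + k * + n) %ℕ n) + (z + k * + n) /ℕ n * + n - (+ (z %ℕ n) + z /ℕ n * + n)
    + (z /ℕ n * + n - (z + k * + n) /ℕ n * + n)
    ≡⟨ cong₂ (λ a b → a - b + (z /ℕ n * + n - (z + k * + n) /ℕ n * + n))
         (sym (a≡a%ℕn+[a/ℕn]*n (z + k * + n) n)) (sym (a≡a%ℕn+[a/ℕn]*n z n)) ⟩
  z + k * + n - z + (z /ℕ n * + n - (z + k * + n) /ℕ n * + n)
    ≡⟨ collect z k (+ n) (z /ℕ n) ((z + k * + n) /ℕ n) ⟩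
  (z /ℕ n + k - (z + k * + n) /ℕ n) * + n ∎)
  where
  open ≡-Reasoning
  cancel : ∀ a b c d → a - c ≡ a + b - (c + d) + (d - b)
  cancel = solve-∀
  collect : ∀ z k n q q′ → z + k * n - z + (q * n - q′ * n) ≡ (q + k - q′) * n
  collect = solve-∀

periodic-* : ∀ {n f} m → Periodic n f → Periodic (m ℕ.* n) f
periodic-* {n} {f} m f-per z k = trans (cong (λ x → f (z + x))
  (trans (cong (k *_) (ℤ.pos-* m n)) (sym (ℤ.*-assoc k (+ m) (+ n))))) (f-per z (k * + m))

-- Both functions depend on the residue of z only. An identity between periodic functions thus
-- becomes a decidable check over one period, which is how the character identities below are
-- obtained.
periodic-ext : ∀ {n f g} .{{_ : ℕ.NonZero n}} → Periodic n f → Periodic n g →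
  (∀ {r} → r < n → f (+ r) ≡ g (+ r)) → ∀ z → f z ≡ g z
periodic-ext {n} {f} {g} f-per g-per f≗g z = begin
  f z                               ≡⟨ cong f (a≡a%ℕn+[a/ℕn]*n z n) ⟩
  f (+ (z %ℕ n) + z /ℕ n * + n)     ≡⟨ f-per (+ (z %ℕ n)) (z /ℕ n) ⟩
  f (+ (z %ℕ n))                    ≡⟨ f≗g (n%ℕd<d z n) ⟩
  g (+ (z %ℕ n))                    ≡⟨ sym (g-per (+ (z %ℕ n)) (z /ℕ n)) ⟩
  g (+ (z %ℕ n) + z /ℕ n * + n)     ≡⟨ cong g (sym (a≡a%ℕn+[a/ℕn]*n z n)) ⟩
  g z                               ∎
  where open ≡-Reasoning

periodic-neg : ∀ {n f} → Periodic n f → Periodic n (λ z → f (- z))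
periodic-neg {n} {f} f-per z k = trans (cong f (identity z k (+ n))) (f-per (- z) (- k))
  where
  identity : ∀ z k n → - (z + k * n) ≡ - z + - k * n
  identity = solve-∀

residue : (n : ℕ) .{{_ : ℕ.NonZero n}} → ℕ → ℤ → ℤ
residue n r z = mono r (z %ℕ n)

residue-periodic : ∀ n .{{_ : ℕ.NonZero n}} r → Periodic n (residue n r)
residue-periodic n r z k = cong (mono r) (%ℕ-periodic n z k)

mono-≢0 : ∀ {e n} → mono e n ≢ + 0 → n ≡ e
mono-≢0 {e} {n} ≢0 with n ℕ.≟ e
... | yes n≡e = n≡e
... | no _    = contradiction refl ≢0

residue-support : ∀ n .{{_ : ℕ.NonZero n}} r z → residue n r z ≢ + 0 → ∃[ k ] z ≡ + r + k * + n
residue-support n r z ≢0 = z /ℕ n , trans (a≡a%ℕn+[a/ℕn]*n z n)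
  (cong (λ s → + s + z /ℕ n * + n) (mono-≢0 ≢0))

*-≢0 : ∀ a b → a * b ≢ + 0 → a ≢ + 0 × b ≢ + 0
*-≢0 a b ab≢0 = (λ { refl → ab≢0 refl }) , λ { refl → ab≢0 (ℤ.*-zeroʳ a) }

-≢0 : ∀ {a} → - a ≢ + 0 → a ≢ + 0
-≢0 -a≢0 refl = -a≢0 refl

+-≢0 : ∀ a b → a + b ≢ + 0 → a ≢ + 0 ⊎ b ≢ + 0
+-≢0 a b a+b≢0 with a ℤ.≟ + 0
... | no a≢0   = inj₁ a≢0
... | yes refl = inj₂ λ { refl → a+b≢0 refl }

sgnℕ-square : ∀ n → sgnℕ n * sgnℕ n ≡ + 1
sgnℕ-square zero    = refl
sgnℕ-square (suc n) = trans (neg-square (sgnℕ n)) (sgnℕ-square n)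
  where
  neg-square : ∀ a → - a * - a ≡ a * a
  neg-square = solve-∀

sgn-square : ∀ z → sgn z * sgn z ≡ + 1
sgn-square z = sgnℕ-square ℤ.∣ z ∣

sgn-neg : ∀ z → sgn (- z) ≡ sgn z
sgn-neg z = cong sgnℕ (ℤ.∣-i∣≡∣i∣ z)

sgn-+ : ∀ a b → sgn (a + b) ≡ sgn a * sgn b
sgn-+ (+ m) b = pos m b
  where
  pos : ∀ m b → sgn (+ m + b) ≡ sgnℕ m * sgn b
  pos zero    b = trans (cong sgn (ℤ.+-identityˡ b)) (sym (ℤ.*-identityˡ (sgn b)))
  pos (suc m) b = trans (cong sgn (ℤ.+-assoc (+ 1) (+ m) b)) (trans (sgn-suc (+ m + b))
    (trans (cong -_ (pos m b)) (ℤ.neg-distribˡ-* (sgnℕ m) (sgn b))))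
sgn-+ -[1+ m ] b = begin
  sgn (-[1+ m ] + b)                 ≡⟨ sym (sgn-neg (-[1+ m ] + b)) ⟩
  sgn (- (-[1+ m ] + b))             ≡⟨ cong sgn (ℤ.neg-distrib-+ -[1+ m ] b) ⟩
  sgn (+ suc m + - b)                ≡⟨ sgn-+ (+ suc m) (- b) ⟩
  sgnℕ (suc m) * sgn (- b)           ≡⟨ cong (sgnℕ (suc m) *_) (sgn-neg b) ⟩
  sgn -[1+ m ] * sgn b               ∎
  where open ≡-Reasoning

sgn-double : ∀ k → sgn (k * + 2) ≡ + 1
sgn-double k = trans (cong sgn (double k)) (trans (sgn-+ k k) (sgn-square k))
  where
  double : ∀ k → k * + 2 ≡ k + k
  double = solve-∀

sgn-periodic : Periodic 2 sgn
sgn-periodic z k = trans (sgn-+ z (k * + 2))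
  (trans (cong (sgn z *_) (sgn-double k)) (ℤ.*-identityʳ (sgn z)))

-- Sign characters

-- `χ₁₂` is the quadratic character modulo 12, the sign of the pentagonal number theorem. `ε₅` marks
-- the class of x = 10 a + 3, and `σ₇` is the odd function that separates y = 14 b + 5 from y = -
-- (14 b + 5).
odd even three₆ unit₆ χ₁₂ ε₅ σ₇ : ℤ → ℤ
odd    = residue 2 1
even   = residue 2 0
three₆ = residue 6 3
unit₆ z = residue 6 1 z + residue 6 5 z
χ₁₂ z = residue 12 1 z - residue 12 5 z - residue 12 7 z + residue 12 11 z
ε₅     = residue 5 3
σ₇ z   = residue 7 5 z - residue 7 2 z

odd-periodic : Periodic 2 odd
odd-periodic = residue-periodic 2 1

even-periodic : Periodic 2 even
even-periodic = residue-periodic 2 0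

three₆-periodic : Periodic 6 three₆
three₆-periodic = residue-periodic 6 3

unit₆-periodic : Periodic 6 unit₆
unit₆-periodic z k = cong₂ _+_ (residue-periodic 6 1 z k) (residue-periodic 6 5 z k)

χ₁₂-periodic : Periodic 12 χ₁₂
χ₁₂-periodic z k = cong₂ _+_ (cong₂ _-_ (cong₂ _-_ (residue-periodic 12 1 z k)
  (residue-periodic 12 5 z k)) (residue-periodic 12 7 z k)) (residue-periodic 12 11 z k)

ε₅-periodic : Periodic 5 ε₅
ε₅-periodic = residue-periodic 5 3

σ₇-periodic : Periodic 7 σ₇
σ₇-periodic z k = cong₂ _-_ (residue-periodic 7 5 z k) (residue-periodic 7 2 z k)

σ₇-neg : ∀ z → σ₇ (- z) ≡ - σ₇ z
σ₇-neg = periodic-ext (periodic-neg {f = σ₇} σ₇-periodic) (λ z k → cong -_ (σ₇-periodic z k))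
  (from-yes (ℕ.allUpTo? (λ r → σ₇ (- + r) ℤ.≟ - σ₇ (+ r)) 7))

three₆-neg : ∀ z → three₆ (- z) ≡ three₆ z
three₆-neg = periodic-ext (periodic-neg {f = three₆} three₆-periodic) three₆-periodic
  (from-yes (ℕ.allUpTo? (λ r → three₆ (- + r) ℤ.≟ three₆ (+ r)) 6))

unit₆-neg : ∀ z → unit₆ (- z) ≡ unit₆ z
unit₆-neg = periodic-ext (periodic-neg {f = unit₆} unit₆-periodic) unit₆-periodic
  (from-yes (ℕ.allUpTo? (λ r → unit₆ (- + r) ℤ.≟ unit₆ (+ r)) 6))

even-neg : ∀ z → even (- z) ≡ even z
even-neg = periodic-ext (periodic-neg {f = even} even-periodic) even-periodic
  (from-yes (ℕ.allUpTo? (λ r → even (- + r) ℤ.≟ even (+ r)) 2))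

unit₆+three₆ : ∀ z → odd z ≡ unit₆ z + three₆ z
unit₆+three₆ = periodic-ext (periodic-* {f = odd} 3 odd-periodic)
  (λ z k → cong₂ _+_ (unit₆-periodic z k) (three₆-periodic z k))
  (from-yes (ℕ.allUpTo? (λ r → odd (+ r) ℤ.≟ unit₆ (+ r) + three₆ (+ r)) 6))

odd-even : ∀ z → - sgn z ≡ odd z - even z
odd-even = periodic-ext (λ z k → cong -_ (sgn-periodic z k))
  (λ z k → cong₂ _-_ (odd-periodic z k) (even-periodic z k))
  (from-yes (ℕ.allUpTo? (λ r → - sgn (+ r) ℤ.≟ odd (+ r) - even (+ r)) 2))

shift-periodic : ∀ {n f} a → Periodic n f → Periodic n (λ z → f (a + z))
shift-periodic {f = f} a f-per z k = trans (cong f (sym (ℤ.+-assoc a z (k * + _)))) (f-per (a + z) k)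

even-suc : ∀ z → even (+ 1 + z) ≡ odd z
even-suc = periodic-ext (shift-periodic {f = even} (+ 1) even-periodic) odd-periodic
  (from-yes (ℕ.allUpTo? (λ r → even (+ 1 + + r) ℤ.≟ odd (+ r)) 2))

odd-suc : ∀ z → odd (+ 1 + z) ≡ even z
odd-suc = periodic-ext (shift-periodic {f = odd} (+ 1) odd-periodic) even-periodic
  (from-yes (ℕ.allUpTo? (λ r → odd (+ 1 + + r) ℤ.≟ even (+ r)) 2))

χ₁₂-dilate : ∀ a → Periodic 2 (λ i → χ₁₂ (a + i * + 6))
χ₁₂-dilate a i k = trans (cong χ₁₂ (identity a i k)) (χ₁₂-periodic (a + i * + 6) k)
  where
  identity : ∀ a i k → a + (i + k * + 2) * + 6 ≡ a + i * + 6 + k * + 12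
  identity = solve-∀

χ₁₂-1 : ∀ i → χ₁₂ (+ 1 + i * + 6) ≡ sgn i
χ₁₂-1 = periodic-ext (χ₁₂-dilate (+ 1)) sgn-periodic
  (from-yes (ℕ.allUpTo? (λ r → χ₁₂ (+ 1 + + r * + 6) ℤ.≟ sgn (+ r)) 2))

χ₁₂-[-1] : ∀ i → χ₁₂ (- + 1 + i * + 6) ≡ sgn i
χ₁₂-[-1] = periodic-ext (χ₁₂-dilate (- + 1)) sgn-periodic
  (from-yes (ℕ.allUpTo? (λ r → χ₁₂ (- + 1 + + r * + 6) ℤ.≟ sgn (+ r)) 2))

-- The left-hand side as a theta series

-- The sign of the term q^((j² - 529) / 840), where ε₅ selects one of ± j; outside the support of h
-- the value of eS below is junk.
h : ℤ → ℤ
h j = ε₅ j * χ₁₂ j * - σ₇ j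

h-periodic : Periodic 420 h
h-periodic z k = cong₂ _*_ (cong₂ _*_ (periodic-* {f = ε₅} 84 ε₅-periodic z k)
  (periodic-* {f = χ₁₂} 35 χ₁₂-periodic z k)) (cong -_ (periodic-* {f = σ₇} 60 σ₇-periodic z k))

h-shift : ∀ k r → h (+ (k ℕ.* 420 ℕ.+ r)) ≡ h (+ r)
h-shift k r = trans (cong h (trans (ℤ.pos-+ (k ℕ.* 420) r)
  (trans (cong (_+ + r) (ℤ.pos-* k 420)) (ℤ.+-comm (+ k * + 420) (+ r))))) (h-periodic (+ r) (+ k))

h-shift-neg : ∀ k r → h (- + (k ℕ.* 420 ℕ.+ r)) ≡ h (- + r)
h-shift-neg k r = trans (cong h (trans (cong -_ (trans (ℤ.pos-+ (k ℕ.* 420) r)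
  (cong (_+ + r) (ℤ.pos-* k 420)))) (identity (+ k) (+ r)))) (h-periodic (- + r) (- + k))
  where
  identity : ∀ k r → - (k * + 420 + r) ≡ - r + - k * + 420
  identity = solve-∀

eS : ℤ → ℕ
eS j = (ℤ.∣ j ∣ ℕ.* ℤ.∣ j ∣ ∸ 529) ℕ./ 840

eS-unique : ∀ j m → ℤ.∣ j ∣ ℕ.* ℤ.∣ j ∣ ≡ 840 ℕ.* m ℕ.+ 529 → eS j ≡ m
eS-unique j m eq = begin
  (ℤ.∣ j ∣ ℕ.* ℤ.∣ j ∣ ∸ 529) ℕ./ 840   ≡⟨ cong (λ x → (x ∸ 529) ℕ./ 840) eq ⟩
  (840 ℕ.* m ℕ.+ 529 ∸ 529) ℕ./ 840     ≡⟨ cong (ℕ._/ 840) (ℕ.m+n∸n≡m (840 ℕ.* m) 529) ⟩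
  840 ℕ.* m ℕ./ 840                      ≡⟨ cong (ℕ._/ 840) (ℕ.*-comm 840 m) ⟩
  m ℕ.* 840 ℕ./ 840                      ≡⟨ m*n/n≡m m 840 ⟩
  m                                      ∎
  where open ≡-Reasoning

-- Because 420² = 210 · 840 and 2 · 420 = 840, a square modulo 840 depends on its root modulo 420
-- only. The identity is polynomial in e = 210, with 420 = 2 e and 840 = 4 e.
square-shift : ∀ k r → (k ℕ.* 420 ℕ.+ r) ℕ.* (k ℕ.* 420 ℕ.+ r) ≡
  r ℕ.* r ℕ.+ (210 ℕ.* (k ℕ.* k) ℕ.+ k ℕ.* r) ℕ.* 840
square-shift k r = identity 210 k r
  where
  identity : ∀ e k r → (k ℕ.* (2 ℕ.* e) ℕ.+ r) ℕ.* (k ℕ.* (2 ℕ.* e) ℕ.+ r) ≡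
    r ℕ.* r ℕ.+ (e ℕ.* (k ℕ.* k) ℕ.+ k ℕ.* r) ℕ.* (4 ℕ.* e)
  identity = ℕ-Solver.solve-∀

square-from-residue : ∀ a → (a ℕ.% 420) ℕ.* (a ℕ.% 420) ℕ.% 840 ≡ 529 →
  ∃[ m ] a ℕ.* a ≡ 840 ℕ.* m ℕ.+ 529
square-from-residue a r²≡529 = Q ℕ.+ q , (begin
  a ℕ.* a
    ≡⟨ cong (λ x → x ℕ.* x) (trans (m≡m%n+[m/n]*n a 420) (ℕ.+-comm r (k ℕ.* 420))) ⟩
  (k ℕ.* 420 ℕ.+ r) ℕ.* (k ℕ.* 420 ℕ.+ r)
    ≡⟨ square-shift k r ⟩
  r ℕ.* r ℕ.+ q ℕ.* 840
    ≡⟨ cong (ℕ._+ q ℕ.* 840) (trans (m≡m%n+[m/n]*n (r ℕ.* r) 840) (cong (ℕ._+ Q ℕ.* 840) r²≡529)) ⟩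
  529 ℕ.+ Q ℕ.* 840 ℕ.+ q ℕ.* 840
    ≡⟨ regroup 529 840 Q q ⟩
  840 ℕ.* (Q ℕ.+ q) ℕ.+ 529 ∎)
  where
  open ≡-Reasoning
  r = a ℕ.% 420
  k = a ℕ./ 420
  q = 210 ℕ.* (k ℕ.* k) ℕ.+ k ℕ.* r
  Q = r ℕ.* r ℕ./ 840
  regroup : ∀ a b x y → a ℕ.+ x ℕ.* b ℕ.+ y ℕ.* b ≡ b ℕ.* (x ℕ.+ y) ℕ.+ a
  regroup = ℕ-Solver.solve-∀

residue-from-square : ∀ k r m → (k ℕ.* 420 ℕ.+ r) ℕ.* (k ℕ.* 420 ℕ.+ r) ≡ 840 ℕ.* m ℕ.+ 529 →
  r ℕ.* r ℕ.% 840 ≡ 529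
residue-from-square k r m eq = begin
  r ℕ.* r ℕ.% 840
    ≡⟨ sym ([m+kn]%n≡m%n (r ℕ.* r) q 840) ⟩
  (r ℕ.* r ℕ.+ q ℕ.* 840) ℕ.% 840
    ≡⟨ cong (ℕ._% 840) (trans (sym (square-shift k r)) eq) ⟩
  (840 ℕ.* m ℕ.+ 529) ℕ.% 840
    ≡⟨ cong (ℕ._% 840) (trans (ℕ.+-comm (840 ℕ.* m) 529) (cong (529 ℕ.+_) (ℕ.*-comm 840 m))) ⟩
  (529 ℕ.+ m ℕ.* 840) ℕ.% 840
    ≡⟨ [m+kn]%n≡m%n 529 m 840 ⟩
  529 ∎
  where
  open ≡-Reasoning
  q = 210 ℕ.* (k ℕ.* k) ℕ.+ k ℕ.* r

-- Behind the check: 840 = 24 · 5 · 7 and 529 is 1, 4, 4 modulo these factors. A nonzero `χ₁₂` makes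
-- the root coprime to 6, so its square is 1 modulo 24; nonzero `ε₅` and `σ₇` make it ± 2 modulo 5
-- and 7.
h-residues : ∀ {r} → r < 420 → (h (+ r) ≡ + 0 × h (- + r) ≡ + 0) ⊎ r ℕ.* r ℕ.% 840 ≡ 529
h-residues = from-yes (ℕ.allUpTo? (λ r →
  (h (+ r) ℤ.≟ + 0 ×-dec h (- + r) ℤ.≟ + 0) ⊎-dec (r ℕ.* r ℕ.% 840 ℕ.≟ 529)) 420)

h-square : ∀ j → h j ≢ + 0 → ℤ.∣ j ∣ ℕ.* ℤ.∣ j ∣ ≡ 840 ℕ.* eS j ℕ.+ 529
h-square j h≢0 = trans (proj₂ square)
  (cong (λ x → 840 ℕ.* x ℕ.+ 529) (sym (eS-unique j (proj₁ square) (proj₂ square))))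
  where
  a = ℤ.∣ j ∣
  a≡ : a ≡ a ℕ./ 420 ℕ.* 420 ℕ.+ a ℕ.% 420
  a≡ = trans (m≡m%n+[m/n]*n a 420) (ℕ.+-comm (a ℕ.% 420) (a ℕ./ 420 ℕ.* 420))
  reduce : ∀ j → h (+ (ℤ.∣ j ∣ ℕ.% 420)) ≡ + 0 → h (- + (ℤ.∣ j ∣ ℕ.% 420)) ≡ + 0 →
    ℤ.∣ j ∣ ≡ ℤ.∣ j ∣ ℕ./ 420 ℕ.* 420 ℕ.+ ℤ.∣ j ∣ ℕ.% 420 → h j ≡ + 0
  reduce (+ n)    h₊ h₋ eq = trans (cong (h ∘ +_) eq) (trans (h-shift (n ℕ./ 420) (n ℕ.% 420)) h₊)
  reduce -[1+ n ] h₊ h₋ eq = trans (cong (h ∘ -_ ∘ +_) eq)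
    (trans (h-shift-neg (suc n ℕ./ 420) (suc n ℕ.% 420)) h₋)
  r²≡529 : (a ℕ.% 420) ℕ.* (a ℕ.% 420) ℕ.% 840 ≡ 529
  r²≡529 = [ (λ (h₊ , h₋) → contradiction (reduce j h₊ h₋ a≡) h≢0) , (λ eq → eq) ]′
    (h-residues (m%n<n a 420))
  square = square-from-residue ℤ.∣ j ∣ r²≡529

-- The square roots of 529 modulo 840 that are below 420 (modulo 840 they recur with period 420),
-- followed by 443 = 23 + 420.
root : ℕ → ℕ
root 0  = 23
root 1  = 37
root 2  = 47
root 3  = 103
root 4  = 107
root 5  = 163
root 6  = 173
root 7  = 187
root 8  = 233
root 9  = 247
root 10 = 257
root 11 = 313
root 12 = 317
root 13 = 373
root 14 = 383
root 15 = 397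
root _  = 443

rootIndex : ℕ → ℕ
rootIndex i = (root i ℕ.* root i ∸ 529) ℕ./ 840

J : ℕ → ℕ → ℕ
J k i = k ℕ.* 420 ℕ.+ root i

-- By `square-shift` this is the m with 840 m + 529 = (`J k i`)². For i < 16 it turns out to be the
-- member of S with number 16 k + i.
A : ℕ → ℕ → ℕ
A k i = 210 ℕ.* (k ℕ.* k) ℕ.+ k ℕ.* root i ℕ.+ rootIndex i

abstract

  root-square : ∀ {i} → i < 17 → root i ℕ.* root i ≡ rootIndex i ℕ.* 840 ℕ.+ 529
  root-square = from-yes (ℕ.allUpTo? (λ i → root i ℕ.* root i ℕ.≟ rootIndex i ℕ.* 840 ℕ.+ 529) 17)

  root-complete : ∀ {r} → r < 420 → r ℕ.* r ℕ.% 840 ≡ 529 → ∃[ i ] (i < 16 × r ≡ root i)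
  root-complete = from-yes (ℕ.allUpTo? (λ r →
    (r ℕ.* r ℕ.% 840 ℕ.≟ 529) →-dec ℕ.anyUpTo? (λ i → r ℕ.≟ root i) 16) 420)

  -- The range extends to 443 so that the last gap, from 397 to 23 + 420, which straddles the end of
  -- the period, is covered too.
  root-consecutive : ∀ {i} → i < 16 → ∀ {r} → r < 443 → r ℕ.* r ℕ.% 840 ≡ 529 →
    r ≤ root i ⊎ root (suc i) ≤ r
  root-consecutive = from-yes (ℕ.allUpTo? (λ i → ℕ.allUpTo? (λ r → (r ℕ.* r ℕ.% 840 ℕ.≟ 529) →-dec
    ((r ℕ.≤? root i) ⊎-dec (root (suc i) ℕ.≤? r))) 443) 16)

  root-bounds : ∀ {i} → i < 16 → root i < root (suc i) × root (suc i) ≤ 443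
  root-bounds = from-yes (ℕ.allUpTo? (λ i → (root i ℕ.<? root (suc i)) ×-dec (root (suc i) ℕ.≤? 443)) 16)

  -- Here the values of `t` meet the characters. Each root is ± 2 modulo 5, so `ε₅` annihilates
  -- exactly one of the two summands and the other is the sign.
  root-sign : ∀ {i} → i < 16 → h (+ root i) + h (- + root i) ≡ (- + 1) ℤ.^ t i
  root-sign = from-yes (ℕ.allUpTo? (λ i → h (+ root i) + h (- + root i) ℤ.≟ (- + 1) ℤ.^ t i) 16)

J-square : ∀ k {i} → i < 17 → J k i ℕ.* J k i ≡ 840 ℕ.* A k i ℕ.+ 529
J-square k {i} i<17 = begin
  J k i ℕ.* J k i
    ≡⟨ square-shift k (root i) ⟩
  root i ℕ.* root i ℕ.+ q ℕ.* 840
    ≡⟨ cong (ℕ._+ q ℕ.* 840) (root-square i<17) ⟩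
  rootIndex i ℕ.* 840 ℕ.+ 529 ℕ.+ q ℕ.* 840
    ≡⟨ regroup (rootIndex i) 840 529 q ⟩
  840 ℕ.* A k i ℕ.+ 529 ∎
  where
  open ≡-Reasoning
  q = 210 ℕ.* (k ℕ.* k) ℕ.+ k ℕ.* root i
  regroup : ∀ x b a y → x ℕ.* b ℕ.+ a ℕ.+ y ℕ.* b ≡ b ℕ.* (y ℕ.+ x) ℕ.+ a
  regroup = ℕ-Solver.solve-∀

square-index-injective : ∀ m n → 840 ℕ.* m ℕ.+ 529 ≡ 840 ℕ.* n ℕ.+ 529 → m ≡ n
square-index-injective m n eq = ℕ.*-cancelˡ-≡ m n 840 (ℕ.+-cancelʳ-≡ 529 (840 ℕ.* m) (840 ℕ.* n) eq)

square-mono-< : ∀ {m n} → m < n → 840 ℕ.* m ℕ.+ 529 < 840 ℕ.* n ℕ.+ 529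
square-mono-< m<n = ℕ.+-monoˡ-< 529 (ℕ.*-monoʳ-< 840 m<n)

square-cancel-< : ∀ {a b} → a ℕ.* a < b ℕ.* b → a < b
square-cancel-< {a} {b} a²<b² with ℕ.≤-<-connex b a
... | inj₁ b≤a = contradiction (ℕ.*-mono-≤ b≤a b≤a) (ℕ.<⇒≱ a²<b²)
... | inj₂ a<b = a<b

square-injective : ∀ {a b} → a ℕ.* a ≡ b ℕ.* b → a ≡ b
square-injective {a} {b} eq with ℕ.<-cmp a b
... | tri< a<b _ _ = contradiction eq (ℕ.<⇒≢ (ℕ.*-mono-< a<b a<b))
... | tri≈ _ a≡b _ = a≡b
... | tri> _ _ b<a = contradiction (sym eq) (ℕ.<⇒≢ (ℕ.*-mono-< b<a b<a))

-- Squaring preserves order, so such an m would give a j strictly between `J k i` and `J k (suc i)`.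
-- Then j - 420 k would be a square root of 529 modulo 840 strictly between neighbouring entries of
-- `root`.
A-<-gap : ∀ k {i m} → i < 16 → A k i < m → m < A k (suc i) → ¬ InS m
A-<-gap k {i} {m} i<16 lo hi (j , j²) = [ ℕ.<⇒≱ root<r , ℕ.<⇒≱ r<root ]′
  (root-consecutive i<16 (ℕ.<-≤-trans r<root (proj₂ (root-bounds i<16)))
    (residue-from-square k r m (trans (cong (λ x → x ℕ.* x) j≡) j²)))
  where
  J<j : J k i < j
  J<j = square-cancel-< (subst₂ _<_ (sym (J-square k (ℕ.m<n⇒m<1+n i<16))) (sym j²) (square-mono-< lo))
  j<J : j < J k (suc i)
  j<J = square-cancel-< (subst₂ _<_ (sym j²) (sym (J-square k (s≤s i<16))) (square-mono-< hi))
  r = j ∸ k ℕ.* 420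
  j≡ : k ℕ.* 420 ℕ.+ r ≡ j
  j≡ = ℕ.m+[n∸m]≡n (ℕ.≤-trans (ℕ.m≤m+n (k ℕ.* 420) (root i)) (ℕ.<⇒≤ J<j))
  root<r : root i < r
  root<r = ℕ.+-cancelˡ-< (k ℕ.* 420) (root i) r (subst (J k i <_) (sym j≡) J<j)
  r<root : r < root (suc i)
  r<root = ℕ.+-cancelˡ-< (k ℕ.* 420) r (root (suc i)) (subst (_< J k (suc i)) (sym j≡) j<J)

-- The position of an element in the sequence

countBelow-∈ : ∀ m → InS m → countBelow (suc m) ≡ suc (countBelow m)
countBelow-∈ m m∈S with inS? m
... | yes _  = refl
... | no m∉S = contradiction m∈S m∉S

countBelow-∉ : ∀ m → ¬ InS m → countBelow (suc m) ≡ countBelow m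
countBelow-∉ m m∉S with inS? m
... | yes m∈S = contradiction m∈S m∉S
... | no _    = refl

countBelow-gap : ∀ lo k → (∀ {m} → lo ≤ m → m < k ℕ.+ lo → ¬ InS m) →
  countBelow (k ℕ.+ lo) ≡ countBelow lo
countBelow-gap lo zero    gap = refl
countBelow-gap lo (suc k) gap = trans (countBelow-∉ (k ℕ.+ lo) (gap (ℕ.m≤n+m lo k) ℕ.≤-refl))
  (countBelow-gap lo k λ lo≤m m<k+lo → gap lo≤m (ℕ.m<n⇒m<1+n m<k+lo))

countBelow-step : ∀ k {i} → i < 16 → countBelow (A k (suc i)) ≡ suc (countBelow (A k i))
countBelow-step k {i} i<16 = begin
  countBelow (A k (suc i))
    ≡⟨ cong countBelow (sym (ℕ.m∸n+n≡m A<A′)) ⟩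
  countBelow (A k (suc i) ∸ suc (A k i) ℕ.+ suc (A k i))
    ≡⟨ countBelow-gap (suc (A k i)) (A k (suc i) ∸ suc (A k i)) (λ {m} lo hi →
         A-<-gap k i<16 lo (subst (m <_) (ℕ.m∸n+n≡m A<A′) hi)) ⟩
  countBelow (suc (A k i))
    ≡⟨ countBelow-∈ (A k i) (J k i , J-square k (ℕ.m<n⇒m<1+n i<16)) ⟩
  suc (countBelow (A k i)) ∎
  where
  open ≡-Reasoning
  A<A′ : A k i < A k (suc i)
  A<A′ = ℕ.*-cancelˡ-< 840 (A k i) (A k (suc i)) (ℕ.+-cancelʳ-< 529 (840 ℕ.* A k i) (840 ℕ.* A k (suc i))
    (subst₂ _<_ (J-square k (ℕ.m<n⇒m<1+n i<16)) (J-square k (s≤s i<16)) (ℕ.*-mono-< J<J′ J<J′)))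
    where
    J<J′ : J k i < J k (suc i)
    J<J′ = ℕ.+-monoʳ-< (k ℕ.* 420) (proj₁ (root-bounds i<16))

J-wrap : ∀ k → J (suc k) 0 ≡ J k 16
J-wrap k = trans (cong (ℕ._+ 23) (ℕ.+-comm 420 (k ℕ.* 420))) (ℕ.+-assoc (k ℕ.* 420) 420 23)

A-wrap : ∀ k → A (suc k) 0 ≡ A k 16
A-wrap k = square-index-injective (A (suc k) 0) (A k 16) (trans (sym (J-square (suc k) {0} (s≤s z≤n)))
  (trans (cong (λ x → x ℕ.* x) (J-wrap k)) (J-square k {16} ℕ.≤-refl)))

-- Stated for a variable m because countBelow (A (suc k) 0) unfolds to an unwieldy term.
countBelow-A : ∀ k i → i ≤ 16 → ∀ m → m ≡ A k i → countBelow m ≡ i ℕ.+ k ℕ.* 16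
countBelow-A zero    zero    _    m m≡ = cong countBelow m≡
countBelow-A (suc k) zero    _    m m≡ = countBelow-A k 16 ℕ.≤-refl m (trans m≡ (A-wrap k))
countBelow-A k       (suc i) i<16 m m≡ = trans (cong countBelow m≡) (trans (countBelow-step k {i} i<16)
  (cong suc (countBelow-A k i (ℕ.<⇒≤ i<16) (A k i) refl)))

locate : ∀ m j → j ℕ.* j ≡ 840 ℕ.* m ℕ.+ 529 → ∃[ k ] ∃[ i ] (i < 16 × j ≡ J k i × m ≡ A k i)
locate m j j² = build (root-complete (m%n<n j 420)
    (residue-from-square k (j ℕ.% 420) m (trans (cong (λ x → x ℕ.* x) (sym j≡)) j²)))
  where
  k : ℕ
  k = j ℕ./ 420
  j≡ : j ≡ k ℕ.* 420 ℕ.+ j ℕ.% 420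
  j≡ = trans (m≡m%n+[m/n]*n j 420) (ℕ.+-comm (j ℕ.% 420) (k ℕ.* 420))
  build : ∃[ i ] (i < 16 × j ℕ.% 420 ≡ root i) → ∃[ k ] ∃[ i ] (i < 16 × j ≡ J k i × m ≡ A k i)
  build (i , i<16 , r≡) = k , i , i<16 , j≡J , square-index-injective m (A k i)
    (trans (sym j²) (trans (cong (λ x → x ℕ.* x) j≡J) (J-square k (ℕ.m<n⇒m<1+n i<16))))
    where
    j≡J : j ≡ J k i
    j≡J = trans j≡ (cong (k ℕ.* 420 ℕ.+_) r≡)

-- The left-hand coefficients in terms of characters

positive : List ℕ
positive = 0 ∷ 2 ∷ 3 ∷ 6 ∷ 9 ∷ 12 ∷ 13 ∷ 15 ∷ []

t-cong : ∀ {m n} → m ℕ.% 16 ≡ n ℕ.% 16 → t m ≡ t n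
t-cong {m} {n} eq
  with (m ℕ.% 16) ∈? positive | (n ℕ.% 16) ∈? positive
... | yes _   | yes _   = refl
... | no _    | no _    = refl
... | yes m∈  | no n∉   = contradiction (subst (_∈ positive) eq m∈) n∉
... | no m∉   | yes n∈  = contradiction (subst (_∈ positive) (sym eq) n∈) m∉

lhsSeries-∈ : ∀ m → InS m → lhsSeries m ≡ (- + 1) ℤ.^ t (countBelow m)
lhsSeries-∈ m m∈S with inS? m
... | yes _  = refl
... | no m∉S = contradiction m∈S m∉S

lhsSeries-∉ : ∀ m → ¬ InS m → lhsSeries m ≡ + 0
lhsSeries-∉ m m∉S with inS? m
... | yes m∈S = contradiction m∈S m∉S
... | no _    = refl

-- For j = `J k i` the position in the sequence is 16 k + i. Both `t` and `h` forget k, the first by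
-- period 16, the second by period 420, which leaves the sixteen cases of `root-sign`.
lhsSeries-h : ∀ m j → j ℕ.* j ≡ 840 ℕ.* m ℕ.+ 529 → lhsSeries m ≡ h (+ j) + h (- + j)
lhsSeries-h m j j² = signs (locate m j j²)
  where
  open ≡-Reasoning
  signs : ∃[ k ] ∃[ i ] (i < 16 × j ≡ J k i × m ≡ A k i) → lhsSeries m ≡ h (+ j) + h (- + j)
  signs (k , i , i<16 , j≡J , m≡A) = begin
    lhsSeries m
      ≡⟨ lhsSeries-∈ m (j , j²) ⟩
    (- + 1) ℤ.^ t (countBelow m)
      ≡⟨ cong (λ n → (- + 1) ℤ.^ t n) (countBelow-A k i (ℕ.<⇒≤ i<16) m m≡A) ⟩
    (- + 1) ℤ.^ t (i ℕ.+ k ℕ.* 16)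
      ≡⟨ cong ((- + 1) ℤ.^_) (t-cong {i ℕ.+ k ℕ.* 16} {i} ([m+kn]%n≡m%n i k 16)) ⟩
    (- + 1) ℤ.^ t i
      ≡⟨ sym (root-sign i<16) ⟩
    h (+ root i) + h (- + root i)
      ≡⟨ sym (cong₂ _+_ (h-shift k (root i)) (h-shift-neg k (root i))) ⟩
    h (+ J k i) + h (- + J k i)
      ≡⟨ cong (λ x → h (+ x) + h (- + x)) (sym j≡J) ⟩
    h (+ j) + h (- + j) ∎

*-mono-≡0 : ∀ a e n → (a ≢ + 0 → n ≢ e) → a * mono e n ≡ + 0
*-mono-≡0 a e n n≢e with a ℤ.≟ + 0
... | yes refl = refl
... | no a≢0   = trans (cong (a *_) (mono-≢ (n≢e a≢0))) (ℤ.*-zeroʳ a)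

bsum-two-points : ∀ R (f g : ℤ → ℤ) a b → ℤ.∣ a ∣ ≤ R → ℤ.∣ b ∣ ≤ R → a ≢ b →
  g a ≡ f a → g b ≡ f b → (∀ z → z ≢ a → z ≢ b → g z ≡ + 0) → bsum R g ≡ f a + f b
bsum-two-points R f g a b a≤R b≤R a≢b ga gb g≡0 = begin
  bsum R g
    ≡⟨ bsum-cong R pointwise ⟩
  bsum R (λ z → δ a z * f z + δ b z * f z)
    ≡⟨ bsum-+ R (λ z → δ a z * f z) (λ z → δ b z * f z) ⟩
  bsum R (λ z → δ a z * f z) + bsum R (λ z → δ b z * f z)
    ≡⟨ cong₂ _+_ (bsum-δ R a f a≤R) (bsum-δ R b f b≤R) ⟩
  f a + f b ∎
  where
  open ≡-Reasoning
  pointwise : ∀ z → g z ≡ δ a z * f z + δ b z * f z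
  pointwise z with z ℤ.≟ a | z ℤ.≟ b
  ... | yes refl | yes refl = contradiction refl a≢b
  ... | yes refl | no _     = trans ga (sym (trans (ℤ.+-identityʳ _) (ℤ.*-identityˡ (f a))))
  ... | no _     | yes refl = trans gb (sym (trans (ℤ.+-identityˡ _) (ℤ.*-identityˡ (f b))))
  ... | no z≢a   | no z≢b   = g≡0 z z≢a z≢b

∣z∣≡n : ∀ z {n} → ℤ.∣ z ∣ ≡ n → z ≡ + n ⊎ z ≡ - + n
∣z∣≡n (+ n)    refl = inj₁ refl
∣z∣≡n -[1+ n ] refl = inj₂ refl

pos≢neg : ∀ {n} → n ≢ 0 → + n ≢ - + n
pos≢neg {zero}  n≢0 _ = n≢0 refl
pos≢neg {suc n} _ ()

n≤n*n : ∀ n → n ≤ n ℕ.* n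
n≤n*n zero      = z≤n
n≤n*n n@(suc _) = ℕ.m≤m*n n n

-- `eS` involves truncated subtraction and rounding, but where `h` is nonzero it determines z² by
-- `h-square`. Hence at most the two points ± j contribute to the coefficient of q^m, and the bound
-- puts both inside the box.
lhsSeries≡theta : ∀ R m → 840 ℕ.* m ℕ.+ 529 ≤ R → lhsSeries m ≡ theta R h eS m
lhsSeries≡theta R m bound = decide (inS? m)
  where
  decide : Dec (InS m) → lhsSeries m ≡ theta R h eS m
  decide (no m∉S) = trans (lhsSeries-∉ m m∉S) (sym (trans
    (bsum-cong R λ z → *-mono-≡0 (h z) (eS z) m λ h≢0 m≡eS → m∉S (ℤ.∣ z ∣ ,
      trans (h-square z h≢0) (cong (λ x → 840 ℕ.* x ℕ.+ 529) (sym m≡eS))))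
    (bsum-0 R)))
  decide (yes (j , j²)) = trans (lhsSeries-h m j j²) (sym
    (bsum-two-points R h (λ z → h z * mono (eS z) m) (+ j) (- + j) j≤R
      (subst (_≤ R) (sym (ℤ.∣-i∣≡∣i∣ (+ j))) j≤R) (pos≢neg j≢0)
      (at (+ j) refl) (at (- + j) (ℤ.∣-i∣≡∣i∣ (+ j)))
      (λ z z≢j z≢-j → *-mono-≡0 (h z) (eS z) m λ h≢0 m≡eS → [ z≢j , z≢-j ]′ (∣z∣≡n z (square-injective
        (trans (h-square z h≢0) (trans (cong (λ x → 840 ℕ.* x ℕ.+ 529) (sym m≡eS)) (sym j²))))))))
    where
    j≤R : j ≤ R
    j≤R = ℕ.≤-trans (n≤n*n j) (ℕ.≤-trans (ℕ.≤-reflexive j²) bound)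
    j≢0 : j ≢ 0
    j≢0 refl = ℕ.<⇒≢ (ℕ.≤-trans (s≤s z≤n) (ℕ.m≤n+m 529 (840 ℕ.* m))) j²
    at : ∀ z → ℤ.∣ z ∣ ≡ j → h z * mono (eS z) m ≡ h z
    at z ∣z∣≡j = trans (cong (h z *_) (trans (cong (λ e → mono e m)
      (eS-unique z m (trans (cong (λ x → x ℕ.* x) ∣z∣≡j) j²))) (mono-≡ m))) (ℤ.*-identityʳ (h z))

-- Exponents and the quadratic form

tri-ℤ : ∀ k → + 2 * + tri k ≡ + k * + k - + k
tri-ℤ zero    = refl
tri-ℤ (suc k) = begin
  + 2 * + (k ℕ.+ tri k)          ≡⟨ cong (+ 2 *_) (ℤ.pos-+ k (tri k)) ⟩
  + 2 * (+ k + + tri k)          ≡⟨ ℤ.*-distribˡ-+ (+ 2) (+ k) (+ tri k) ⟩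
  + 2 * + k + + 2 * + tri k      ≡⟨ cong (_+_ (+ 2 * + k)) (tri-ℤ k) ⟩
  + 2 * + k + (+ k * + k - + k)  ≡⟨ identity (+ k) ⟩
  (+ 1 + + k) * (+ 1 + + k) - (+ 1 + + k) ∎
  where
  open ≡-Reasoning
  identity : ∀ k → + 2 * k + (k * k - k) ≡ (+ 1 + k) * (+ 1 + k) - (+ 1 + k)
  identity = solve-∀

module _ (α β : ℕ) .{{_ : ℕ.NonZero α}} .{{_ : ℕ.NonZero β}} where
  open TripleProduct α β using (d; expo)

  private
    half : ∀ γ k → + 2 * + (d ℕ.* tri k ℕ.+ γ ℕ.* k) ≡
      + d * (+ k * + k - + k) + + 2 * + γ * + k
    half γ k = begin
      + 2 * + (d ℕ.* tri k ℕ.+ γ ℕ.* k)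
        ≡⟨ cong (+ 2 *_) (trans (ℤ.pos-+ (d ℕ.* tri k) (γ ℕ.* k)) (cong₂ _+_ (ℤ.pos-* d (tri k)) (ℤ.pos-* γ k))) ⟩
      + 2 * (+ d * + tri k + + γ * + k)
        ≡⟨ identity (+ d) (+ tri k) (+ γ) (+ k) ⟩
      + d * (+ 2 * + tri k) + + 2 * + γ * + k
        ≡⟨ cong (λ x → + d * x + + 2 * + γ * + k) (tri-ℤ k) ⟩
      + d * (+ k * + k - + k) + + 2 * + γ * + k ∎
      where
      open ≡-Reasoning
      identity : ∀ d t g k → + 2 * (d * t + g * k) ≡ d * (+ 2 * t) + + 2 * g * k
      identity = solve-∀

  -- Doubling clears the denominator and merges the two branches of `expo` into one polynomial,
  -- ready for completing the square.
  expo-ℤ : ∀ k → + 2 * + expo k ≡ (+ α + + β) * (k * k) + (+ α - + β) * k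
  expo-ℤ (+ k)    = trans (half α k) (trans
    (cong (λ x → x * (+ k * + k - + k) + + 2 * + α * + k) (ℤ.pos-+ α β))
    (identity (+ α) (+ β) (+ k)))
    where
    identity : ∀ a b k → (a + b) * (k * k - k) + + 2 * a * k ≡ (a + b) * (k * k) + (a - b) * k
    identity = solve-∀
  expo-ℤ -[1+ k ] = trans (half β (suc k)) (trans
    (cong (λ x → x * (+ suc k * + suc k - + suc k) + + 2 * + β * + suc k) (ℤ.pos-+ α β))
    (identity (+ α) (+ β) (+ suc k)))
    where
    identity : ∀ a b k → (a + b) * (k * k - k) + + 2 * b * k ≡ (a + b) * (- k * - k) + (a - b) * - k
    identity = solve-∀

-- These are c (3 c + 1) / 2, a (5 a + 3) / 2 and b (7 b + 5) / 2. Putting the larger base first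
-- gives the linear terms positive coefficients, hence the squares of 6 c + 1, 10 a + 3 and 14 b +
-- 5.
e₃ e₅ e₇ : ℤ → ℕ
e₃ = TripleProduct.expo 2 1
e₅ = TripleProduct.expo 4 1
e₇ = TripleProduct.expo 6 1

abstract
  -- The constant is what completing the squares costs, and it is the same on both sides: 564 = 529
  -- + 35 = 21 · 3² + 15 · 5².
  level : ℕ → ℤ
  level n = + 840 * + n + + 564

  level-def : ∀ n → level n ≡ + 840 * + n + + 564
  level-def n = refl

level-ℕ : ∀ n → level n ≡ + (840 ℕ.* n ℕ.+ 564)
level-ℕ n = trans (level-def n) (sym (trans (ℤ.pos-+ (840 ℕ.* n) 564) (cong (_+ + 564) (ℤ.pos-* 840 n))))

level-injective : ∀ {m n} → level m ≡ level n → m ≡ n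
level-injective {m} {n} eq = ℕ.*-cancelˡ-≡ m n 840 (ℕ.+-cancelʳ-≡ 564 (840 ℕ.* m) (840 ℕ.* n)
  (ℤ.+-injective (trans (sym (level-ℕ m)) (trans eq (level-ℕ n)))))

mono≡δ-level : ∀ m n → mono m n ≡ δ (level n) (level m)
mono≡δ-level m n with n ℕ.≟ m
... | yes refl = sym (δ-≡ (level m))
... | no n≢m   = sym (δ-≢ λ eq → n≢m (sym (level-injective eq)))

-- j² + 35 u² for j = 7 u + 6 y; it equals 3 (7 x² + 5 y²) for x = 2 u + y
Q : ℤ → ℤ → ℤ
Q u y = (+ 7 * u + + 6 * y) * (+ 7 * u + + 6 * y) + + 35 * (u * u)

-- 420 (5 a² + 3 a) = 21 ((10 a + 3)² - 9) and 420 (7 b² + 5 b) = 15 ((14 b + 5)² - 25).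
level-xy : ∀ a b → level (e₅ a ℕ.+ e₇ b) ≡
  + 21 * ((+ 10 * a + + 3) * (+ 10 * a + + 3)) + + 15 * ((+ 14 * b + + 5) * (+ 14 * b + + 5))
level-xy a b = begin
  level (e₅ a ℕ.+ e₇ b)
    ≡⟨ trans (level-def (e₅ a ℕ.+ e₇ b)) (cong (λ x → + 840 * x + + 564) (ℤ.pos-+ (e₅ a) (e₇ b))) ⟩
  + 840 * (+ e₅ a + + e₇ b) + + 564
    ≡⟨ halve (+ e₅ a) (+ e₇ b) ⟩
  + 420 * (+ 2 * + e₅ a) + + 420 * (+ 2 * + e₇ b) + + 564
    ≡⟨ cong₂ (λ x y → + 420 * x + + 420 * y + + 564) (expo-ℤ 4 1 a) (expo-ℤ 6 1 b) ⟩
  + 420 * (+ 5 * (a * a) + + 3 * a) + + 420 * (+ 7 * (b * b) + + 5 * b) + + 564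
    ≡⟨ identity a b ⟩
  + 21 * ((+ 10 * a + + 3) * (+ 10 * a + + 3)) + + 15 * ((+ 14 * b + + 5) * (+ 14 * b + + 5)) ∎
  where
  open ≡-Reasoning
  halve : ∀ x y → + 840 * (x + y) + + 564 ≡ + 420 * (+ 2 * x) + + 420 * (+ 2 * y) + + 564
  halve = solve-∀
  identity : ∀ a b → + 420 * (+ 5 * (a * a) + + 3 * a) + + 420 * (+ 7 * (b * b) + + 5 * b) + + 564
    ≡ + 21 * ((+ 10 * a + + 3) * (+ 10 * a + + 3)) + + 15 * ((+ 14 * b + + 5) * (+ 14 * b + + 5))
  identity = solve-∀

i*i≡∣i∣*∣i∣ : ∀ i → i * i ≡ + (ℤ.∣ i ∣ ℕ.* ℤ.∣ i ∣)
i*i≡∣i∣*∣i∣ (+ n)    = sym (ℤ.pos-* n n)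
i*i≡∣i∣*∣i∣ -[1+ n ] = refl

level-cj : ∀ c j → h j ≢ + 0 → level (e₃ c ℕ.+ eS j) ≡ j * j + + 35 * ((+ 6 * c + + 1) * (+ 6 * c + + 1))
level-cj c j h≢0 = begin
  level (e₃ c ℕ.+ eS j)
    ≡⟨ trans (level-def (e₃ c ℕ.+ eS j)) (cong (λ x → + 840 * x + + 564) (ℤ.pos-+ (e₃ c) (eS j))) ⟩
  + 840 * (+ e₃ c + + eS j) + + 564
    ≡⟨ halve (+ e₃ c) (+ eS j) ⟩
  (+ 840 * + eS j + + 529) + (+ 420 * (+ 2 * + e₃ c) + + 35)
    ≡⟨ cong₂ (λ x y → x + (+ 420 * y + + 35)) (sym j²) (expo-ℤ 2 1 c) ⟩
  j * j + (+ 420 * (+ 3 * (c * c) + + 1 * c) + + 35)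
    ≡⟨ cong (_+_ (j * j)) (identity c) ⟩
  j * j + + 35 * ((+ 6 * c + + 1) * (+ 6 * c + + 1)) ∎
  where
  open ≡-Reasoning
  j² : j * j ≡ + 840 * + eS j + + 529
  j² = trans (i*i≡∣i∣*∣i∣ j) (trans (cong +_ (h-square j h≢0))
    (trans (ℤ.pos-+ (840 ℕ.* eS j) 529) (cong (_+ + 529) (ℤ.pos-* 840 (eS j)))))
  halve : ∀ x y → + 840 * (x + y) + + 564 ≡ (+ 840 * y + + 529) + (+ 420 * (+ 2 * x) + + 35)
  halve = solve-∀
  identity : ∀ c → + 420 * (+ 3 * (c * c) + + 1 * c) + + 35 ≡ + 35 * ((+ 6 * c + + 1) * (+ 6 * c + + 1))
  identity = solve-∀

square-sum-bound : ∀ a b .{{_ : ℕ.NonZero a}} .{{_ : ℕ.NonZero b}} i j N →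
  + a * (i * i) + + b * (j * j) ≡ + N → ℤ.∣ i ∣ ≤ N × ℤ.∣ j ∣ ≤ N
square-sum-bound a b i j N eq =
    ℕ.≤-trans (n≤n*n ℤ.∣ i ∣) (ℕ.≤-trans (ℕ.m≤n*m (ℤ.∣ i ∣ ℕ.* ℤ.∣ i ∣) a)
      (ℕ.≤-trans (ℕ.m≤m+n _ (b ℕ.* (ℤ.∣ j ∣ ℕ.* ℤ.∣ j ∣))) (ℕ.≤-reflexive eqℕ)))
  , ℕ.≤-trans (n≤n*n ℤ.∣ j ∣) (ℕ.≤-trans (ℕ.m≤n*m (ℤ.∣ j ∣ ℕ.* ℤ.∣ j ∣) b)
      (ℕ.≤-trans (ℕ.m≤n+m _ (a ℕ.* (ℤ.∣ i ∣ ℕ.* ℤ.∣ i ∣))) (ℕ.≤-reflexive eqℕ)))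
  where
  cast : ∀ a i → + a * (i * i) ≡ + (a ℕ.* (ℤ.∣ i ∣ ℕ.* ℤ.∣ i ∣))
  cast a i = trans (cong (+ a *_) (i*i≡∣i∣*∣i∣ i)) (sym (ℤ.pos-* a (ℤ.∣ i ∣ ℕ.* ℤ.∣ i ∣)))
  eqℕ : a ℕ.* (ℤ.∣ i ∣ ℕ.* ℤ.∣ i ∣) ℕ.+ b ℕ.* (ℤ.∣ j ∣ ℕ.* ℤ.∣ j ∣) ≡ N
  eqℕ = ℤ.+-injective (trans (ℤ.pos-+ (a ℕ.* (ℤ.∣ i ∣ ℕ.* ℤ.∣ i ∣)) (b ℕ.* (ℤ.∣ j ∣ ℕ.* ℤ.∣ j ∣)))
    (trans (sym (cong₂ _+_ (cast a i) (cast b j))) eq))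

-- Each diagonal shape bounds one coordinate: j² + 35 u² bounds u, and 21 x² + 15 y² bounds y.
Q-box : ∀ {R} n u y → 840 ℕ.* n ℕ.+ 564 ≤ R → Q u y ≡ level n → InBox R (u , y)
Q-box n u y bound eq =
    ℕ.≤-trans (proj₂ (square-sum-bound 1 35 (+ 7 * u + + 6 * y) u _ (trans (sym (form₁ u y)) eqℤ))) bound
  , ℕ.≤-trans (proj₂ (square-sum-bound 21 15 (+ 2 * u + y) y _ (trans (sym (form₂ u y)) eqℤ))) bound
  where
  eqℤ : Q u y ≡ + (840 ℕ.* n ℕ.+ 564)
  eqℤ = trans eq (level-ℕ n)
  form₁ : ∀ u y → (+ 7 * u + + 6 * y) * (+ 7 * u + + 6 * y) + + 35 * (u * u) ≡
    + 1 * ((+ 7 * u + + 6 * y) * (+ 7 * u + + 6 * y)) + + 35 * (u * u)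
  form₁ = solve-∀
  form₂ : ∀ u y → (+ 7 * u + + 6 * y) * (+ 7 * u + + 6 * y) + + 35 * (u * u) ≡
    + 21 * ((+ 2 * u + y) * (+ 2 * u + y)) + + 15 * (y * y)
  form₂ = solve-∀

-- The two-variable identity

odd-from-sgn : ∀ z → sgn z ≡ - + 1 → odd z ≡ + 1
odd-from-sgn z sgn≡-1 = ℤ.*-cancelˡ-≡ (+ 2) (odd z) (+ 1)
  (trans (double z) (cong (λ x → + 1 - x) sgn≡-1))
  where
  double : ∀ z → + 2 * odd z ≡ + 1 - sgn z
  double = periodic-ext (λ z k → cong (+ 2 *_) (odd-periodic z k))
    (λ z k → cong (λ x → + 1 - x) (sgn-periodic z k))
    (from-yes (ℕ.allUpTo? (λ r → + 2 * odd (+ r) ℤ.≟ + 1 - sgn (+ r)) 2))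

sgn-odd : ∀ k → sgn (+ 1 + k * + 2) ≡ - + 1
sgn-odd k = sgn-periodic (+ 1) k

-- A polynomial identity can carry a hypothesis p = q as an explicit multiple c (p - q); this lemma
-- then drops that multiple.
+-*-vanish : ∀ u c {p q} → p ≡ q → u + c * (p - q) ≡ u
+-*-vanish u c {p} refl = trans (cong (λ x → u + c * x) (ℤ.+-inverseʳ p))
  (trans (cong (_+_ u) (ℤ.*-zeroʳ c)) (ℤ.+-identityʳ u))

+-cancelʳ : ∀ c {a b} → a + c ≡ b + c → a ≡ b
+-cancelʳ c {a} {b} = RingProperties.+-cancelʳ ℤ.+-*-ring c a b

-- A point (u , y) contributes to the coefficient of q^n when Q u y = 840 n + 564.
module TwoVariable (n R : ℕ) (bound : 840 ℕ.* n ℕ.+ 564 ≤ R) where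

  -- The factor common to all the sums in (u , y). The conditions modulo 2 and 6 and the sign
  -- (-1)^y, in which the sums differ, are left to the two functions in `weight`.
  g : ℤ → ℤ → ℤ
  g u y = ε₅ (+ 2 * u + y) * σ₇ y * δ (level n) (Q u y)

  δ-≢0 : ∀ {a k} → δ a k ≢ + 0 → k ≡ a
  δ-≢0 {a} {k} ≢0 with k ℤ.≟ a
  ... | yes k≡a = k≡a
  ... | no _    = contradiction refl ≢0

  g-box : ∀ u y → g u y ≢ + 0 → InBox R (u , y)
  g-box u y g≢0 = Q-box n u y bound (δ-≢0 (proj₂ (*-≢0 (ε₅ (+ 2 * u + y) * σ₇ y) (δ (level n) (Q u y)) g≢0)))

  weight : (ℤ → ℤ) → (ℤ → ℤ) → Weight
  weight f₁ f₂ (u , y) = f₁ u * f₂ y * g u y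

  weight-≢0 : ∀ f₁ f₂ u y → weight f₁ f₂ (u , y) ≢ + 0 → f₁ u ≢ + 0 × f₂ y ≢ + 0 × g u y ≢ + 0
  weight-≢0 f₁ f₂ u y w≢0 = proj₁ f≢0 , proj₂ f≢0 , proj₂ split
    where
    split = *-≢0 (f₁ u * f₂ y) (g u y) w≢0
    f≢0 = *-≢0 (f₁ u) (f₂ y) (proj₁ split)

  weight-box : ∀ f₁ f₂ p → weight f₁ f₂ p ≢ + 0 → InBox R p
  weight-box f₁ f₂ (u , y) w≢0 = g-box u y (proj₂ (proj₂ (weight-≢0 f₁ f₂ u y w≢0)))

  reflect : Plane → Plane
  reflect (u , y) = u + y , - y

  reflect-involutive : ∀ p → reflect (reflect p) ≡ p
  reflect-involutive (u , y) = cong₂ _,_ (identity u y) (ℤ.neg-involutive y)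
    where
    identity : ∀ u y → u + y + - y ≡ u
    identity = solve-∀

  -- The map fixes x = 2 u + y and negates y. It preserves `ε₅` and 21 x² + 15 y², and the sign
  -- comes from `σ₇` being odd.
  g-reflect : ∀ u y → g (u + y) (- y) ≡ - g u y
  g-reflect u y = begin
    ε₅ (+ 2 * (u + y) + - y) * σ₇ (- y) * δ (level n) (Q (u + y) (- y))
      ≡⟨ cong₂ _*_ (cong₂ _*_ (cong ε₅ (x-eq u y)) (σ₇-neg y)) (cong (δ (level n)) (Q-eq u y)) ⟩
    ε₅ (+ 2 * u + y) * - σ₇ y * δ (level n) (Q u y)
      ≡⟨ pull (ε₅ (+ 2 * u + y)) (σ₇ y) (δ (level n) (Q u y)) ⟩
    - g u y ∎
    where
    open ≡-Reasoning
    x-eq : ∀ u y → + 2 * (u + y) + - y ≡ + 2 * u + y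
    x-eq = solve-∀
    Q-eq : ∀ u y → (+ 7 * (u + y) + + 6 * - y) * (+ 7 * (u + y) + + 6 * - y) + + 35 * ((u + y) * (u + y))
      ≡ (+ 7 * u + + 6 * y) * (+ 7 * u + + 6 * y) + + 35 * (u * u)
    Q-eq = solve-∀
    pull : ∀ a b c → a * - b * c ≡ - (a * b * c)
    pull = solve-∀

  odd-even-sum : bsum₂ R (weight odd even) ≡ + 0
  odd-even-sum = bsum₂-antisymmetric record
    { Rel = λ p r → r ≡ reflect p
    ; to = λ p w≢0 → reflect p , flip p w≢0 , refl
    ; from = λ r w≢0 → reflect r
        , trans (sym (ℤ.neg-involutive (weight odd even (reflect r)))) (cong -_ (flip r (-≢0 w≢0)))
        , sym (reflect-involutive r)
    ; functional = λ r≡ r′≡ → trans r≡ (sym r′≡)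
    ; injective = λ {p} {p′} r≡ r≡′ → trans (sym (reflect-involutive p))
        (trans (cong reflect (trans (sym r≡) r≡′)) (reflect-involutive p′))
    ; boxˡ = weight-box odd even
    ; boxʳ = λ r w≢0 → weight-box odd even r (-≢0 w≢0)
    }
    where
    flip : ∀ p → weight odd even p ≢ + 0 → - weight odd even (reflect p) ≡ weight odd even p
    flip (u , y) w≢0 = begin
      - (odd (u + y) * even (- y) * g (u + y) (- y))
        ≡⟨ cong -_ (cong₂ _*_ (cong₂ _*_ odd-eq (even-neg y)) (g-reflect u y)) ⟩
      - (odd u * even y * - g u y)
        ≡⟨ pull (odd u) (even y) (g u y) ⟩
      odd u * even y * g u y ∎
      where
      open ≡-Reasoning
      half = residue-support 2 0 y (proj₁ (proj₂ (weight-≢0 odd even u y w≢0)))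
      odd-eq : odd (u + y) ≡ odd u
      odd-eq = trans (cong (λ x → odd (u + x)) (trans (proj₂ half) (ℤ.+-identityˡ _))) (odd-periodic u (proj₁ half))
      pull : ∀ a b c → - (a * b * - c) ≡ a * b * c
      pull = solve-∀

  -- With u = 3 v the map negates u and fixes j = 7 u + 6 y, hence preserves j² + 35 u². It changes
  -- x by - 5 v and y by 7 v, which `ε₅` and `σ₇` do not see.
  g-swap : ∀ v y → g (- (+ 3 * v)) (y + v * + 7) ≡ g (+ 3 * v) y
  g-swap v y = cong₂ _*_ (cong₂ _*_ ε-eq (σ₇-periodic y v)) (cong (δ (level n)) (Q-eq v y))
    where
    ε-eq : ε₅ (+ 2 * - (+ 3 * v) + (y + v * + 7)) ≡ ε₅ (+ 2 * (+ 3 * v) + y)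
    ε-eq = trans (sym (ε₅-periodic (+ 2 * - (+ 3 * v) + (y + v * + 7)) v)) (cong ε₅ (identity v y))
      where
      identity : ∀ v y → + 2 * - (+ 3 * v) + (y + v * + 7) + v * + 5 ≡ + 2 * (+ 3 * v) + y
      identity = solve-∀
    Q-eq : ∀ v y → (+ 7 * - (+ 3 * v) + + 6 * (y + v * + 7)) * (+ 7 * - (+ 3 * v) + + 6 * (y + v * + 7))
        + + 35 * (- (+ 3 * v) * - (+ 3 * v))
      ≡ (+ 7 * (+ 3 * v) + + 6 * y) * (+ 7 * (+ 3 * v) + + 6 * y) + + 35 * (+ 3 * v * (+ 3 * v))
    Q-eq = solve-∀

  -- Parametrised by v = u / 3, so that the shift 7 u / 3 of y is visibly integral.
  data Swap : Plane → Plane → Set where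
    swap : ∀ v y → Swap (+ 3 * v , y) (- (+ 3 * v) , y + v * + 7)

  swap-sym : ∀ {p r} → Swap p r → Swap r p
  swap-sym (swap v y) = subst₂ Swap (cong (_, y + v * + 7) (u-eq v)) (cong₂ _,_ (u-eq′ v) (y-eq v y))
    (swap (- v) (y + v * + 7))
    where
    u-eq : ∀ v → + 3 * - v ≡ - (+ 3 * v)
    u-eq = solve-∀
    u-eq′ : ∀ v → - (+ 3 * - v) ≡ + 3 * v
    u-eq′ = solve-∀
    y-eq : ∀ v y → y + v * + 7 + - v * + 7 ≡ y
    y-eq = solve-∀

  swap-functional : ∀ {p p′ r r′} → p ≡ p′ → Swap p r → Swap p′ r′ → r ≡ r′
  swap-functional p≡p′ (swap v y) (swap v′ y′)
    with ℤ.*-cancelˡ-≡ (+ 3) v v′ (cong proj₁ p≡p′) | cong proj₂ p≡p′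
  ... | refl | refl = refl

  exchange : ∀ f f′ → Periodic 2 f′ → (∀ z → f′ (+ 1 + z) ≡ f z) → ∀ p → weight three₆ f p ≢ + 0 →
    ∃[ r ] (weight three₆ f′ r ≡ weight three₆ f p × Swap p r)
  exchange f f′ f′-per shift (u , y) w≢0 = (- (+ 3 * v) , y + v * + 7)
    , trans (cong₂ _*_ (cong₂ _*_ (three₆-neg (+ 3 * v)) parity) (g-swap v y))
        (cong (λ x → weight three₆ f (x , y)) (sym u≡3v))
    , subst (λ x → Swap (x , y) (- (+ 3 * v) , y + v * + 7)) (sym u≡3v) (swap v y)
    where
    sixth = residue-support 6 3 u (proj₁ (weight-≢0 three₆ f u y w≢0))
    k = proj₁ sixth
    -- From u = 3 + 6 k, the quotient u / 3 is odd, so adding 7 v changes the parity of y.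
    v = + 1 + k * + 2
    triple : ∀ k → + 3 + k * + 6 ≡ + 3 * (+ 1 + k * + 2)
    triple = solve-∀
    u≡3v : u ≡ + 3 * v
    u≡3v = trans (proj₂ sixth) (triple k)
    regroup : ∀ y k → y + (+ 1 + k * + 2) * + 7 ≡ + 1 + y + (+ 3 + + 7 * k) * + 2
    regroup = solve-∀
    parity : f′ (y + v * + 7) ≡ f y
    parity = trans (cong f′ (regroup y k)) (trans (f′-per (+ 1 + y) (+ 3 + + 7 * k)) (shift y))

  three-sum : bsum₂ R (weight three₆ odd) ≡ bsum₂ R (weight three₆ even)
  three-sum = bsum₂-matching record
    { Rel = Swap
    ; to = exchange odd even even-periodic even-suc
    ; from = λ r w≢0 → let p , eq , s = exchange even odd odd-periodic odd-suc r w≢0 in p , eq , swap-sym s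
    ; functional = λ s s′ → swap-functional refl s s′
    ; injective = λ s s′ → swap-functional refl (swap-sym s) (swap-sym s′)
    ; boxˡ = weight-box three₆ odd
    ; boxʳ = weight-box three₆ even
    }

  -- Put odd = unit₆ + three₆ in u and - sgn = odd - even in y. The difference of the two weights is
  -- three₆ · odd + odd · even - three₆ · even: the middle sum is zero and the outer two cancel.
  odd-odd-sum : bsum₂ R (weight odd odd) ≡ bsum₂ R (weight unit₆ (λ y → - sgn y))
  odd-odd-sum = begin
    bsum₂ R (weight odd odd)
      ≡⟨ bsum₂-cong R pointwise ⟩
    bsum₂ R (λ p → weight unit₆ (λ y → - sgn y) p
      + (weight three₆ odd p + (weight odd even p + - weight three₆ even p)))
      ≡⟨ bsum₂-+ R (weight unit₆ (λ y → - sgn y))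
           (λ p → weight three₆ odd p + (weight odd even p + - weight three₆ even p)) ⟩
    Σ + bsum₂ R (λ p → weight three₆ odd p + (weight odd even p + - weight three₆ even p))
      ≡⟨ cong (_+_ Σ) (bsum₂-+ R (weight three₆ odd) (λ p → weight odd even p + - weight three₆ even p)) ⟩
    Σ + (bsum₂ R (weight three₆ odd) + bsum₂ R (λ p → weight odd even p + - weight three₆ even p))
      ≡⟨ cong₂ (λ a b → Σ + (a + b)) three-sum (trans (bsum₂-+ R (weight odd even) (λ p → - weight three₆ even p))
           (cong₂ _+_ odd-even-sum (bsum₂-neg R (weight three₆ even)))) ⟩
    Σ + (bsum₂ R (weight three₆ even) + (+ 0 + - bsum₂ R (weight three₆ even)))
      ≡⟨ cancel Σ (bsum₂ R (weight three₆ even)) ⟩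
    Σ ∎
    where
    open ≡-Reasoning
    Σ = bsum₂ R (weight unit₆ (λ y → - sgn y))
    cancel : ∀ a b → a + (b + (+ 0 + - b)) ≡ a
    cancel = solve-∀
    split : ∀ a b c d e → (a + b) * c * e ≡ a * (c - d) * e + (b * c * e + ((a + b) * d * e + - (b * d * e)))
    split = solve-∀
    pointwise : ∀ p → weight odd odd p ≡
      weight unit₆ (λ y → - sgn y) p + (weight three₆ odd p + (weight odd even p + - weight three₆ even p))
    pointwise (u , y) = begin
      odd u * odd y * g u y
        ≡⟨ cong (λ o → o * odd y * g u y) (unit₆+three₆ u) ⟩
      (unit₆ u + three₆ u) * odd y * g u y
        ≡⟨ split (unit₆ u) (three₆ u) (odd y) (even y) (g u y) ⟩
      unit₆ u * (odd y - even y) * g u y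
        + (three₆ u * odd y * g u y + ((unit₆ u + three₆ u) * even y * g u y + - (three₆ u * even y * g u y)))
        ≡⟨ cong₂ (λ s o → unit₆ u * s * g u y
             + (three₆ u * odd y * g u y + (o * even y * g u y + - (three₆ u * even y * g u y))))
             (sym (odd-even y)) (sym (unit₆+three₆ u)) ⟩
      unit₆ u * - sgn y * g u y
        + (three₆ u * odd y * g u y + (odd u * even y * g u y + - (three₆ u * even y * g u y))) ∎

-- The product of the two theta series on the right

module ThetaProducts (n R : ℕ) (bound : 840 ℕ.* n ℕ.+ 564 ≤ R) where
  open TwoVariable n R bound

  n≤R : n ≤ R
  n≤R = ℕ.≤-trans (ℕ.≤-trans (ℕ.m≤n*m n 840) (ℕ.m≤m+n (840 ℕ.* n) 564)) bound

  θ₅θ₇ : Weight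
  θ₅θ₇ (a , b) = sgn a * sgn b * mono (e₅ a ℕ.+ e₇ b) n

  weight-value : ∀ f₁ f₂ u y m {s₁ s₂ s₃ s₄} → f₁ u ≡ s₁ → f₂ y ≡ s₂ → ε₅ (+ 2 * u + y) ≡ s₃ → σ₇ y ≡ s₄ →
    Q u y ≡ level m → weight f₁ f₂ (u , y) ≡ s₁ * s₂ * (s₃ * s₄ * mono m n)
  weight-value f₁ f₂ u y m f₁≡ f₂≡ ε≡ σ≡ Q≡ = cong₂ _*_ (cong₂ _*_ f₁≡ f₂≡)
    (cong₂ _*_ (cong₂ _*_ ε≡ σ≡) (trans (cong (δ (level n)) Q≡) (sym (mono≡δ-level m n))))

  -- Solving x = 10 a + 3 and y = ± (14 b + 5) for u = (x - y) / 2 gives the two formulas. Modulo 2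
  -- the first u is a + b + 1 and the second is a + b, so the sign (-1)^(a + b) selects the branch
  -- in which u is odd; it also equals `σ₇ y`.
  data XY : Plane → Plane → Set where
    plus  : ∀ {a b u y} → sgn a * sgn b ≡ + 1 →
      u ≡ + 5 * a - + 7 * b - + 1 → y ≡ + 14 * b + + 5 → XY (a , b) (u , y)
    minus : ∀ {a b u y} → sgn a * sgn b ≡ - + 1 →
      u ≡ + 5 * a + + 7 * b + + 4 → y ≡ - (+ 14 * b + + 5) → XY (a , b) (u , y)

  sgn-u-plus : ∀ a b → sgn (+ 5 * a - + 7 * b - + 1) ≡ - (sgn a * sgn b)
  sgn-u-plus a b = trans (cong sgn (identity a b)) (trans (sgn-periodic (+ 1 + (a + b)) (+ 2 * a - + 4 * b - + 1))
    (trans (sgn-suc (a + b)) (cong -_ (sgn-+ a b))))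
    where
    identity : ∀ a b → + 5 * a - + 7 * b - + 1 ≡ + 1 + (a + b) + (+ 2 * a - + 4 * b - + 1) * + 2
    identity = solve-∀

  sgn-u-minus : ∀ a b → sgn (+ 5 * a + + 7 * b + + 4) ≡ sgn a * sgn b
  sgn-u-minus a b = trans (cong sgn (identity a b)) (trans (sgn-periodic (a + b) (+ 2 * a + + 3 * b + + 2))
    (sgn-+ a b))
    where
    identity : ∀ a b → + 5 * a + + 7 * b + + 4 ≡ a + b + (+ 2 * a + + 3 * b + + 2) * + 2
    identity = solve-∀

  σ₇-plus : ∀ b → σ₇ (+ 14 * b + + 5) ≡ + 1
  σ₇-plus b = trans (cong σ₇ (identity b)) (σ₇-periodic (+ 5) (+ 2 * b))
    where
    identity : ∀ b → + 14 * b + + 5 ≡ + 5 + + 2 * b * + 7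
    identity = solve-∀

  XY-weight : ∀ {p r} → XY p r → weight odd odd r ≡ θ₅θ₇ p
  XY-weight (plus {a} {b} s refl refl) = trans
    (weight-value odd odd (+ 5 * a - + 7 * b - + 1) (+ 14 * b + + 5) (e₅ a ℕ.+ e₇ b)
      (odd-from-sgn (+ 5 * a - + 7 * b - + 1) (trans (sgn-u-plus a b) (cong -_ s)))
      (trans (cong odd (y-odd b)) (odd-periodic (+ 1) (+ 7 * b + + 2)))
      (trans (cong ε₅ (x-eq a b)) (ε₅-periodic (+ 3) (+ 2 * a)))
      (σ₇-plus b)
      (trans (Q-eq a b) (sym (level-xy a b))))
    (trans (ℤ.*-identityˡ (+ 1 * mono (e₅ a ℕ.+ e₇ b) n)) (cong (_* mono (e₅ a ℕ.+ e₇ b) n) (sym s)))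
    where
    y-odd : ∀ b → + 14 * b + + 5 ≡ + 1 + (+ 7 * b + + 2) * + 2
    y-odd = solve-∀
    x-eq : ∀ a b → + 2 * (+ 5 * a - + 7 * b - + 1) + (+ 14 * b + + 5) ≡ + 3 + + 2 * a * + 5
    x-eq = solve-∀
    Q-eq : ∀ a b → (+ 7 * (+ 5 * a - + 7 * b - + 1) + + 6 * (+ 14 * b + + 5))
        * (+ 7 * (+ 5 * a - + 7 * b - + 1) + + 6 * (+ 14 * b + + 5))
        + + 35 * ((+ 5 * a - + 7 * b - + 1) * (+ 5 * a - + 7 * b - + 1))
      ≡ + 21 * ((+ 10 * a + + 3) * (+ 10 * a + + 3)) + + 15 * ((+ 14 * b + + 5) * (+ 14 * b + + 5))
    Q-eq = solve-∀
  XY-weight (minus {a} {b} s refl refl) = trans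
    (weight-value odd odd (+ 5 * a + + 7 * b + + 4) (- (+ 14 * b + + 5)) (e₅ a ℕ.+ e₇ b)
      (odd-from-sgn (+ 5 * a + + 7 * b + + 4) (trans (sgn-u-minus a b) s))
      (trans (cong odd (y-odd b)) (odd-periodic (+ 1) (- (+ 7 * b) - + 3)))
      (trans (cong ε₅ (x-eq a b)) (ε₅-periodic (+ 3) (+ 2 * a)))
      (trans (σ₇-neg (+ 14 * b + + 5)) (cong -_ (σ₇-plus b)))
      (trans (Q-eq a b) (sym (level-xy a b))))
    (trans (ℤ.*-identityˡ (- + 1 * mono (e₅ a ℕ.+ e₇ b) n)) (cong (_* mono (e₅ a ℕ.+ e₇ b) n) (sym s)))
    where
    y-odd : ∀ b → - (+ 14 * b + + 5) ≡ + 1 + (- (+ 7 * b) - + 3) * + 2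
    y-odd = solve-∀
    x-eq : ∀ a b → + 2 * (+ 5 * a + + 7 * b + + 4) + - (+ 14 * b + + 5) ≡ + 3 + + 2 * a * + 5
    x-eq = solve-∀
    Q-eq : ∀ a b → (+ 7 * (+ 5 * a + + 7 * b + + 4) + + 6 * - (+ 14 * b + + 5))
        * (+ 7 * (+ 5 * a + + 7 * b + + 4) + + 6 * - (+ 14 * b + + 5))
        + + 35 * ((+ 5 * a + + 7 * b + + 4) * (+ 5 * a + + 7 * b + + 4))
      ≡ + 21 * ((+ 10 * a + + 3) * (+ 10 * a + + 3)) + + 15 * ((+ 14 * b + + 5) * (+ 14 * b + + 5))
    Q-eq = solve-∀

  sgn-cases : ∀ z → sgn z ≡ + 1 ⊎ sgn z ≡ - + 1
  sgn-cases z = cases ℤ.∣ z ∣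
    where
    cases : ∀ m → sgnℕ m ≡ + 1 ⊎ sgnℕ m ≡ - + 1
    cases zero = inj₁ refl
    cases (suc m) with cases m
    ... | inj₁ eq = inj₂ (cong -_ eq)
    ... | inj₂ eq = inj₁ (cong -_ eq)

  XY-total : ∀ p → ∃[ r ] XY p r
  XY-total (a , b) with sgn-cases (a + b)
  ... | inj₁ s = (+ 5 * a - + 7 * b - + 1 , + 14 * b + + 5) , plus (trans (sym (sgn-+ a b)) s) refl refl
  ... | inj₂ s = (+ 5 * a + + 7 * b + + 4 , - (+ 14 * b + + 5)) , minus (trans (sym (sgn-+ a b)) s) refl refl

  XY-surjective : ∀ r → weight odd odd r ≢ + 0 → ∃[ p ] XY p r
  XY-surjective (u , y) w≢0 = find (+-≢0 (residue 7 5 y) (- residue 7 2 y)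
      (proj₂ (*-≢0 (ε₅ (+ 2 * u + y)) (σ₇ y) (proj₁ (*-≢0 (ε₅ (+ 2 * u + y) * σ₇ y) (δ (level n) (Q u y))
        (proj₂ (proj₂ ≢0)))))))
    where
    ≢0 = weight-≢0 odd odd u y w≢0
    u-half = residue-support 2 1 u (proj₁ ≢0)
    y-half = residue-support 2 1 y (proj₁ (proj₂ ≢0))
    x-fifth = residue-support 5 3 (+ 2 * u + y) (proj₁ (*-≢0 (ε₅ (+ 2 * u + y)) (σ₇ y)
      (proj₁ (*-≢0 (ε₅ (+ 2 * u + y) * σ₇ y) (δ (level n) (Q u y)) (proj₂ (proj₂ ≢0))))))
    s = proj₁ y-half
    k = proj₁ x-fifth
    sgn-u : sgn u ≡ - + 1
    sgn-u = trans (cong sgn (proj₂ u-half)) (sgn-odd (proj₁ u-half))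
    find : residue 7 5 y ≢ + 0 ⊎ - residue 7 2 y ≢ + 0 → ∃[ p ] XY p (u , y)
    find (inj₁ res≢0) = (a , b) , plus sgn≡1 u≡ y≡
      where
      seventh = residue-support 7 5 y res≢0
      w = proj₁ seventh
      -- Chinese remaindering: 14 b + 5 = 7 (1 + 2 s) - 6 (5 + 7 w), and both brackets equal y.
      b = s - + 2 - + 3 * w
      -- With T = u + 7 b + 1, the condition x = 3 + 5 k says 2 T = 5 k, so T - 2 k is the integer T
      -- / 5.
      a = u + + 7 * b + + 1 - + 2 * k
      y-id : ∀ s t → + 14 * (s - + 2 - + 3 * t) + + 5 ≡ + 5 + t * + 7 + + 7 * (+ 1 + s * + 2 - (+ 5 + t * + 7))
      y-id = solve-∀
      y≡ : y ≡ + 14 * b + + 5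
      y≡ = sym (trans (y-id s w) (trans (+-*-vanish (+ 5 + w * + 7) (+ 7)
        (trans (sym (proj₂ y-half)) (proj₂ seventh))) (sym (proj₂ seventh))))
      u-id : ∀ u b k → + 5 * (u + + 7 * b + + 1 - + 2 * k) - + 7 * b - + 1 ≡
        u + + 2 * (+ 2 * u + (+ 14 * b + + 5) - (+ 3 + k * + 5))
      u-id = solve-∀
      u≡ : u ≡ + 5 * a - + 7 * b - + 1
      u≡ = sym (trans (u-id u b k) (+-*-vanish u (+ 2) (trans (cong (_+_ (+ 2 * u)) (sym y≡)) (proj₂ x-fifth))))
      sgn≡1 : sgn a * sgn b ≡ + 1
      sgn≡1 = ℤ.neg-injective (trans (sym (sgn-u-plus a b)) (trans (cong sgn (sym u≡)) sgn-u))
    find (inj₂ res≢0) = (a , b) , minus sgn≡-1 u≡ y≡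
      where
      seventh = residue-support 7 2 y (-≢0 res≢0)
      w = proj₁ seventh
      -- Likewise - (14 b + 5) = 7 (1 + 2 s) - 6 (2 + 7 w).
      b = + 3 * w - s
      a = u - + 7 * b - + 4 - + 2 * k
      y-id : ∀ s t → - (+ 14 * (+ 3 * t - s) + + 5) ≡ + 2 + t * + 7 + + 7 * (+ 1 + s * + 2 - (+ 2 + t * + 7))
      y-id = solve-∀
      y≡ : y ≡ - (+ 14 * b + + 5)
      y≡ = sym (trans (y-id s w) (trans (+-*-vanish (+ 2 + w * + 7) (+ 7)
        (trans (sym (proj₂ y-half)) (proj₂ seventh))) (sym (proj₂ seventh))))
      u-id : ∀ u b k → + 5 * (u - + 7 * b - + 4 - + 2 * k) + + 7 * b + + 4 ≡
        u + + 2 * (+ 2 * u + - (+ 14 * b + + 5) - (+ 3 + k * + 5))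
      u-id = solve-∀
      u≡ : u ≡ + 5 * a + + 7 * b + + 4
      u≡ = sym (trans (u-id u b k) (+-*-vanish u (+ 2) (trans (cong (_+_ (+ 2 * u)) (sym y≡)) (proj₂ x-fifth))))
      sgn≡-1 : sgn a * sgn b ≡ - + 1
      sgn≡-1 = trans (sym (sgn-u-minus a b)) (trans (cong sgn (sym u≡)) sgn-u)

  XY-functional : ∀ {p r r′} → XY p r → XY p r′ → r ≡ r′
  XY-functional (plus _ refl refl)  (plus _ refl refl)  = refl
  XY-functional (minus _ refl refl) (minus _ refl refl) = refl
  XY-functional (plus s _ _)  (minus s′ _ _) = contradiction (trans (sym s) s′) λ ()
  XY-functional (minus s _ _) (plus s′ _ _)  = contradiction (trans (sym s) s′) λ ()

  linear-injective : ∀ c .{{_ : ℤ.NonZero c}} e {x y} → c * x + e ≡ c * y + e → x ≡ y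
  linear-injective c e {x} {y} eq = ℤ.*-cancelˡ-≡ c x y (+-cancelʳ e {c * x} {c * y} eq)

  XY-injective : ∀ {p p′ r} → XY p r → XY p′ r → p ≡ p′
  XY-injective (plus {a} {b} _ u≡ y≡) (plus {a′} {b′} _ u≡′ y≡′)
    with linear-injective (+ 14) (+ 5) {b} {b′} (trans (sym y≡) y≡′)
  ... | refl = cong (_, b) (ℤ.*-cancelˡ-≡ (+ 5) a a′ (+-cancelʳ (- (+ 7 * b)) {+ 5 * a} {+ 5 * a′}
      (+-cancelʳ (- + 1) {+ 5 * a - + 7 * b} {+ 5 * a′ - + 7 * b} (trans (sym u≡) u≡′))))
  XY-injective (minus {a} {b} _ u≡ y≡) (minus {a′} {b′} _ u≡′ y≡′)
    with linear-injective (+ 14) (+ 5) {b} {b′} (ℤ.neg-injective (trans (sym y≡) y≡′))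
  ... | refl = cong (_, b) (ℤ.*-cancelˡ-≡ (+ 5) a a′ (+-cancelʳ (+ 7 * b) {+ 5 * a} {+ 5 * a′}
      (+-cancelʳ (+ 4) {+ 5 * a + + 7 * b} {+ 5 * a′ + + 7 * b} (trans (sym u≡) u≡′))))
  -- No point lies in both branches: y is 5 modulo 7 in one and 2 in the other, and `σ₇` tells them
  -- apart.
  XY-injective (plus {a} {b} _ _ y≡) (minus {a′} {b′} _ _ y≡′) = contradiction
    (trans (sym (σ₇-plus b)) (trans (cong σ₇ (trans (sym y≡) y≡′))
      (trans (σ₇-neg (+ 14 * b′ + + 5)) (cong -_ (σ₇-plus b′))))) λ ()
  XY-injective (minus {a} {b} _ _ y≡) (plus {a′} {b′} _ _ y≡′) = contradiction
    (trans (sym (σ₇-plus b′)) (trans (cong σ₇ (trans (sym y≡′) y≡))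
      (trans (σ₇-neg (+ 14 * b + + 5)) (cong -_ (σ₇-plus b))))) λ ()

  θ₅θ₇-box : ∀ p → θ₅θ₇ p ≢ + 0 → InBox R p
  θ₅θ₇-box (a , b) w≢0 =
      ℕ.≤-trans (TripleProduct.∣k∣≤expo 4 1 a) (ℕ.≤-trans (ℕ.m≤m+n (e₅ a) (e₇ b)) e≤R)
    , ℕ.≤-trans (TripleProduct.∣k∣≤expo 6 1 b) (ℕ.≤-trans (ℕ.m≤n+m (e₇ b) (e₅ a)) e≤R)
    where
    e≤R : e₅ a ℕ.+ e₇ b ≤ R
    e≤R = subst (_≤ R) (mono-≢0 (proj₂ (*-≢0 (sgn a * sgn b) (mono (e₅ a ℕ.+ e₇ b) n) w≢0))) n≤R

  θ₅θ₇-sum : bsum₂ R θ₅θ₇ ≡ bsum₂ R (weight odd odd)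
  θ₅θ₇-sum = bsum₂-matching record
    { Rel = XY
    ; to = λ p _ → let r , p~r = XY-total p in r , XY-weight p~r , p~r
    ; from = λ r w≢0 → let p , p~r = XY-surjective r w≢0 in p , sym (XY-weight p~r) , p~r
    ; functional = XY-functional
    ; injective = XY-injective
    ; boxˡ = θ₅θ₇-box
    ; boxʳ = weight-box odd odd
    }

-- The product of (q;q)_∞ and the left-hand side

module EtaProduct (n R : ℕ) (bound : 840 ℕ.* n ℕ.+ 564 ≤ R) where
  open TwoVariable n R bound
  open ThetaProducts n R bound

  θ₃S : Weight
  θ₃S (c , j) = sgn c * h j * mono (e₃ c ℕ.+ eS j) n

  -- Numbers 6 c + 1 meet only one of the classes ± 1 modulo 6, hence the two signs. The sign is
  -- determined by j, because j = 7 u + 6 y is congruent to u modulo 6.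
  CJ : Plane → Plane → Set
  CJ (c , j) (u , y) = + 7 * u + + 6 * y ≡ j × (u ≡ + 6 * c + + 1 ⊎ u ≡ - (+ 6 * c + + 1))

  1+6c : ∀ c → + 6 * c + + 1 ≡ + 1 + c * + 6
  1+6c = solve-∀

  -- Write j = ± 1 + 6 i. Then `χ₁₂ j` is (-1)^i, and i has the parity of 1 + c + y. Multiplied by
  -- the pentagonal sign (-1)^c, this leaves - (-1)^y.
  χ₁₂-sgn : ∀ {c j u y} → CJ (c , j) (u , y) → χ₁₂ j ≡ - (sgn c * sgn y)
  χ₁₂-sgn {c} {_} {_} {y} (refl , inj₁ refl) = begin
    χ₁₂ (+ 7 * (+ 6 * c + + 1) + + 6 * y)      ≡⟨ cong χ₁₂ (identity c y) ⟩
    χ₁₂ (+ 1 + (+ 1 + (c + y) + + 3 * c * + 2) * + 6)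
      ≡⟨ χ₁₂-1 (+ 1 + (c + y) + + 3 * c * + 2) ⟩
    sgn (+ 1 + (c + y) + + 3 * c * + 2)        ≡⟨ sgn-periodic (+ 1 + (c + y)) (+ 3 * c) ⟩
    sgn (+ 1 + (c + y))                        ≡⟨ trans (sgn-suc (c + y)) (cong -_ (sgn-+ c y)) ⟩
    - (sgn c * sgn y)                          ∎
    where
    open ≡-Reasoning
    identity : ∀ c y → + 7 * (+ 6 * c + + 1) + + 6 * y ≡ + 1 + (+ 1 + (c + y) + + 3 * c * + 2) * + 6
    identity = solve-∀
  χ₁₂-sgn {c} {_} {_} {y} (refl , inj₂ refl) = begin
    χ₁₂ (+ 7 * - (+ 6 * c + + 1) + + 6 * y)    ≡⟨ cong χ₁₂ (identity c y) ⟩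
    χ₁₂ (- + 1 + (+ 1 + (c + y) + (- (+ 4 * c) - + 1) * + 2) * + 6)
      ≡⟨ χ₁₂-[-1] (+ 1 + (c + y) + (- (+ 4 * c) - + 1) * + 2) ⟩
    sgn (+ 1 + (c + y) + (- (+ 4 * c) - + 1) * + 2)  ≡⟨ sgn-periodic (+ 1 + (c + y)) (- (+ 4 * c) - + 1) ⟩
    sgn (+ 1 + (c + y))                        ≡⟨ trans (sgn-suc (c + y)) (cong -_ (sgn-+ c y)) ⟩
    - (sgn c * sgn y)                          ∎
    where
    open ≡-Reasoning
    identity : ∀ c y → + 7 * - (+ 6 * c + + 1) + + 6 * y ≡
      - + 1 + (+ 1 + (c + y) + (- (+ 4 * c) - + 1) * + 2) * + 6
    identity = solve-∀

  unit₆-CJ : ∀ {c u} → u ≡ + 6 * c + + 1 ⊎ u ≡ - (+ 6 * c + + 1) → unit₆ u ≡ + 1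
  unit₆-CJ {c} (inj₁ refl) = trans (cong unit₆ (1+6c c)) (unit₆-periodic (+ 1) c)
  unit₆-CJ {c} (inj₂ refl) = trans (unit₆-neg (+ 6 * c + + 1)) (unit₆-CJ {c} (inj₁ refl))

  u²-CJ : ∀ {c u} → u ≡ + 6 * c + + 1 ⊎ u ≡ - (+ 6 * c + + 1) → u * u ≡ (+ 6 * c + + 1) * (+ 6 * c + + 1)
  u²-CJ     (inj₁ refl) = refl
  u²-CJ {c} (inj₂ refl) = identity c
    where
    identity : ∀ c → - (+ 6 * c + + 1) * - (+ 6 * c + + 1) ≡ (+ 6 * c + + 1) * (+ 6 * c + + 1)
    identity = solve-∀

  ε₅-CJ : ∀ u y → ε₅ (+ 2 * u + y) ≡ ε₅ (+ 7 * u + + 6 * y)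
  ε₅-CJ u y = sym (trans (cong ε₅ (identity u y)) (ε₅-periodic (+ 2 * u + y) (u + y)))
    where
    identity : ∀ u y → + 7 * u + + 6 * y ≡ + 2 * u + y + (u + y) * + 5
    identity = solve-∀

  -- Modulo 7, j = 7 u + 6 y is - y, and `σ₇` is odd; this is the origin of the minus sign in `h`.
  σ₇-CJ : ∀ u y → σ₇ y ≡ - σ₇ (+ 7 * u + + 6 * y)
  σ₇-CJ u y = trans (sym (ℤ.neg-involutive (σ₇ y))) (cong -_ (sym
    (trans (cong σ₇ (identity u y)) (trans (σ₇-periodic (- y) (u + y)) (σ₇-neg y)))))
    where
    identity : ∀ u y → + 7 * u + + 6 * y ≡ - y + (u + y) * + 7
    identity = solve-∀

  CJ-weight : ∀ c j u y → CJ (c , j) (u , y) → h j ≢ + 0 →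
    weight unit₆ (λ y → - sgn y) (u , y) ≡ θ₃S (c , j)
  CJ-weight c j u y c~u@(refl , u≡) h≢0 = begin
    weight unit₆ (λ y → - sgn y) (u , y)
      ≡⟨ weight-value unit₆ (λ y → - sgn y) u y (e₃ c ℕ.+ eS j) (unit₆-CJ {c} u≡) sgn-y (ε₅-CJ u y) (σ₇-CJ u y)
           (trans (cong (λ x → j * j + + 35 * x) (u²-CJ {c} u≡)) (sym (level-cj c j h≢0))) ⟩
    + 1 * (χ₁₂ j * sgn c) * (ε₅ j * - σ₇ j * mono (e₃ c ℕ.+ eS j) n)
      ≡⟨ rearrange (χ₁₂ j) (sgn c) (ε₅ j) (- σ₇ j) (mono (e₃ c ℕ.+ eS j) n) ⟩
    sgn c * (ε₅ j * χ₁₂ j * - σ₇ j) * mono (e₃ c ℕ.+ eS j) n ∎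
    where
    open ≡-Reasoning
    rearrange : ∀ x s e z m → + 1 * (x * s) * (e * z * m) ≡ s * (e * x * z) * m
    rearrange = solve-∀
    cancel : ∀ s r → - (s * r) * s ≡ - r * (s * s)
    cancel = solve-∀
    sgn-y : - sgn y ≡ χ₁₂ j * sgn c
    sgn-y = sym (trans (cong (_* sgn c) (χ₁₂-sgn {c} {j} {u} {y} c~u)) (trans (cancel (sgn c) (sgn y))
      (trans (cong (- sgn y *_) (sgn-square c)) (ℤ.*-identityʳ (- sgn y)))))

  CJ-total : ∀ c j → h j ≢ + 0 → ∃[ r ] CJ (c , j) r
  CJ-total c j h≢0 = find (χ₁₂-support j (proj₂ (*-≢0 (ε₅ j) (χ₁₂ j) (proj₁ (*-≢0 (ε₅ j * χ₁₂ j) (- σ₇ j) h≢0)))))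
    where
    χ₁₂-support : ∀ j → χ₁₂ j ≢ + 0 → ∃[ i ] (j ≡ + 1 + i * + 6 ⊎ j ≡ - + 1 + i * + 6)
    χ₁₂-support j χ≢0 with +-≢0 (residue 12 1 j - residue 12 5 j - residue 12 7 j) (residue 12 11 j) χ≢0
    ... | inj₂ ≢0 = let k , j≡ = residue-support 12 11 j ≢0 in
      + 2 + k * + 2 , inj₂ (trans j≡ (identity k))
      where
      identity : ∀ k → + 11 + k * + 12 ≡ - + 1 + (+ 2 + k * + 2) * + 6
      identity = solve-∀
    ... | inj₁ χ≢0′ with +-≢0 (residue 12 1 j - residue 12 5 j) (- residue 12 7 j) χ≢0′
    ...   | inj₂ ≢0 = let k , j≡ = residue-support 12 7 j (-≢0 ≢0) in
      + 1 + k * + 2 , inj₁ (trans j≡ (identity k))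
      where
      identity : ∀ k → + 7 + k * + 12 ≡ + 1 + (+ 1 + k * + 2) * + 6
      identity = solve-∀
    ...   | inj₁ χ≢0″ with +-≢0 (residue 12 1 j) (- residue 12 5 j) χ≢0″
    ...     | inj₁ ≢0 = let k , j≡ = residue-support 12 1 j ≢0 in
      k * + 2 , inj₁ (trans j≡ (identity k))
      where
      identity : ∀ k → + 1 + k * + 12 ≡ + 1 + (k * + 2) * + 6
      identity = solve-∀
    ...     | inj₂ ≢0 = let k , j≡ = residue-support 12 5 j (-≢0 ≢0) in
      + 1 + k * + 2 , inj₂ (trans j≡ (identity k))
      where
      identity : ∀ k → + 5 + k * + 12 ≡ - + 1 + (+ 1 + k * + 2) * + 6
      identity = solve-∀
    find : ∃[ i ] (j ≡ + 1 + i * + 6 ⊎ j ≡ - + 1 + i * + 6) → ∃[ r ] CJ (c , j) r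
    find (i , inj₁ j≡) = (+ 6 * c + + 1 , i - + 7 * c - + 1) , trans (identity i c) (sym j≡) , inj₁ refl
      where
      identity : ∀ i c → + 7 * (+ 6 * c + + 1) + + 6 * (i - + 7 * c - + 1) ≡ + 1 + i * + 6
      identity = solve-∀
    find (i , inj₂ j≡) = (- (+ 6 * c + + 1) , i + + 7 * c + + 1) , trans (identity i c) (sym j≡) , inj₂ refl
      where
      identity : ∀ i c → + 7 * - (+ 6 * c + + 1) + + 6 * (i + + 7 * c + + 1) ≡ - + 1 + i * + 6
      identity = solve-∀

  CJ-surjective : ∀ u y → unit₆ u ≢ + 0 → ∃[ c ] CJ (c , + 7 * u + + 6 * y) (u , y)
  CJ-surjective u y unit≢0 with +-≢0 (residue 6 1 u) (residue 6 5 u) unit≢0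
  ... | inj₁ ≢0 = let k , u≡ = residue-support 6 1 u ≢0 in k , refl , inj₁ (trans u≡ (sym (1+6c k)))
  ... | inj₂ ≢0 = let k , u≡ = residue-support 6 5 u ≢0 in - k - + 1 , refl , inj₂ (trans u≡ (identity k))
    where
    identity : ∀ k → + 5 + k * + 6 ≡ - (+ 6 * (- k - + 1) + + 1)
    identity = solve-∀

  plus%6 : ∀ c → (+ 6 * c + + 1) %ℕ 6 ≡ 1
  plus%6 c = trans (cong (_%ℕ 6) (1+6c c)) (%ℕ-periodic 6 (+ 1) c)

  minus%6 : ∀ c → (- (+ 6 * c + + 1)) %ℕ 6 ≡ 5
  minus%6 c = trans (cong (_%ℕ 6) (identity c)) (%ℕ-periodic 6 (- + 1) (- c))
    where
    identity : ∀ c → - (+ 6 * c + + 1) ≡ - + 1 + - c * + 6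
    identity = solve-∀

  plus≢minus : ∀ c c′ z z′ → + 6 * c + + 1 + z * + 6 ≢ - (+ 6 * c′ + + 1) + z′ * + 6
  plus≢minus c c′ z z′ eq = contradiction (trans (sym (trans (%ℕ-periodic 6 (+ 6 * c + + 1) z) (plus%6 c)))
    (trans (cong (_%ℕ 6) eq) (trans (%ℕ-periodic 6 (- (+ 6 * c′ + + 1)) z′) (minus%6 c′)))) λ ()

  CJ-mod6 : ∀ u y → + 7 * u + + 6 * y ≡ u + (u + y) * + 6
  CJ-mod6 = solve-∀

  CJ-functional : ∀ {p r r′} → CJ p r → CJ p r′ → r ≡ r′
  CJ-functional {c , j} {u , y} {u′ , y′} (j≡ , u≡) (j≡′ , u≡′) with same u≡ u≡′
    where
    eq : u + (u + y) * + 6 ≡ u′ + (u′ + y′) * + 6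
    eq = trans (sym (CJ-mod6 u y)) (trans (trans j≡ (sym j≡′)) (CJ-mod6 u′ y′))
    same : u ≡ + 6 * c + + 1 ⊎ u ≡ - (+ 6 * c + + 1) → u′ ≡ + 6 * c + + 1 ⊎ u′ ≡ - (+ 6 * c + + 1) → u ≡ u′
    same (inj₁ e) (inj₁ e′) = trans e (sym e′)
    same (inj₂ e) (inj₂ e′) = trans e (sym e′)
    same (inj₁ refl) (inj₂ refl) = contradiction eq (plus≢minus c c (u + y) (u′ + y′))
    same (inj₂ refl) (inj₁ refl) = contradiction (sym eq) (plus≢minus c c (u′ + y′) (u + y))
  ... | refl = cong (u ,_) (ℤ.*-cancelˡ-≡ (+ 6) y y′
    (RingProperties.+-cancelˡ ℤ.+-*-ring (+ 7 * u) (+ 6 * y) (+ 6 * y′) (trans j≡ (sym j≡′))))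

  CJ-injective : ∀ {p p′ r} → CJ p r → CJ p′ r → p ≡ p′
  CJ-injective {c , j} {c′ , j′} {u , y} (j≡ , u≡) (j≡′ , u≡′) = cong₂ _,_ (same u≡ u≡′) (trans (sym j≡) j≡′)
    where
    same : u ≡ + 6 * c + + 1 ⊎ u ≡ - (+ 6 * c + + 1) → u ≡ + 6 * c′ + + 1 ⊎ u ≡ - (+ 6 * c′ + + 1) → c ≡ c′
    same (inj₁ e) (inj₁ e′) = linear-injective (+ 6) (+ 1) {c} {c′} (trans (sym e) e′)
    same (inj₂ e) (inj₂ e′) = linear-injective (+ 6) (+ 1) {c} {c′} (ℤ.neg-injective (trans (sym e) e′))
    same (inj₁ e) (inj₂ e′) = contradiction (cong (_+ + 0 * + 6) (trans (sym e) e′)) (plus≢minus c c′ (+ 0) (+ 0))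
    same (inj₂ e) (inj₁ e′) = contradiction (cong (_+ + 0 * + 6) (trans (sym e′) e)) (plus≢minus c′ c (+ 0) (+ 0))

  θ₃S-≢0 : ∀ c j → θ₃S (c , j) ≢ + 0 → h j ≢ + 0 × n ≡ e₃ c ℕ.+ eS j
  θ₃S-≢0 c j w≢0 = proj₂ (*-≢0 (sgn c) (h j) (proj₁ split)) , mono-≢0 (proj₂ split)
    where split = *-≢0 (sgn c * h j) (mono (e₃ c ℕ.+ eS j) n) w≢0

  θ₃S-box : ∀ p → θ₃S p ≢ + 0 → InBox R p
  θ₃S-box (c , j) w≢0 =
      ℕ.≤-trans (TripleProduct.∣k∣≤expo 2 1 c) (ℕ.≤-trans (ℕ.m≤m+n (e₃ c) (eS j)) (subst (_≤ R) n≡ n≤R))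
    , ℕ.≤-trans (n≤n*n ℤ.∣ j ∣) (ℕ.≤-trans (ℕ.≤-reflexive (h-square j (proj₁ ≢0)))
        (ℕ.≤-trans (ℕ.+-mono-≤ (ℕ.*-monoʳ-≤ 840 eS≤n) (ℕ.m≤m+n 529 35)) bound))
    where
    ≢0 = θ₃S-≢0 c j w≢0
    n≡ = proj₂ ≢0
    eS≤n : eS j ≤ n
    eS≤n = subst (eS j ≤_) (sym n≡) (ℕ.m≤n+m (eS j) (e₃ c))

  -- `CJ-weight` needs a nonzero `h j`, since otherwise `eS j` carries no information. As `χ₁₂ j`
  -- squares to 1, a vanishing `h j` would make the factors `ε₅` and `σ₇` of the weight vanish.
  weight-h : ∀ u y c → CJ (c , + 7 * u + + 6 * y) (u , y) →
    weight unit₆ (λ y → - sgn y) (u , y) ≢ + 0 → h (+ 7 * u + + 6 * y) ≢ + 0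
  weight-h u y c c~u w≢0 h≡0 = w≢0 (begin
    unit₆ u * - sgn y * (ε₅ (+ 2 * u + y) * σ₇ y * δ (level n) (Q u y))
      ≡⟨ cong (λ z → unit₆ u * - sgn y * (z * δ (level n) (Q u y))) εσ≡0 ⟩
    unit₆ u * - sgn y * (+ 0 * δ (level n) (Q u y))
      ≡⟨ ℤ.*-zeroʳ (unit₆ u * - sgn y) ⟩
    + 0 ∎)
    where
    open ≡-Reasoning
    j = + 7 * u + + 6 * y
    regroup : ∀ e z x → e * z ≡ e * z * (x * x) → (e * x * z) * x ≡ e * z
    regroup e z x eq = trans (identity e z x) (sym eq)
      where
      identity : ∀ e z x → (e * x * z) * x ≡ e * z * (x * x)
      identity = solve-∀
    χ² : χ₁₂ j * χ₁₂ j ≡ + 1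
    χ² = trans (cong₂ _*_ χ≡ χ≡) (trans (identity (sgn c) (sgn y)) (cong₂ _*_ (sgn-square c) (sgn-square y)))
      where
      χ≡ = χ₁₂-sgn {c} {j} {u} {y} c~u
      identity : ∀ a b → - (a * b) * - (a * b) ≡ (a * a) * (b * b)
      identity = solve-∀
    εσ≡0 : ε₅ (+ 2 * u + y) * σ₇ y ≡ + 0
    εσ≡0 = begin
      ε₅ (+ 2 * u + y) * σ₇ y
        ≡⟨ cong₂ _*_ (ε₅-CJ u y) (σ₇-CJ u y) ⟩
      ε₅ j * - σ₇ j
        ≡⟨ sym (regroup (ε₅ j) (- σ₇ j) (χ₁₂ j)
             (sym (trans (cong (ε₅ j * - σ₇ j *_) χ²) (ℤ.*-identityʳ (ε₅ j * - σ₇ j))))) ⟩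
      h j * χ₁₂ j
        ≡⟨ cong (_* χ₁₂ j) h≡0 ⟩
      + 0 * χ₁₂ j ∎

  θ₃S-sum : bsum₂ R θ₃S ≡ bsum₂ R (weight unit₆ (λ y → - sgn y))
  θ₃S-sum = bsum₂-matching record
    { Rel = CJ
    ; to = λ (c , j) w≢0 → let h≢0 = proj₁ (θ₃S-≢0 c j w≢0)
                               (u , y) , c~u = CJ-total c j h≢0
                           in (u , y) , CJ-weight c j u y c~u h≢0 , c~u
    ; from = λ (u , y) w≢0 → let c , c~u = CJ-surjective u y (proj₁ (weight-≢0 unit₆ (λ y → - sgn y) u y w≢0))
                             in (c , + 7 * u + + 6 * y)
                              , sym (CJ-weight c (+ 7 * u + + 6 * y) u y c~u (weight-h u y c c~u w≢0))
                              , c~u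
    ; functional = λ {p} {r} {r′} → CJ-functional {p} {r} {r′}
    ; injective = λ {p} {p′} {r} → CJ-injective {p} {p′} {r}
    ; boxˡ = θ₃S-box
    ; boxʳ = weight-box unit₆ (λ y → - sgn y)
    }

  θ₃S≡θ₅θ₇ : bsum₂ R θ₃S ≡ bsum₂ R θ₅θ₇
  θ₃S≡θ₅θ₇ = trans θ₃S-sum (trans (sym odd-odd-sum) (sym θ₅θ₇-sum))

-- Multiplication by (q;q)_∞ and cancellation

module Assembly (N : ℕ) where
  open TruncatedProducts N
  open TruncatedPochhammers N
  open SetoidReasoning setoid

  -- One size for everything: as a radius it holds every point whose level is at most that of N, and
  -- as a product length it is at least 2 N, as the triple product requires.
  R : ℕ
  R = 840 ℕ.* N ℕ.+ 564

  N+N≤R : N ℕ.+ N ≤ R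
  N+N≤R = ℕ.≤-trans (ℕ.+-monoʳ-≤ N (ℕ.m≤n*m N 839)) (ℕ.m≤m+n (840 ℕ.* N) 564)

  N≤R : N ≤ R
  N≤R = ℕ.≤-trans (ℕ.m≤m+n N N) N+N≤R

  euler : ℕ → PS
  euler K = prodTo K (λ i → oneMinus (suc i))

  oneMinus-cong : ∀ {a b} → a ≡ b → oneMinus a ≋ oneMinus b
  oneMinus-cong {a} refl = ≋-refl {oneMinus a}

  exponent : ∀ r d K → r ℕ.+ K ℕ.* d ≡ r ℕ.+ d ℕ.* K
  exponent r d K = cong (r ℕ.+_) (ℕ.*-comm K d)

  -- The factors are sorted by the residue of their exponents modulo 3, one block of three at a
  -- time.
  euler₃ : ∀ K → euler (K ℕ.* 3) ≋ poch 1 3 K ⊛ poch 2 3 K ⊛ poch 3 3 K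
  euler₃ zero    = ≋-sym (≋-trans (⊛-congʳ oneP (⊛-identityʳ≋ oneP)) (⊛-identityʳ≋ oneP))
  euler₃ (suc K) = ≋-trans
    (⊛-cong (⊛-cong (⊛-cong (euler₃ K)
      (oneMinus-cong (exponent 1 3 K))) (oneMinus-cong (exponent 2 3 K))) (oneMinus-cong (exponent 3 3 K)))
    (regroup₃ (poch 1 3 K) (poch 2 3 K) (poch 3 3 K)
      (oneMinus (1 ℕ.+ 3 ℕ.* K)) (oneMinus (2 ℕ.+ 3 ℕ.* K)) (oneMinus (3 ℕ.+ 3 ℕ.* K)))

  euler₅ : ∀ K → euler (K ℕ.* 5) ≋ poch 1 5 K ⊛ poch 2 5 K ⊛ poch 3 5 K ⊛ poch 4 5 K ⊛ poch 5 5 K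
  euler₅ zero    = ≋-sym (≋-trans (⊛-identityʳ≋ (oneP ⊛ oneP ⊛ oneP ⊛ oneP)) (≋-trans
    (⊛-identityʳ≋ (oneP ⊛ oneP ⊛ oneP)) (≋-trans (⊛-identityʳ≋ (oneP ⊛ oneP)) (⊛-identityʳ≋ oneP))))
  euler₅ (suc K) = ≋-trans
    (⊛-cong (⊛-cong (⊛-cong (⊛-cong (⊛-cong (euler₅ K)
      (oneMinus-cong (exponent 1 5 K))) (oneMinus-cong (exponent 2 5 K))) (oneMinus-cong (exponent 3 5 K)))
      (oneMinus-cong (exponent 4 5 K))) (oneMinus-cong (exponent 5 5 K)))
    (regroup₅ (poch 1 5 K) (poch 2 5 K) (poch 3 5 K) (poch 4 5 K) (poch 5 5 K)
      (oneMinus (1 ℕ.+ 5 ℕ.* K)) (oneMinus (2 ℕ.+ 5 ℕ.* K)) (oneMinus (3 ℕ.+ 5 ℕ.* K))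
      (oneMinus (4 ℕ.+ 5 ℕ.* K)) (oneMinus (5 ℕ.+ 5 ℕ.* K)))

  -- (q;q)_∞ cut at a multiple of 3, to be split modulo 3. Any cut past N gives the same class, so
  -- `D≋euler₅` may cut it again at a multiple of 5.
  D D⁻¹ : PS
  D   = euler (R ℕ.* 3)
  D⁻¹ = prodTo (R ℕ.* 3) (λ i → geomInv (suc i))

  D-inverse : D ⊛ D⁻¹ ≋ oneP
  D-inverse = prodTo-⊛-inverse (R ℕ.* 3) λ i → ≈⇒≋ (oneMinus-⊛-geomInv (suc i))

  D≋euler₅ : D ≋ euler (R ℕ.* 5)
  D≋euler₅ = prodTo-stable (λ i N≤i → oneMinus-high (s≤s N≤i))
    (ℕ.≤-trans N≤R (ℕ.m≤m*n R 3)) (ℕ.≤-trans N≤R (ℕ.m≤m*n R 5))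

  D≋θ₃ : D ≋ theta R sgn e₃
  D≋θ₃ = begin
    D                                          ≈⟨ euler₃ R ⟩
    poch 1 3 R ⊛ poch 2 3 R ⊛ poch 3 3 R       ≈⟨ swap₁₂ (poch 1 3 R) (poch 2 3 R) (poch 3 3 R) ⟩
    poch 2 3 R ⊛ poch 1 3 R ⊛ poch 3 3 R       ≈⟨ JacobiTripleProduct.triple-product 2 1 N N+N≤R ⟩
    theta R sgn e₃                             ∎

  poch-⊛-invPoch : ∀ a d .{{_ : ℕ.NonZero a}} → poch a d R ⊛ invPoch a d R ≋ oneP
  poch-⊛-invPoch (suc a) d = prodTo-⊛-inverse R λ i → ≈⇒≋ (oneMinus-⊛-geomInv (suc a ℕ.+ d ℕ.* i))

  D⊛rhs : D ⊛ rhsSeries ≋ theta R sgn e₅ ⊛ theta R sgn e₇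
  D⊛rhs = begin
    D ⊛ rhsSeries
      ≈⟨ ⊛-cong (≋-trans D≋euler₅ (euler₅ R)) (⊛-cong
           (⊛-cong (⊛-cong (poch∞≋poch 1 7 N≤R) (poch∞≋poch 6 7 N≤R)) (poch∞≋poch 7 7 N≤R))
           (⊛-cong (invPoch∞≋invPoch 2 5 N≤R) (invPoch∞≋invPoch 3 5 N≤R))) ⟩
    (poch 1 5 R ⊛ poch 2 5 R ⊛ poch 3 5 R ⊛ poch 4 5 R ⊛ poch 5 5 R)
      ⊛ ((poch 1 7 R ⊛ poch 6 7 R ⊛ poch 7 7 R) ⊛ (invPoch 2 5 R ⊛ invPoch 3 5 R))
      ≈⟨ regroup-products (poch 1 5 R) (poch 2 5 R) (poch 3 5 R) (poch 4 5 R) (poch 5 5 R)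
           (poch 1 7 R) (poch 6 7 R) (poch 7 7 R) (invPoch 2 5 R) (invPoch 3 5 R) ⟩
    ((poch 4 5 R ⊛ poch 1 5 R ⊛ poch 5 5 R) ⊛ (poch 6 7 R ⊛ poch 1 7 R ⊛ poch 7 7 R))
      ⊛ ((poch 2 5 R ⊛ invPoch 2 5 R) ⊛ (poch 3 5 R ⊛ invPoch 3 5 R))
      ≈⟨ ⊛-cong (⊛-cong (JacobiTripleProduct.triple-product 4 1 N N+N≤R)
                        (JacobiTripleProduct.triple-product 6 1 N N+N≤R))
                (≋-trans (⊛-cong (poch-⊛-invPoch 2 5) (poch-⊛-invPoch 3 5)) (⊛-identityʳ≋ oneP)) ⟩
    (theta R sgn e₅ ⊛ theta R sgn e₇) ⊛ oneP
      ≈⟨ ⊛-identityʳ≋ (theta R sgn e₅ ⊛ theta R sgn e₇) ⟩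
    theta R sgn e₅ ⊛ theta R sgn e₇ ∎

  lhs≋theta : lhsSeries ≋ theta R h eS
  lhs≋theta = trunc λ n n≤N → lhsSeries≡theta R n
    (ℕ.+-mono-≤ (ℕ.*-monoʳ-≤ 840 n≤N) (ℕ.m≤m+n 529 35))

  D⊛lhs : D ⊛ lhsSeries ≋ theta R sgn e₅ ⊛ theta R sgn e₇
  D⊛lhs = ≋-trans (⊛-cong D≋θ₃ lhs≋theta) (trunc λ n n≤N →
    trans (theta-⊛-theta R sgn e₃ h eS n)
      (trans (EtaProduct.θ₃S≡θ₅θ₇ n R (ℕ.+-monoˡ-≤ 564 (ℕ.*-monoʳ-≤ 840 n≤N)))
        (sym (theta-⊛-theta R sgn e₅ sgn e₇ n))))

  D-cancel : ∀ {f} → f ≋ (D ⊛ f) ⊛ D⁻¹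
  D-cancel {f} = begin
    f                  ≈⟨ ≋-sym (⊛-identityʳ≋ f) ⟩
    f ⊛ oneP           ≈⟨ ⊛-congˡ f (≋-sym D-inverse) ⟩
    f ⊛ (D ⊛ D⁻¹)      ≈⟨ ≋-sym (⊛-assoc≋ f D D⁻¹) ⟩
    (f ⊛ D) ⊛ D⁻¹      ≈⟨ ⊛-congʳ D⁻¹ (⊛-comm≋ f D) ⟩
    (D ⊛ f) ⊛ D⁻¹      ∎

  lhs≋rhs : lhsSeries ≋ rhsSeries
  lhs≋rhs = begin
    lhsSeries                      ≈⟨ D-cancel {lhsSeries} ⟩
    (D ⊛ lhsSeries) ⊛ D⁻¹          ≈⟨ ⊛-congʳ D⁻¹ (≋-trans D⊛lhs (≋-sym D⊛rhs)) ⟩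
    (D ⊛ rhsSeries) ⊛ D⁻¹          ≈⟨ ≋-sym (D-cancel {rhsSeries}) ⟩
    rhsSeries                      ∎

theorem2 : (m : ℕ) → lhsSeries m ≡ rhsSeries m
theorem2 m = Truncated.coeff (Assembly.lhs≋rhs m) m ℕ.≤-refl
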